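{- Let $p$ be a prime, $q=p^e$ with $e$ a positive integer, and let $\xi\in\mathbb{F}_q$ satisfy $\mathrm{Tr}_{\mathbb{F}_q}(\xi)\neq 0$. Let $g(X)=X^p-X+\xi\in\mathbb{F}_q[X]$. Define sequences $\{a_n\}_{n\ge1},\{c_n\}_{n\ge1},\{d_n\}_{n\ge1}$ in $\mathbb{F}_q$ by $$a_1=\xi,\ c_1=1,\ d_1=0;\qquad a_2=-1,\ c_2=\xi,\ d_2=-1;$$ and for $n\ge 2$, $$a_{n+1}=-a_nd_n,\qquad c_{n+1}=c_n^2\bigl(\xi-(c_n^{ -1}d_n)^p+c_n^{ -1}d_n\bigr),\qquad d_{n+1}=-c_n^2$$ (all $c_n$ are nonzero under the hypothesis $\mathrm{Tr}_{\mathbb{F}_q}(\xi)\ne0$, so these are well defined). Then $g(X)$ is inversely stable over $\mathbb{F}_q$ if and only if $\mathrm{Tr}_{\mathbb{F}_q}(a_nc_n^{ -1})\neq 0$ for every positive integer $n$.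
   Context: $\mathrm{Tr}_{\mathbb{F}_q}$ denotes the absolute trace from $\mathbb{F}_q$ to $\mathbb{F}_p$. For $\varphi(X)\in\mathbb{F}_q[X]$, let $\Phi(X)=\frac{1}{\varphi(X)}$ and define iterates $\Phi^{(0)}(X)=X$, $\Phi^{(n)}(X)=\Phi(\Phi^{(n-1)}(X))$ for $n\ge1$. Let $d_{n,\varphi}(X)$ denote the denominator of the rational function $\Phi^{(n)}(X)$ (written as a quotient of coprime polynomials). The polynomial $\varphi$ is called inversely stable over $\mathbb{F}_q$ if all polynomials $d_{n,\varphi}(X)$, $n=1,2,\dots$, are irreducible over $\mathbb{F}_q$ and pairwise distinct. -}

module Defs where

open import Level using (Level; _⊔_)
open import Data.Nat as ℕ using (ℕ; zero; suc; _∸_; _^_; _≤_)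
open import Data.Nat.Primality using (Prime)
open import Data.Fin using (Fin)
open import Data.List using (List; []; _∷_; length)
open import Data.Product using (_×_; _,_; proj₁; proj₂; Σ; ∃)
open import Data.Sum using (_⊎_)
open import Relation.Nullary using (¬_)
open import Algebra.Bundles using (CommutativeRing)

-- Fields: a commutative ring with 1 ≉ 0 and a (total) inverse map that
-- is a multiplicative inverse on every nonzero element.  (0⁻¹ is some
-- unspecified element; it is never used in a way that matters.)

record Field (c ℓ : Level) : Set (Level.suc (c ⊔ ℓ)) where
  field
    commutativeRing : CommutativeRing c ℓ
  open CommutativeRing commutativeRing public
  field
    _⁻¹      : Carrier → Carrier
    1≉0      : ¬ (1# ≈ 0#)
    ⁻¹-inverse : ∀ x → ¬ (x ≈ 0#) → (x * (x ⁻¹)) ≈ 1#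

module FieldTheory {c ℓ : Level} (F : Field c ℓ) where
  open Field F

  HasCardinality : ℕ → Set (c ⊔ ℓ)
  HasCardinality q =
    Σ (Fin q → Carrier) λ enum →
      (∀ x → ∃ λ i → x ≈ enum i) × (∀ i j → enum i ≈ enum j → i ≡F j)
    where
      open import Relation.Binary.PropositionalEquality using () renaming (_≡_ to _≡F_)

  pow : Carrier → ℕ → Carrier
  pow x zero    = 1#
  pow x (suc n) = x * pow x n

  Tr : ℕ → ℕ → Carrier → Carrier
  Tr p zero    x = 0#
  Tr p (suc i) x = Tr p i x + pow x (p ^ i)

  -- Polynomials over F as coefficient lists (constant term first);
  -- trailing zeros allowed, equality is coefficientwise ≈.

  Poly : Set c
  Poly = List Carrier

  coeff : Poly → ℕ → Carrier
  coeff []       _       = 0#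
  coeff (a ∷ f)  zero    = a
  coeff (a ∷ f)  (suc i) = coeff f i

  _≈ₚ_ : Poly → Poly → Set ℓ
  f ≈ₚ g = ∀ i → coeff f i ≈ coeff g i

  _+ₚ_ : Poly → Poly → Poly
  []      +ₚ g       = g
  (a ∷ f) +ₚ []      = a ∷ f
  (a ∷ f) +ₚ (b ∷ g) = (a + b) ∷ (f +ₚ g)

  scale : Carrier → Poly → Poly
  scale a []      = []
  scale a (b ∷ f) = (a * b) ∷ scale a f

  _*ₚ_ : Poly → Poly → Poly
  []      *ₚ g = []
  (a ∷ f) *ₚ g = scale a g +ₚ (0# ∷ (f *ₚ g))

  constP : Carrier → Poly
  constP a = a ∷ []

  Xₚ : Poly
  Xₚ = 0# ∷ 1# ∷ []

  powP : Poly → ℕ → Poly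
  powP f zero    = constP 1#
  powP f (suc n) = f *ₚ powP f n

  IsZeroP : Poly → Set ℓ
  IsZeroP f = ∀ i → coeff f i ≈ 0#

  IsConstP : Poly → Set ℓ
  IsConstP f = ∀ i → coeff f (suc i) ≈ 0#

  _∣ₚ_ : Poly → Poly → Set (c ⊔ ℓ)
  a ∣ₚ f = ∃ λ k → f ≈ₚ (k *ₚ a)

  -- coprime: every common divisor is a constant (a unit, or 0 which
  -- cannot divide a nonzero polynomial)
  CoprimeP : Poly → Poly → Set (c ⊔ ℓ)
  CoprimeP f g = ∀ a → a ∣ₚ f → a ∣ₚ g → IsConstP a

  Irreducible : Poly → Set (c ⊔ ℓ)
  Irreducible f = ¬ IsConstP f × (∀ a b → f ≈ₚ (a *ₚ b) → IsConstP a ⊎ IsConstP b)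

  Associated : Poly → Poly → Set (c ⊔ ℓ)
  Associated f g = ∃ λ u → ¬ (u ≈ 0#) × (f ≈ₚ scale u g)

  -- Iterates of Φ = 1/φ as rational functions N/D (pairs of polynomials).
  -- With m = length φ ∸ 1 (≥ deg φ):  Φ(N/D) = D^m / H(N,D),
  -- H(N,D) = Σ_i φ_i N^i D^(m-i).

  homog : Poly → Poly → Poly → Poly
  homog φ N D = go 0 φ
    where
      m : ℕ
      m = length φ ∸ 1
      go : ℕ → Poly → Poly
      go i []       = []
      go i (a ∷ as) = scale a (powP N i *ₚ powP D (m ∸ i)) +ₚ go (suc i) as

  -- Φ^(n)(X) = proj₁ (iterΦ φ n) / proj₂ (iterΦ φ n)  (not reduced)
  iterΦ : Poly → ℕ → Poly × Poly
  iterΦ φ zero    = Xₚ , constP 1#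
  iterΦ φ (suc n) with iterΦ φ n
  ... | N , D = powP D (length φ ∸ 1) , homog φ N D

  -- d is a denominator of Φ^(n) written as a quotient of coprime
  -- polynomials: Φ^(n) = N/d with N, d coprime, d ≠ 0.
  -- (Such d is determined up to a nonzero constant factor.)
  IsDenominator : Poly → ℕ → Poly → Set (c ⊔ ℓ)
  IsDenominator φ n d =
    ¬ IsZeroP d ×
    ∃ λ N → CoprimeP N d ×
      ((N *ₚ proj₂ (iterΦ φ n)) ≈ₚ (d *ₚ proj₁ (iterΦ φ n)))

  -- φ is inversely stable over F: all d_{n,φ} (n ≥ 1) irreducible and
  -- pairwise distinct (distinct up to the constant-factor ambiguity).
  InverselyStable : Poly → Set (c ⊔ ℓ)
  InverselyStable φ =
    (∀ n → 1 ≤ n → ∀ d → IsDenominator φ n d → Irreducible d) ×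
    (∀ n m → 1 ≤ n → 1 ≤ m → ¬ (n ≡ m) → ∀ d d' →
       IsDenominator φ n d → IsDenominator φ m d' → ¬ Associated d d')
    where open import Relation.Binary.PropositionalEquality using (_≡_)

  gPoly : ℕ → Carrier → Poly
  gPoly p ξ = (powP Xₚ p +ₚ scale (- 1#) Xₚ) +ₚ constP ξ

  -- (a_n, c_n, d_n); index 0 is a dummy value, indices n ≥ 1 as in the paper
  acd : ℕ → Carrier → ℕ → Carrier × Carrier × Carrier
  acd p ξ zero = 0# , 0# , 0#
  acd p ξ (suc zero) = ξ , 1# , 0#
  acd p ξ (suc (suc zero)) = - 1# , ξ , - 1#
  acd p ξ (suc (suc (suc n))) with acd p ξ (suc (suc n))
  ... | a , c , d =
        - (a * d) ,
        (c * c) * ((ξ + - pow ((c ⁻¹) * d) p) + ((c ⁻¹) * d)) ,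
        - (c * c)

  aₙ cₙ dₙ : ℕ → Carrier → ℕ → Carrier
  aₙ p ξ n = proj₁ (acd p ξ n)
  cₙ p ξ n = proj₁ (proj₂ (acd p ξ n))
  dₙ p ξ n = proj₂ (proj₂ (acd p ξ n))

{-# OPTIONS --safe #-}
-- A root y of the n-th denominator D_n starts a chain y = y_n, ..., y_1 with
-- g(y_{k+1}) = v_k, where v_0 = 0 and v_k = 1/y_k. Each step is an Artin-Schreier
-- equation y^p - y = v_k - ξ: with m = p^k, Frobenius gives y^(q^m) = y + τ_k, where
-- τ_k is the trace of v_k - ξ down to F_p. Summing 1/(y - x) over the p conjugates
-- y + jτ_k gives -1/(v_k - g(x)), so the traces of 1/(v_k - g(x)) obey a recursion
-- in k, whose value at x = 0 is a_{k+1}/c_{k+1} up to sign.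
--
-- If all τ_k are nonzero, a polynomial relation of degree < p^(k+1) for y, written in
-- base g, has p distinct roots y + jτ_k, so its coefficients are relations of degree
-- < p^k for v_k; by induction they vanish. Hence every nonconstant factor of D_n has
-- degree at least p^n = deg D_n. Irreducibility need not be known beforehand: all of this
-- holds in any commutative F-algebra, in particular modulo a factor of D_n.
--
-- If τ_k = 0 for the first time and D_{k+1} were irreducible, choose b in F such that b v_k
-- has absolute trace Tr ξ. The absolute trace sum T of b v_k y is then fixed by x ↦ x^p, so it
-- lies in the prime field, but the automorphism y ↦ y + 1 changes it by Tr ξ ≠ 0.
module Submission where

open import Defs
open import Level using (Level; _⊔_)
open import Data.Nat using (ℕ; _≤_)
open import Data.Nat.Primality using (Prime)
open import Relation.Nullary using (¬_)
open import Function.Bundles using (_⇔_)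

open import Algebra.Bundles using (CommutativeRing)
import Algebra.Properties.CommutativeMonoid.Sum as Sum
import Algebra.Solver.Ring as Solver
open import Algebra.Solver.Ring.AlmostCommutativeRing using (fromCommutativeRing; _-Raw-AlmostCommutative⟶_; Induced-equivalence)
open import Data.Empty using (⊥-elim)
open import Data.Fin as Fin using (Fin; toℕ; fromℕ; inject₁; punchIn)
open import Data.Fin.Permutation using (Permutation; permutation)
import Data.Fin.Properties as Fin
open import Data.Integer as ℤ using (ℤ; +_; -[1+_])
import Data.Integer.Properties as ℤ
open import Data.List using ([]; _∷_; length; take; applyUpTo)
import Data.List.Properties as List
open import Data.Maybe using (just; nothing)
open import Data.Nat as ℕ using (zero; suc; _∸_; _<_; z≤n; s≤s)
open import Data.Nat.Combinatorics using (nCn≡1; k![n∸k]!∣n!) renaming (_C_ to _choose_)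
open import Data.Nat.Combinatorics.Specification using (nCk≡n!/k![n-k]!)
open import Data.Nat.Coprimality using (prime⇒coprime; coprime-Bézout)
open import Data.Nat.Divisibility using (_∣_; divides; ∣⇒≤; m∣m*n)
open import Data.Nat.DivMod using (m/n*n≡m)
import Data.Nat.GCD as GCD
open import Data.Nat.Primality using (euclidsLemma; prime⇒nonTrivial)
import Data.Nat.Properties as ℕ
open import Data.Product using (_×_; _,_; proj₁; proj₂; ∃)
open import Data.Sum using (_⊎_; inj₁; inj₂)
open import Function.Bundles using (mk⇔)
open import Relation.Binary.Definitions using (WeaklyDecidable)
open import Relation.Binary.PropositionalEquality as P using (_≡_)
open import Relation.Nullary using (Dec; yes; no)

-- In an algebra that may have zero divisors no element can be inverted merely because it is
-- nonzero, so every inverse has to be constructed. With `s = y - x` one has `s ^ p - s = v - g x`;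
-- hence an inverse of `v - g x`, multiplied by the cofactor `s ^ (p - 1) - 1`, inverts `s`, and a
-- Möbius substitution passes from `y` to `1 / y`. The start is `v = 0`, where `g x` is nonzero for
-- every `x` in F because its absolute trace is that of `ξ`. The same formula makes the partial
-- trace of `1 / s` computable: its first factor is fixed by the relevant Frobenius power, and the
-- sum of `(s + jτ) ^ (p - 1)` over the p translates is constantly -1. The sequences of the
-- statement come from evaluating the trace recursion at 0. Each step replaces `x` by
-- `Φ x = 1 / g x`, so the orbit of 0 under `Φ` appears; c and d are homogeneous coordinates of its
-- points, and a / c collects the product of squares that the recursion accumulates.

prime∤! : ∀ {p} → Prime p → ∀ k → k < p → ¬ (p ∣ k ℕ.!)
prime∤! pr zero k<p p∣1 = ℕ.<⇒≱ (ℕ.nonTrivial⇒n>1 _ {{prime⇒nonTrivial pr}}) (∣⇒≤ p∣1)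
prime∤! pr (suc k) k<p p∣ with euclidsLemma (suc k) (k ℕ.!) pr p∣
... | inj₁ p∣k = ℕ.<⇒≱ k<p (∣⇒≤ p∣k)
... | inj₂ p∣k! = prime∤! pr k (ℕ.<-trans (ℕ.n<1+n k) k<p) p∣k!

-- Multiplied by `k! * (p - k)!` the coefficient becomes `p!`, which `p` divides, whereas neither
-- factorial has a factor `p` because both arguments are below `p`.
prime∣C : ∀ {p} → Prime p → ∀ k → 0 < k → k < p → p ∣ (p choose k)
prime∣C {p@(suc p′)} pr k@(suc k′) 0<k k<p with euclidsLemma (p choose k) (k ℕ.! ℕ.* (p ∸ k) ℕ.!) pr (P.subst (p ∣_) (P.sym C*≡) (m∣m*n (p′ ℕ.!)))
  where
  instance
    d≢0 = ℕ.m*n≢0 (k ℕ.!) ((p ∸ k) ℕ.!) {{k ℕ.!≢0}} {{(p ∸ k) ℕ.!≢0}}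
  C*≡ : (p choose k) ℕ.* (k ℕ.! ℕ.* (p ∸ k) ℕ.!) ≡ p ℕ.!
  C*≡ = P.trans (P.cong (ℕ._* (k ℕ.! ℕ.* (p ∸ k) ℕ.!)) (nCk≡n!/k![n-k]! (ℕ.<⇒≤ k<p))) (m/n*n≡m (k![n∸k]!∣n! (ℕ.<⇒≤ k<p)))
... | inj₁ p∣C = p∣C
... | inj₂ p∣d with euclidsLemma (k ℕ.!) _ pr p∣d
...   | inj₁ p∣k! = ⊥-elim (prime∤! pr k k<p p∣k!)
...   | inj₂ p∣k! = ⊥-elim (prime∤! pr (p ∸ k) (s≤s (ℕ.m∸n≤m p′ k′)) p∣k!)

-- Commutative rings: integer constants for the solver, additivity of the p-th power

module RingTools {a ℓ : Level} (R : CommutativeRing a ℓ) where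
  open CommutativeRing R
  open import Algebra.Properties.Ring ring public
    using (-‿distribˡ-*; -‿distribʳ-*; -‿involutive; -0#≈0#; x+x≈x⇒x≈0)
  open import Algebra.Properties.AbelianGroup +-abelianGroup public using (⁻¹-∙-comm)
  open import Algebra.Properties.Semiring.Exp semiring public
  open import Algebra.Properties.CommutativeSemiring.Exp commutativeSemiring public using (^-distrib-*)
  open import Algebra.Properties.Semiring.Mult semiring public renaming (_×_ to _·_)
  open import Algebra.Properties.Semiring.Sum semiring public using (sum; sum-init-last; sum-cong-≋; sum-replicate-zero)
  open import Algebra.Properties.CommutativeSemiring.Binomial commutativeSemiring using (theorem; binomialTerm)
  open import Relation.Binary.Reasoning.Setoid setoid

  fromℤ : ℤ → Carrier
  fromℤ (+ n)    = n · 1#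
  fromℤ -[1+ n ] = - (suc n · 1#)

  private
    x+y-[x+z] : ∀ x y z → (x + y) + - (x + z) ≈ y + - z
    x+y-[x+z] x y z = begin
      (x + y) + - (x + z)       ≈⟨ +-cong (+-comm x y) (sym (⁻¹-∙-comm x z)) ⟩
      (y + x) + (- x + - z)     ≈⟨ +-assoc y x _ ⟩
      y + (x + (- x + - z))     ≈⟨ +-congˡ (+-assoc x (- x) (- z)) ⟨
      y + ((x + - x) + - z)     ≈⟨ +-congˡ (trans (+-congʳ (-‿inverseʳ x)) (+-identityˡ _)) ⟩
      y + - z                   ∎

    fromℤ-⊖ : ∀ m n → fromℤ (m ℤ.⊖ n) ≈ m · 1# + - (n · 1#)
    fromℤ-⊖ m       zero    = sym (trans (+-congˡ -0#≈0#) (+-identityʳ _))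
    fromℤ-⊖ zero    (suc n) = sym (+-identityˡ _)
    fromℤ-⊖ (suc m) (suc n) = trans (reflexive (P.cong fromℤ (ℤ.[1+m]⊖[1+n]≡m⊖n m n))) (trans (fromℤ-⊖ m n) (sym (x+y-[x+z] 1# _ _)))

    fromℤ-+ : ∀ i j → fromℤ (i ℤ.+ j) ≈ fromℤ i + fromℤ j
    fromℤ-+ (+ m)    (+ n)    = ×-homo-+ 1# m n
    fromℤ-+ (+ m)    -[1+ n ] = fromℤ-⊖ m (suc n)
    fromℤ-+ -[1+ m ] (+ n)    = trans (fromℤ-⊖ n (suc m)) (+-comm _ _)
    fromℤ-+ -[1+ m ] -[1+ n ] = begin
      - (suc (suc (m ℕ.+ n)) · 1#)      ≈⟨ -‿cong (×-congˡ (P.cong suc (P.sym (ℕ.+-suc m n)))) ⟩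
      - ((suc m ℕ.+ suc n) · 1#)        ≈⟨ -‿cong (×-homo-+ 1# (suc m) (suc n)) ⟩
      - (suc m · 1# + suc n · 1#)       ≈⟨ ⁻¹-∙-comm _ _ ⟨
      - (suc m · 1#) + - (suc n · 1#)   ∎

    fromℤ-neg : ∀ i → fromℤ (ℤ.- i) ≈ - fromℤ i
    fromℤ-neg (+ zero)   = sym -0#≈0#
    fromℤ-neg (+ suc n)  = refl
    fromℤ-neg -[1+ n ]   = sym (-‿involutive _)

    fromℤ-pos* : ∀ m j → fromℤ ((+ m) ℤ.* j) ≈ m · 1# * fromℤ j
    fromℤ-pos* m (+ n)    = trans (reflexive (P.cong fromℤ (P.sym (ℤ.pos-* m n)))) (×1-homo-* m n)
    fromℤ-pos* m -[1+ n ] = begin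
      fromℤ ((+ m) ℤ.* (ℤ.- (+ suc n)))  ≡⟨ P.cong fromℤ (ℤ.neg-distribʳ-* (+ m) (+ suc n)) ⟨
      fromℤ (ℤ.- ((+ m) ℤ.* (+ suc n)))  ≈⟨ fromℤ-neg ((+ m) ℤ.* (+ suc n)) ⟩
      - fromℤ ((+ m) ℤ.* (+ suc n))      ≈⟨ -‿cong (fromℤ-pos* m (+ suc n)) ⟩
      - (m · 1# * (suc n · 1#))          ≈⟨ -‿distribʳ-* _ _ ⟩
      m · 1# * - (suc n · 1#)            ∎

    fromℤ-* : ∀ i j → fromℤ (i ℤ.* j) ≈ fromℤ i * fromℤ j
    fromℤ-* (+ m)    j = fromℤ-pos* m j
    fromℤ-* -[1+ m ] j = begin
      fromℤ ((ℤ.- (+ suc m)) ℤ.* j)      ≡⟨ P.cong fromℤ (ℤ.neg-distribˡ-* (+ suc m) j) ⟨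
      fromℤ (ℤ.- ((+ suc m) ℤ.* j))      ≈⟨ fromℤ-neg ((+ suc m) ℤ.* j) ⟩
      - fromℤ ((+ suc m) ℤ.* j)          ≈⟨ -‿cong (fromℤ-pos* (suc m) j) ⟩
      - (suc m · 1# * fromℤ j)           ≈⟨ -‿distribˡ-* _ _ ⟩
      - (suc m · 1#) * fromℤ j           ∎

    -- A variant of fromℤ that sends + 1 to 1# on the nose, so that the
    -- solver's constant con (+ 1) matches 1# in goals.
    natural : ℕ → Carrier
    natural zero          = 0#
    natural (suc zero)    = 1#
    natural (suc (suc n)) = 1# + natural (suc n)

    natural≈ : ∀ n → natural n ≈ n · 1#
    natural≈ zero          = refl
    natural≈ (suc zero)    = sym (+-identityʳ 1#)
    natural≈ (suc (suc n)) = +-congˡ (natural≈ (suc n))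

    integer : ℤ → Carrier
    integer (+ n)    = natural n
    integer -[1+ n ] = - natural (suc n)

    integer≈ : ∀ i → integer i ≈ fromℤ i
    integer≈ (+ n)    = natural≈ n
    integer≈ -[1+ n ] = -‿cong (natural≈ (suc n))

    ℤ-morphism : ℤ.+-*-rawRing -Raw-AlmostCommutative⟶ fromCommutativeRing R
    ℤ-morphism = record
      { ⟦_⟧    = integer
      ; +-homo = λ i j → trans (integer≈ (i ℤ.+ j)) (trans (fromℤ-+ i j) (sym (+-cong (integer≈ i) (integer≈ j))))
      ; *-homo = λ i j → trans (integer≈ (i ℤ.* j)) (trans (fromℤ-* i j) (sym (*-cong (integer≈ i) (integer≈ j))))
      ; -‿homo = λ i → trans (integer≈ (ℤ.- i)) (trans (fromℤ-neg i) (sym (-‿cong (integer≈ i))))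
      ; 0-homo = refl
      ; 1-homo = refl
      }

    integer-≟ : WeaklyDecidable (Induced-equivalence ℤ-morphism)
    integer-≟ i j with i ℤ.≟ j
    ... | yes i≡j = just (reflexive (P.cong integer i≡j))
    ... | no  _   = nothing

  open Solver ℤ.+-*-rawRing (fromCommutativeRing R) ℤ-morphism integer-≟ public
    using (solve; _:=_; _:+_; _:*_; _:-_; :-_; con)

  x-y≈0⇒x≈y : ∀ {x y} → x + - y ≈ 0# → x ≈ y
  x-y≈0⇒x≈y {x} {y} x-y≈0 = begin
    x              ≈⟨ solve 2 (λ x y → x := (x :- y) :+ y) refl x y ⟩
    (x + - y) + y  ≈⟨ +-congʳ x-y≈0 ⟩
    0# + y         ≈⟨ +-identityˡ y ⟩
    y              ∎

  x≈y⇒x-y≈0 : ∀ {x y} → x ≈ y → x + - y ≈ 0#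
  x≈y⇒x-y≈0 {x} {y} x≈y = trans (+-congʳ x≈y) (-‿inverseʳ y)

  inverse-unique : ∀ {x y z} → y * x ≈ 1# → z * x ≈ 1# → y ≈ z
  inverse-unique {x} {y} {z} yx≈1 zx≈1 = begin
    y            ≈⟨ *-identityʳ y ⟨
    y * 1#       ≈⟨ *-congˡ zx≈1 ⟨
    y * (z * x)  ≈⟨ solve 3 (λ x y z → y :* (z :* x) := z :* (y :* x)) refl x y z ⟩
    z * (y * x)  ≈⟨ *-congˡ yx≈1 ⟩
    z * 1#       ≈⟨ *-identityʳ z ⟩
    z            ∎

  1^ : ∀ n → 1# ^ n ≈ 1#
  1^ zero    = refl
  1^ (suc n) = trans (*-identityˡ _) (1^ n)

  0^ : ∀ n → 0 < n → 0# ^ n ≈ 0#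
  0^ (suc n) _ = zeroˡ _

  ·-1 : ∀ n x → n · x ≈ (n · 1#) * x
  ·-1 n x = sym (trans (×-assoc-* n 1# x) (×-congʳ n (*-identityˡ x)))

  module Char (p : ℕ) (p-prime : Prime p) (p·1≈0 : p · 1# ≈ 0#) where

    p·≈0 : ∀ x → p · x ≈ 0#
    p·≈0 x = trans (·-1 p x) (trans (*-congʳ p·1≈0) (zeroˡ x))

    p∣⇒·≈0 : ∀ {n} → p ∣ n → ∀ x → n · x ≈ 0#
    p∣⇒·≈0 (divides k P.refl) x = begin
      (k ℕ.* p) · x  ≈⟨ ×-assocˡ x k p ⟨
      k · (p · x)    ≈⟨ ×-congʳ k (p·≈0 x) ⟩
      k · 0#         ≈⟨ ·-1 k 0# ⟩
      (k · 1#) * 0#  ≈⟨ zeroʳ _ ⟩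
      0#             ∎

    frobenius-+ : ∀ x y → (x + y) ^ p ≈ x ^ p + y ^ p
    frobenius-+ x y = go p P.refl
      where
      -- The exponent is decoupled from `p` so that it can be split as a successor, which exposes
      -- the first and last binomial terms, while the divisibility facts keep speaking of `p`.
      go : ∀ n → n ≡ p → (x + y) ^ n ≈ x ^ n + y ^ n
      go zero P.refl = ⊥-elim (ℕ.1+n≰n (ℕ.≤-trans (ℕ.nonTrivial⇒n>1 _ {{prime⇒nonTrivial p-prime}}) z≤n))
      go n@(suc m) n≡p = begin
        (x + y) ^ n                          ≈⟨ theorem n x y ⟩
        t Fin.zero + sum (λ i → t (Fin.suc i)) ≈⟨ +-congˡ (sum-init-last (λ i → t (Fin.suc i))) ⟩
        t Fin.zero + (sum (λ i → t (Fin.suc (inject₁ i))) + t (fromℕ n)) ≈⟨ +-cong head≈ (+-cong middle≈ last≈) ⟩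
        y ^ n + (0# + x ^ n)                 ≈⟨ solve 2 (λ x y → y :+ (con (+ 0) :+ x) := x :+ y) refl (x ^ n) (y ^ n) ⟩
        x ^ n + y ^ n                        ∎
        where
        t = binomialTerm x y n
        head≈ : t Fin.zero ≈ y ^ n
        head≈ = trans (×-homo-1 _) (*-identityˡ _)
        last≈ : t (fromℕ n) ≈ x ^ n
        last≈ = begin
          (n choose toℕ (fromℕ n)) · (x ^ toℕ (fromℕ n) * y ^ (n ∸ toℕ (fromℕ n))) ≡⟨ P.cong (λ k → (n choose k) · (x ^ k * y ^ (n ∸ k))) (Fin.toℕ-fromℕ n) ⟩
          (n choose n) · (x ^ n * y ^ (n ∸ n)) ≡⟨ P.cong₂ (λ c k → c · (x ^ n * y ^ k)) (nCn≡1 n) (ℕ.n∸n≡0 n) ⟩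
          1 · (x ^ n * 1#)                ≈⟨ trans (×-homo-1 _) (*-identityʳ _) ⟩
          x ^ n                           ∎
        middle≈ : sum (λ i → t (Fin.suc (inject₁ i))) ≈ 0#
        middle≈ = trans (sum-cong-≋ {m} zero-term) (sum-replicate-zero m)
          where
          zero-term : ∀ (i : Fin m) → t (Fin.suc (inject₁ i)) ≈ 0#
          zero-term i = p∣⇒·≈0 (P.subst (λ n → p ∣ (n choose k)) (P.sym n≡p) (prime∣C p-prime k (s≤s z≤n) k<p)) _
            where
            k = suc (toℕ (inject₁ i))
            k<p : k < p
            k<p = P.subst (k <_) n≡p (s≤s (P.subst (_< m) (P.sym (Fin.toℕ-inject₁ i)) (Fin.toℕ<n i)))

-- Polynomial functions and the root bound in a commutative ring

module Evaluation {a ℓ : Level} (R : CommutativeRing a ℓ) where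
  open CommutativeRing R
  open RingTools R
  open import Relation.Binary.Reasoning.Setoid setoid

  -- The coefficients are arbitrary ring elements, such as elements of F[v], which coefficient lists
  -- over F cannot express; `n` is a strict bound on the degree.
  evalN : ℕ → (ℕ → Carrier) → Carrier → Carrier
  evalN zero    c x = 0#
  evalN (suc n) c x = c 0 + x * evalN n (λ i → c (suc i)) x

  evalN-cong : ∀ n {c d} → (∀ i → i < n → c i ≈ d i) → ∀ x → evalN n c x ≈ evalN n d x
  evalN-cong zero    c≈d x = refl
  evalN-cong (suc n) c≈d x = +-cong (c≈d 0 (s≤s z≤n)) (*-congˡ (evalN-cong n (λ i i<n → c≈d (suc i) (s≤s i<n)) x))

  evalN-0 : ∀ n {c} → (∀ i → i < n → c i ≈ 0#) → ∀ x → evalN n c x ≈ 0#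
  evalN-0 zero    c≈0 x = refl
  evalN-0 (suc n) c≈0 x = trans (+-cong (c≈0 0 (s≤s z≤n)) (*-congˡ (evalN-0 n (λ i i<n → c≈0 (suc i) (s≤s i<n)) x))) (trans (+-identityˡ _) (zeroʳ x))

  evalN-congʳ : ∀ n {c x y} → x ≈ y → evalN n c x ≈ evalN n c y
  evalN-congʳ zero    x≈y = refl
  evalN-congʳ (suc n) x≈y = +-congˡ (*-cong x≈y (evalN-congʳ n x≈y))

  evalN-+ : ∀ n c d x → evalN n (λ i → c i + d i) x ≈ evalN n c x + evalN n d x
  evalN-+ zero    c d x = sym (+-identityˡ 0#)
  evalN-+ (suc n) c d x = trans (+-congˡ (*-congˡ (evalN-+ n _ _ x)))
    (solve 5 (λ a b x s t → (a :+ b) :+ x :* (s :+ t) := (a :+ x :* s) :+ (b :+ x :* t)) refl (c 0) (d 0) x _ _)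

  evalN-scale : ∀ n a c x → evalN n (λ i → a * c i) x ≈ a * evalN n c x
  evalN-scale zero    a c x = sym (zeroʳ a)
  evalN-scale (suc n) a c x = trans (+-congˡ (*-congˡ (evalN-scale n a _ x)))
    (solve 4 (λ a b x s → a :* b :+ x :* (a :* s) := a :* (b :+ x :* s)) refl a (c 0) x _)

  evalN-snoc : ∀ n c x → evalN (suc n) c x ≈ evalN n c x + x ^ n * c n
  evalN-snoc zero    c x = solve 2 (λ a x → a :+ x :* con (+ 0) := con (+ 0) :+ con (+ 1) :* a) refl (c 0) x
  evalN-snoc (suc n) c x = trans (+-congˡ (*-congˡ (evalN-snoc n (λ i → c (suc i)) x)))
    (solve 5 (λ a x s y b → a :+ x :* (s :+ y :* b) := (a :+ x :* s) :+ (x :* y) :* b) refl (c 0) x _ (x ^ n) (c (suc n)))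

  -- At `y = 1/x` the reversed polynomial is `y ^ (n - 1)` times the original at `x`; the extra
  -- factor `y` on both sides avoids the truncated exponent.
  evalN-reverse : ∀ n c x y → y * x ≈ 1# → y * evalN n (λ i → c (n ∸ suc i)) y ≈ y ^ n * evalN n c x
  evalN-reverse zero c x y yx≈1 = solve 1 (λ y → y :* con (+ 0) := con (+ 1) :* con (+ 0)) refl y
  evalN-reverse (suc n) c x y yx≈1 = begin
    y * (c n + y * evalN n (λ i → c (n ∸ suc i)) y) ≈⟨ *-congˡ (+-congˡ (evalN-reverse n c x y yx≈1)) ⟩
    y * (c n + y ^ n * evalN n c x)                 ≈⟨ solve 4 (λ y c p e → y :* (c :+ p :* e) := (y :* p) :* e :+ y :* (con (+ 1) :* c)) refl y (c n) (y ^ n) _ ⟩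
    (y * y ^ n) * evalN n c x + y * (1# * c n)      ≈⟨ +-congˡ (*-congˡ (*-congʳ yxⁿ≈1)) ⟨
    (y * y ^ n) * evalN n c x + y * ((y ^ n * x ^ n) * c n) ≈⟨ solve 5 (λ y p q e c → (y :* p) :* e :+ y :* ((p :* q) :* c) := (y :* p) :* (e :+ q :* c)) refl y (y ^ n) (x ^ n) _ (c n) ⟩
    (y * y ^ n) * (evalN n c x + x ^ n * c n)       ≈⟨ *-congˡ (evalN-snoc n c x) ⟨
    (y * y ^ n) * evalN (suc n) c x ∎
    where
    yxⁿ≈1 : y ^ n * x ^ n ≈ 1#
    yxⁿ≈1 = trans (sym (^-distrib-* y x n)) (trans (^-congˡ n yx≈1) (1^ n))

  -- Synthetic division by X - r of a polynomial with n + 1 coefficients.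
  quot : ℕ → (ℕ → Carrier) → Carrier → ℕ → Carrier
  quot zero    c r i       = 0#
  quot (suc n) c r zero    = evalN (suc n) (λ i → c (suc i)) r
  quot (suc n) c r (suc i) = quot n (λ i → c (suc i)) r i

  evalN-quot : ∀ n c r x → evalN (suc n) c x ≈ evalN (suc n) c r + (x + - r) * evalN n (quot n c r) x
  evalN-quot zero c r x = solve 3 (λ a r x → a :+ x :* con (+ 0) := (a :+ r :* con (+ 0)) :+ (x :- r) :* con (+ 0)) refl (c 0) r x
  evalN-quot (suc n) c r x = trans (+-congˡ (*-congˡ (evalN-quot n (λ i → c (suc i)) r x)))
    (solve 5 (λ a x r e q → a :+ x :* (e :+ (x :- r) :* q) := (a :+ r :* e) :+ (x :- r) :* (e :+ x :* q)) refl (c 0) x r _ _)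

  -- The quotient coefficients form a triangular system: coefficient `i` is `c (suc i)` plus `r`
  -- times a combination of later ones, so vanishing propagates down from the top.
  quot≈0⇒tail≈0 : ∀ n c r → (∀ i → i < n → quot n c r i ≈ 0#) → ∀ i → i < n → c (suc i) ≈ 0#
  quot≈0⇒tail≈0 (suc n) c r q≈0 = λ { zero _ → c1≈0 ; (suc i) (s≤s i<n) → rest i i<n }
    where
    rest : ∀ i → i < n → c (suc (suc i)) ≈ 0#
    rest = quot≈0⇒tail≈0 n (λ i → c (suc i)) r (λ i i<n → q≈0 (suc i) (s≤s i<n))
    c1≈0 : c 1 ≈ 0#
    c1≈0 = begin
      c 1                                              ≈⟨ +-identityʳ _ ⟨
      c 1 + 0#                                         ≈⟨ +-congˡ (trans (*-congˡ (evalN-0 n rest r)) (zeroʳ r)) ⟨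
      c 1 + r * evalN n (λ i → c (suc (suc i))) r      ≈⟨ q≈0 0 (s≤s z≤n) ⟩
      0#                                               ∎

  NonZeroDivisor : Carrier → Set (a ⊔ ℓ)
  NonZeroDivisor x = ∀ z → z * x ≈ 0# → z ≈ 0#

  -- The degree bound on roots can fail in a ring with zero divisors. It is restored by asking that
  -- differences of roots be cancellable: after division by `X - r 0`, the factor `r j - r 0` is
  -- removed at every remaining root.
  too-many-roots⇒≈0 : ∀ n c (r : ℕ → Carrier) →
    (∀ i j → i < j → j < n → NonZeroDivisor (r j + - r i)) →
    (∀ i → i < n → evalN n c (r i) ≈ 0#) →
    ∀ i → i < n → c i ≈ 0#
  too-many-roots⇒≈0 (suc n) c r nzd root = λ { zero _ → c0≈0 ; (suc i) (s≤s i<n) → tail≈0 i i<n }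
    where
    q = quot n c (r 0)
    q-root : ∀ i → i < n → evalN n q (r (suc i)) ≈ 0#
    q-root i i<n = nzd 0 (suc i) (s≤s z≤n) (s≤s i<n) _ (begin
      evalN n q (r (suc i)) * (r (suc i) + - r 0)       ≈⟨ *-comm _ _ ⟩
      (r (suc i) + - r 0) * evalN n q (r (suc i))       ≈⟨ +-identityˡ _ ⟨
      0# + (r (suc i) + - r 0) * evalN n q (r (suc i))  ≈⟨ +-congʳ (root 0 (s≤s z≤n)) ⟨
      evalN (suc n) c (r 0) + (r (suc i) + - r 0) * evalN n q (r (suc i)) ≈⟨ evalN-quot n c (r 0) (r (suc i)) ⟨
      evalN (suc n) c (r (suc i))                       ≈⟨ root (suc i) (s≤s i<n) ⟩
      0#                                                ∎)
    tail≈0 : ∀ i → i < n → c (suc i) ≈ 0#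
    tail≈0 = quot≈0⇒tail≈0 n c (r 0) (too-many-roots⇒≈0 n q (λ i → r (suc i))
      (λ i j i<j j<n → nzd (suc i) (suc j) (s≤s i<j) (s≤s j<n)) q-root)
    c0≈0 : c 0 ≈ 0#
    c0≈0 = trans (sym (trans (+-congˡ (trans (*-congˡ (evalN-0 n tail≈0 (r 0))) (zeroʳ _))) (+-identityʳ _))) (root 0 (s≤s z≤n))

-- Frobenius powers and trace sums

module Frobenius {a ℓ : Level} (R : CommutativeRing a ℓ) (p : ℕ) (p-prime : Prime p)
  (p·1≈0 : CommutativeRing._≈_ R (RingTools._·_ R p (CommutativeRing.1# R)) (CommutativeRing.0# R)) where
  open CommutativeRing R
  open RingTools R
  open Char p p-prime p·1≈0 public
  open import Relation.Binary.Reasoning.Setoid setoid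

  0<p : 0 < p
  0<p = ℕ.<-trans (s≤s z≤n) (ℕ.nonTrivial⇒n>1 _ {{prime⇒nonTrivial p-prime}})

  -- Iterating `_^ p` rather than raising to `p ^ k` reduces each homomorphism law to a single p-th
  -- power by induction; `fr≈^` converts.
  fr : ℕ → Carrier → Carrier
  fr zero    x = x
  fr (suc k) x = fr k x ^ p

  fr-cong : ∀ k {x y} → x ≈ y → fr k x ≈ fr k y
  fr-cong zero    x≈y = x≈y
  fr-cong (suc k) x≈y = ^-congˡ p (fr-cong k x≈y)

  fr-+ : ∀ k x y → fr k (x + y) ≈ fr k x + fr k y
  fr-+ zero    x y = refl
  fr-+ (suc k) x y = trans (^-congˡ p (fr-+ k x y)) (frobenius-+ _ _)

  fr-* : ∀ k x y → fr k (x * y) ≈ fr k x * fr k y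
  fr-* zero    x y = refl
  fr-* (suc k) x y = trans (^-congˡ p (fr-* k x y)) (^-distrib-* _ _ p)

  fr-1 : ∀ k → fr k 1# ≈ 1#
  fr-1 zero    = refl
  fr-1 (suc k) = trans (^-congˡ p (fr-1 k)) (1^ p)

  fr-0 : ∀ k → fr k 0# ≈ 0#
  fr-0 zero    = refl
  fr-0 (suc k) = trans (^-congˡ p (fr-0 k)) (0^ p 0<p)

  fr-neg : ∀ k x → fr k (- x) ≈ - fr k x
  fr-neg k x = begin
    fr k (- x)                       ≈⟨ solve 2 (λ u v → v := (u :+ v) :- u) refl (fr k x) (fr k (- x)) ⟩
    (fr k x + fr k (- x)) + - fr k x ≈⟨ +-congʳ (trans (sym (fr-+ k x (- x))) (trans (fr-cong k (-‿inverseʳ x)) (fr-0 k))) ⟩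
    0# + - fr k x                    ≈⟨ +-identityˡ _ ⟩
    - fr k x                         ∎

  fr-- : ∀ k x y → fr k (x + - y) ≈ fr k x + - fr k y
  fr-- k x y = trans (fr-+ k x (- y)) (+-congˡ (fr-neg k y))

  fr-^ : ∀ k x n → fr k (x ^ n) ≈ fr k x ^ n
  fr-^ k x zero    = fr-1 k
  fr-^ k x (suc n) = trans (fr-* k x _) (*-congˡ (fr-^ k x n))

  fr-∘ : ∀ j k x → fr (j ℕ.+ k) x ≈ fr j (fr k x)
  fr-∘ zero    k x = refl
  fr-∘ (suc j) k x = ^-congˡ p (fr-∘ j k x)

  fr-comm : ∀ j k x → fr j (fr k x) ≈ fr k (fr j x)
  fr-comm j k x = trans (sym (fr-∘ j k x)) (trans (reflexive (P.cong (λ n → fr n x) (ℕ.+-comm j k))) (fr-∘ k j x))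

  fr≈^ : ∀ k x → fr k x ≈ x ^ (p ℕ.^ k)
  fr≈^ zero    x = sym (*-identityʳ x)
  fr≈^ (suc k) x = trans (^-congˡ p (fr≈^ k x)) (trans (^-assocʳ x (p ℕ.^ k) p) (^-congʳ x (ℕ.*-comm (p ℕ.^ k) p)))

  fr-·1 : ∀ k n → fr k (n · 1#) ≈ n · 1#
  fr-·1 k zero    = fr-0 k
  fr-·1 k (suc n) = trans (fr-+ k 1# _) (+-cong (fr-1 k) (fr-·1 k n))

  fr-fixed : ∀ k x → fr k x ≈ x → ∀ n → fr (n ℕ.* k) x ≈ x
  fr-fixed k x fix zero    = refl
  fr-fixed k x fix (suc n) = trans (fr-∘ k (n ℕ.* k) x) (trans (fr-cong k (fr-fixed k x fix n)) fix)

  -- With Q = p ^ k this is the sum of x ^ (Q ^ i) over i < n.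
  S : ℕ → ℕ → Carrier → Carrier
  S k zero    x = 0#
  S k (suc n) x = x + S k n (fr k x)

  S-cong : ∀ k n {x y} → x ≈ y → S k n x ≈ S k n y
  S-cong k zero    x≈y = refl
  S-cong k (suc n) x≈y = +-cong x≈y (S-cong k n (fr-cong k x≈y))

  S-+ : ∀ k n x y → S k n (x + y) ≈ S k n x + S k n y
  S-+ k zero    x y = sym (+-identityʳ 0#)
  S-+ k (suc n) x y = trans (+-congˡ (trans (S-cong k n (fr-+ k x y)) (S-+ k n _ _)))
    (solve 4 (λ x y s t → (x :+ y) :+ (s :+ t) := (x :+ s) :+ (y :+ t)) refl x y _ _)

  S-0 : ∀ k n → S k n 0# ≈ 0#
  S-0 k zero    = refl
  S-0 k (suc n) = trans (+-identityˡ _) (trans (S-cong k n (fr-0 k)) (S-0 k n))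

  S-neg : ∀ k n x → S k n (- x) ≈ - S k n x
  S-neg k n x = begin
    S k n (- x)                       ≈⟨ solve 2 (λ u v → v := (u :+ v) :- u) refl (S k n x) (S k n (- x)) ⟩
    (S k n x + S k n (- x)) + - S k n x ≈⟨ +-congʳ (trans (sym (S-+ k n x (- x))) (trans (S-cong k n (-‿inverseʳ x)) (S-0 k n))) ⟩
    0# + - S k n x                    ≈⟨ +-identityˡ _ ⟩
    - S k n x                         ∎

  S-fr : ∀ j k n x → S k n (fr j x) ≈ fr j (S k n x)
  S-fr j k zero    x = sym (fr-0 j)
  S-fr j k (suc n) x = sym (trans (fr-+ j x _) (+-congˡ (trans (sym (S-fr j k n (fr k x))) (S-cong k n (fr-comm j k x)))))

  S-split : ∀ k m n x → S k (m ℕ.+ n) x ≈ S k m x + S k n (fr (m ℕ.* k) x)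
  S-split k zero    n x = sym (+-identityˡ _)
  S-split k (suc m) n x = trans (+-congˡ (trans (S-split k m n (fr k x)) (+-congˡ (S-cong k n fr-fr))))
    (sym (+-assoc x _ _))
    where
    fr-fr : fr (m ℕ.* k) (fr k x) ≈ fr (k ℕ.+ m ℕ.* k) x
    fr-fr = trans (fr-comm (m ℕ.* k) k x) (sym (fr-∘ k (m ℕ.* k) x))

  -- Transitivity of the trace. With exponents written as `i = j + m l`, the inner sum runs over
  -- `l < n` and the outer one over `j < m`; the induction peels off one block of `m` consecutive
  -- terms.
  S-blocks : ∀ k m n x → S k (n ℕ.* m) x ≈ S k m (S (m ℕ.* k) n x)
  S-blocks k m zero    x = sym (S-0 k m)
  S-blocks k m (suc n) x = trans (S-split k m (n ℕ.* m) x) (trans (+-congˡ (S-blocks k m n _)) (sym (S-+ k m x _)))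

  -- The easy half of additive Hilbert 90. For `k = 1` it turns an Artin-Schreier equation for `x`
  -- into the value of a Frobenius power at `x`.
  S-telescope : ∀ k n x → S k n (fr k x + - x) ≈ fr (n ℕ.* k) x + - x
  S-telescope k zero    x = sym (-‿inverseʳ x)
  S-telescope k (suc n) x = begin
    (fr k x + - x) + S k n (fr k (fr k x + - x))               ≈⟨ +-congˡ (trans (S-cong k n (fr-- k (fr k x) x)) (S-telescope k n (fr k x))) ⟩
    (fr k x + - x) + (fr (n ℕ.* k) (fr k x) + - fr k x)        ≈⟨ solve 3 (λ a b c → (a :- b) :+ (c :- a) := c :- b) refl (fr k x) x _ ⟩
    fr (n ℕ.* k) (fr k x) + - x                                ≈⟨ +-congʳ (trans (fr-comm (n ℕ.* k) k x) (sym (fr-∘ k (n ℕ.* k) x))) ⟩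
    fr (k ℕ.+ n ℕ.* k) x + - x                                 ∎

  S-fixed : ∀ k n x → fr k x ≈ x → S k n x ≈ n · x
  S-fixed k zero    x fix = refl
  S-fixed k (suc n) x fix = +-congˡ (trans (S-cong k n fix) (S-fixed k n x fix))

  S-scale : ∀ k n c x → fr k c ≈ c → S k n (c * x) ≈ c * S k n x
  S-scale k zero    c x fix = sym (zeroʳ c)
  S-scale k (suc n) c x fix = trans (+-congˡ (trans (S-cong k n (trans (fr-* k c x) (*-congʳ fix))) (S-scale k n c (fr k x) fix))) (sym (distribˡ c x _))

-- Residue class rings

module Quotient {a ℓ : Level} (R : CommutativeRing a ℓ) (h : CommutativeRing.Carrier R) where
  open CommutativeRing R
  open RingTools R
  open import Relation.Binary.Reasoning.Setoid setoid

  infix 4 _≈/_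
  record _≈/_ (x y : Carrier) : Set (a ⊔ ℓ) where
    constructor mod
    field
      quotient : Carrier
      x-y≈k*h  : x + - y ≈ quotient * h

  ≈⇒≈/ : ∀ {x y} → x ≈ y → x ≈/ y
  ≈⇒≈/ {x} {y} x≈y = mod 0# (trans (x≈y⇒x-y≈0 x≈y) (sym (zeroˡ h)))

  sym/ : ∀ {x y} → x ≈/ y → y ≈/ x
  sym/ {x} {y} (mod k e) = mod (- k) (begin
    y + - x      ≈⟨ solve 2 (λ x y → y :- x := :- (x :- y)) refl x y ⟩
    - (x + - y)  ≈⟨ -‿cong e ⟩
    - (k * h)    ≈⟨ -‿distribˡ-* k h ⟩
    - k * h      ∎)

  trans/ : ∀ {x y z} → x ≈/ y → y ≈/ z → x ≈/ z
  trans/ {x} {y} {z} (mod k e) (mod l f) = mod (k + l) (begin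
    x + - z                  ≈⟨ solve 3 (λ x y z → x :- z := (x :- y) :+ (y :- z)) refl x y z ⟩
    (x + - y) + (y + - z)    ≈⟨ +-cong e f ⟩
    k * h + l * h            ≈⟨ distribʳ h k l ⟨
    (k + l) * h              ∎)

  +-cong/ : ∀ {x y u v} → x ≈/ y → u ≈/ v → x + u ≈/ y + v
  +-cong/ {x} {y} {u} {v} (mod k e) (mod l f) = mod (k + l) (begin
    (x + u) + - (y + v)      ≈⟨ solve 4 (λ x y u v → (x :+ u) :- (y :+ v) := (x :- y) :+ (u :- v)) refl x y u v ⟩
    (x + - y) + (u + - v)    ≈⟨ +-cong e f ⟩
    k * h + l * h            ≈⟨ distribʳ h k l ⟨
    (k + l) * h              ∎)

  *-cong/ : ∀ {x y u v} → x ≈/ y → u ≈/ v → x * u ≈/ y * v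
  *-cong/ {x} {y} {u} {v} (mod k e) (mod l f) = mod (k * u + y * l) (begin
    x * u + - (y * v)              ≈⟨ solve 4 (λ x y u v → x :* u :- y :* v := (x :- y) :* u :+ y :* (u :- v)) refl x y u v ⟩
    (x + - y) * u + y * (u + - v)  ≈⟨ +-cong (*-congʳ e) (*-congˡ f) ⟩
    (k * h) * u + y * (l * h)      ≈⟨ solve 5 (λ k l h u y → (k :* h) :* u :+ y :* (l :* h) := (k :* u :+ y :* l) :* h) refl k l h u y ⟩
    (k * u + y * l) * h            ∎)

  neg-cong/ : ∀ {x y} → x ≈/ y → - x ≈/ - y
  neg-cong/ {x} {y} (mod k e) = mod (- k) (begin
    - x + - - y  ≈⟨ solve 2 (λ x y → :- x :- (:- y) := :- (x :- y)) refl x y ⟩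
    - (x + - y)  ≈⟨ -‿cong e ⟩
    - (k * h)    ≈⟨ -‿distribˡ-* k h ⟩
    - k * h      ∎)

  h≈/0 : h ≈/ 0#
  h≈/0 = mod 1# (solve 1 (λ h → h :- con (+ 0) := con (+ 1) :* h) refl h)

  -- Carrier and operations are kept and only equality is coarsened, so every element is its own
  -- residue class; for polynomials modulo `h`, `Xₚ` itself is then a root of `h`.
  quotientRing : CommutativeRing a (a ⊔ ℓ)
  quotientRing = record
    { Carrier = Carrier ; _≈_ = _≈/_ ; _+_ = _+_ ; _*_ = _*_ ; -_ = -_ ; 0# = 0# ; 1# = 1#
    ; isCommutativeRing = record
      { isRing = record
        { +-isAbelianGroup = record
          { isGroup = record
            { isMonoid = record
              { isSemigroup = record
                { isMagma = record
                  { isEquivalence = record { refl = ≈⇒≈/ refl ; sym = sym/ ; trans = trans/ }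
                  ; ∙-cong = +-cong/ }
                ; assoc = λ x y z → ≈⇒≈/ (+-assoc x y z) }
              ; identity = (λ x → ≈⇒≈/ (+-identityˡ x)) , (λ x → ≈⇒≈/ (+-identityʳ x)) }
            ; inverse = (λ x → ≈⇒≈/ (-‿inverseˡ x)) , (λ x → ≈⇒≈/ (-‿inverseʳ x))
            ; ⁻¹-cong = neg-cong/ }
          ; comm = λ x y → ≈⇒≈/ (+-comm x y) }
        ; *-cong = *-cong/
        ; *-assoc = λ x y z → ≈⇒≈/ (*-assoc x y z)
        ; *-identity = (λ x → ≈⇒≈/ (*-identityˡ x)) , (λ x → ≈⇒≈/ (*-identityʳ x))
        ; distrib = (λ x y z → ≈⇒≈/ (distribˡ x y z)) , (λ x y z → ≈⇒≈/ (distribʳ x y z)) }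
      ; *-comm = λ x y → ≈⇒≈/ (*-comm x y) } }

-- The polynomial ring over a field

module Polynomials {c ℓ : Level} (F : Field c ℓ) where
  open Field F
  open FieldTheory F
  open RingTools commutativeRing
  open import Relation.Binary.Reasoning.Setoid setoid

  coeff-+ : ∀ f g i → coeff (f +ₚ g) i ≈ coeff f i + coeff g i
  coeff-+ []      g       i       = sym (+-identityˡ _)
  coeff-+ (a ∷ f) []      i       = sym (+-identityʳ _)
  coeff-+ (a ∷ f) (b ∷ g) zero    = refl
  coeff-+ (a ∷ f) (b ∷ g) (suc i) = coeff-+ f g i

  coeff-scale : ∀ a f i → coeff (scale a f) i ≈ a * coeff f i
  coeff-scale a []      i       = sym (zeroʳ a)
  coeff-scale a (b ∷ f) zero    = refl
  coeff-scale a (b ∷ f) (suc i) = coeff-scale a f i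

  infix 4 _≋_
  record _≋_ (f g : Poly) : Set ℓ where
    constructor coeffs
    field
      coeff≈ : f ≈ₚ g
  open _≋_ public

  ≋-refl : ∀ {f} → f ≋ f
  ≋-refl = coeffs λ i → refl

  ≋-sym : ∀ {f g} → f ≋ g → g ≋ f
  ≋-sym (coeffs e) = coeffs λ i → sym (e i)

  ≋-trans : ∀ {f g h} → f ≋ g → g ≋ h → f ≋ h
  ≋-trans (coeffs e) (coeffs e′) = coeffs λ i → trans (e i) (e′ i)

  +ₚ-cong : ∀ {f g h k} → f ≋ g → h ≋ k → f +ₚ h ≋ g +ₚ k
  +ₚ-cong {f} {g} {h} {k} (coeffs e) (coeffs e′) = coeffs λ i →
    trans (coeff-+ f h i) (trans (+-cong (e i) (e′ i)) (sym (coeff-+ g k i)))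

  scale-cong : ∀ {a b f g} → a ≈ b → f ≋ g → scale a f ≋ scale b g
  scale-cong {a} {b} {f} {g} a≈b (coeffs e) = coeffs λ i →
    trans (coeff-scale a f i) (trans (*-cong a≈b (e i)) (sym (coeff-scale b g i)))

  ∷-cong : ∀ {a b f g} → a ≈ b → f ≋ g → (a ∷ f) ≋ (b ∷ g)
  ∷-cong a≈b (coeffs e) = coeffs λ { zero → a≈b ; (suc i) → e i }

  +ₚ-assoc : ∀ f g h → (f +ₚ g) +ₚ h ≋ f +ₚ (g +ₚ h)
  +ₚ-assoc f g h = coeffs λ i → begin
    coeff ((f +ₚ g) +ₚ h) i              ≈⟨ trans (coeff-+ (f +ₚ g) h i) (+-congʳ (coeff-+ f g i)) ⟩
    (coeff f i + coeff g i) + coeff h i  ≈⟨ +-assoc _ _ _ ⟩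
    coeff f i + (coeff g i + coeff h i)  ≈⟨ trans (coeff-+ f (g +ₚ h) i) (+-congˡ (coeff-+ g h i)) ⟨
    coeff (f +ₚ (g +ₚ h)) i              ∎

  +ₚ-comm : ∀ f g → f +ₚ g ≋ g +ₚ f
  +ₚ-comm f g = coeffs λ i → trans (coeff-+ f g i) (trans (+-comm _ _) (sym (coeff-+ g f i)))

  +ₚ-identityʳ : ∀ f → f +ₚ [] ≋ f
  +ₚ-identityʳ f = +ₚ-comm f []

  -ₚ_ : Poly → Poly
  -ₚ f = scale (- 1#) f

  coeff-neg : ∀ f i → coeff (-ₚ f) i ≈ - coeff f i
  coeff-neg f i = trans (coeff-scale (- 1#) f i) (solve 1 (λ a → (:- con (+ 1)) :* a := :- a) refl _)

  +ₚ-inverseʳ : ∀ f → f +ₚ (-ₚ f) ≋ []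
  +ₚ-inverseʳ f = coeffs λ i → trans (coeff-+ f (-ₚ f) i) (trans (+-congˡ (coeff-neg f i)) (-‿inverseʳ _))

  scale-+ : ∀ a f g → scale a (f +ₚ g) ≋ scale a f +ₚ scale a g
  scale-+ a f g = coeffs λ i → begin
    coeff (scale a (f +ₚ g)) i             ≈⟨ trans (coeff-scale a (f +ₚ g) i) (*-congˡ (coeff-+ f g i)) ⟩
    a * (coeff f i + coeff g i)            ≈⟨ distribˡ a _ _ ⟩
    a * coeff f i + a * coeff g i          ≈⟨ trans (coeff-+ (scale a f) (scale a g) i) (+-cong (coeff-scale a f i) (coeff-scale a g i)) ⟨
    coeff (scale a f +ₚ scale a g) i       ∎

  scale-scale : ∀ a b f → scale a (scale b f) ≋ scale (a * b) f
  scale-scale a b f = coeffs λ i → trans (coeff-scale a (scale b f) i) (trans (*-congˡ (coeff-scale b f i))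
    (trans (sym (*-assoc a b _)) (sym (coeff-scale (a * b) f i))))

  scale-distribʳ : ∀ a b f → scale (a + b) f ≋ scale a f +ₚ scale b f
  scale-distribʳ a b f = coeffs λ i → trans (coeff-scale (a + b) f i) (trans (distribʳ _ a b)
    (sym (trans (coeff-+ (scale a f) (scale b f) i) (+-cong (coeff-scale a f i) (coeff-scale b f i)))))

  scale-1 : ∀ f → scale 1# f ≋ f
  scale-1 f = coeffs λ i → trans (coeff-scale 1# f i) (*-identityˡ _)

  scale-0 : ∀ f → scale 0# f ≋ []
  scale-0 f = coeffs λ i → trans (coeff-scale 0# f i) (zeroˡ _)

  0∷[]≋[] : (0# ∷ []) ≋ []
  0∷[]≋[] = coeffs λ { zero → refl ; (suc i) → refl }

  *ₚ-zeroʳ : ∀ f → f *ₚ [] ≋ []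
  *ₚ-zeroʳ []      = ≋-refl
  *ₚ-zeroʳ (a ∷ f) = ≋-trans (∷-cong refl (*ₚ-zeroʳ f)) 0∷[]≋[]

  +ₚ-swap : ∀ f g h → f +ₚ (g +ₚ h) ≋ g +ₚ (f +ₚ h)
  +ₚ-swap f g h = ≋-trans (≋-sym (+ₚ-assoc f g h)) (≋-trans (+ₚ-cong (+ₚ-comm f g) ≋-refl) (+ₚ-assoc g f h))

  -- The mirror image of the defining clause of `_*ₚ_`. Commutativity follows from it by induction,
  -- and congruence in the left factor is then borrowed from the right.
  *ₚ-∷ʳ : ∀ f b g → f *ₚ (b ∷ g) ≋ scale b f +ₚ (0# ∷ (f *ₚ g))
  *ₚ-∷ʳ []      b g = ≋-sym 0∷[]≋[]
  *ₚ-∷ʳ (a ∷ f) b g = ∷-cong (+-congʳ (*-comm a b))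
    (≋-trans (+ₚ-cong (≋-refl {scale a g}) (*ₚ-∷ʳ f b g)) (+ₚ-swap (scale a g) (scale b f) _))

  *ₚ-comm : ∀ f g → f *ₚ g ≋ g *ₚ f
  *ₚ-comm []      g = ≋-sym (*ₚ-zeroʳ g)
  *ₚ-comm (a ∷ f) g = ≋-trans (+ₚ-cong (≋-refl {scale a g}) (∷-cong refl (*ₚ-comm f g))) (≋-sym (*ₚ-∷ʳ g a f))

  *ₚ-congˡ : ∀ f {g h} → g ≋ h → f *ₚ g ≋ f *ₚ h
  *ₚ-congˡ []      e = ≋-refl
  *ₚ-congˡ (a ∷ f) e = +ₚ-cong (scale-cong refl e) (∷-cong refl (*ₚ-congˡ f e))

  *ₚ-cong : ∀ {f g h k} → f ≋ g → h ≋ k → f *ₚ h ≋ g *ₚ k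
  *ₚ-cong {f} {g} {h} {k} e e′ = ≋-trans (*ₚ-congˡ f e′) (≋-trans (*ₚ-comm f k) (≋-trans (*ₚ-congˡ k e) (*ₚ-comm k g)))

  interchange : ∀ f g h k → (f +ₚ g) +ₚ (h +ₚ k) ≋ (f +ₚ h) +ₚ (g +ₚ k)
  interchange f g h k = ≋-trans (+ₚ-assoc f g _) (≋-trans (+ₚ-cong (≋-refl {f}) (+ₚ-swap g h k)) (≋-sym (+ₚ-assoc f h _)))

  *ₚ-distribˡ : ∀ f g h → f *ₚ (g +ₚ h) ≋ (f *ₚ g) +ₚ (f *ₚ h)
  *ₚ-distribˡ []      g h = ≋-refl
  *ₚ-distribˡ (a ∷ f) g h =
    ≋-trans (+ₚ-cong (scale-+ a g h) (∷-cong (sym (+-identityˡ 0#)) (*ₚ-distribˡ f g h)))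
      (interchange (scale a g) (scale a h) (0# ∷ (f *ₚ g)) (0# ∷ (f *ₚ h)))

  *ₚ-distribʳ : ∀ f g h → (g +ₚ h) *ₚ f ≋ (g *ₚ f) +ₚ (h *ₚ f)
  *ₚ-distribʳ f g h = ≋-trans (*ₚ-comm (g +ₚ h) f) (≋-trans (*ₚ-distribˡ f g h) (+ₚ-cong (*ₚ-comm f g) (*ₚ-comm f h)))

  scale-*ₚ : ∀ a f g → scale a f *ₚ g ≋ scale a (f *ₚ g)
  scale-*ₚ a []      g = ≋-refl
  scale-*ₚ a (b ∷ f) g = ≋-trans
    (+ₚ-cong (≋-sym (scale-scale a b g)) (∷-cong (sym (zeroʳ a)) (scale-*ₚ a f g)))
    (≋-sym (scale-+ a (scale b g) (0# ∷ (f *ₚ g))))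

  shift-*ₚ : ∀ f g → (0# ∷ f) *ₚ g ≋ 0# ∷ (f *ₚ g)
  shift-*ₚ f g = +ₚ-cong (scale-0 g) ≋-refl

  *ₚ-assoc : ∀ f g h → (f *ₚ g) *ₚ h ≋ f *ₚ (g *ₚ h)
  *ₚ-assoc []      g h = ≋-refl
  *ₚ-assoc (a ∷ f) g h = ≋-trans (*ₚ-distribʳ h (scale a g) (0# ∷ (f *ₚ g)))
    (+ₚ-cong (scale-*ₚ a g h) (≋-trans (shift-*ₚ (f *ₚ g) h) (∷-cong refl (*ₚ-assoc f g h))))

  constP-*ₚ : ∀ a f → constP a *ₚ f ≋ scale a f
  constP-*ₚ a f = ≋-trans (+ₚ-cong (≋-refl {scale a f}) 0∷[]≋[]) (+ₚ-identityʳ _)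

  *ₚ-identityˡ : ∀ f → constP 1# *ₚ f ≋ f
  *ₚ-identityˡ f = ≋-trans (constP-*ₚ 1# f) (scale-1 f)

  polyRing : CommutativeRing c ℓ
  polyRing = record
    { Carrier = Poly ; _≈_ = _≋_ ; _+_ = _+ₚ_ ; _*_ = _*ₚ_ ; -_ = -ₚ_ ; 0# = [] ; 1# = constP 1#
    ; isCommutativeRing = record
      { isRing = record
        { +-isAbelianGroup = record
          { isGroup = record
            { isMonoid = record
              { isSemigroup = record
                { isMagma = record
                  { isEquivalence = record { refl = ≋-refl ; sym = ≋-sym ; trans = ≋-trans }
                  ; ∙-cong = +ₚ-cong }
                ; assoc = +ₚ-assoc }
              ; identity = (λ f → ≋-refl) , +ₚ-identityʳ }
            ; inverse = (λ f → ≋-trans (+ₚ-comm (-ₚ f) f) (+ₚ-inverseʳ f)) , +ₚ-inverseʳ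
            ; ⁻¹-cong = scale-cong refl }
          ; comm = +ₚ-comm }
        ; *-cong = *ₚ-cong
        ; *-assoc = *ₚ-assoc
        ; *-identity = *ₚ-identityˡ , (λ f → ≋-trans (*ₚ-comm f _) (*ₚ-identityˡ f))
        ; distrib = *ₚ-distribˡ , *ₚ-distribʳ }
      ; *-comm = *ₚ-comm } }

-- Commutative algebras over the base field

record Algebra {c ℓ : Level} (F : Field c ℓ) (a b : Level) : Set (c ⊔ ℓ ⊔ Level.suc (a ⊔ b)) where
  private module F = Field F
  field
    commutativeRing : CommutativeRing a b
  open CommutativeRing commutativeRing public
  field
    ι      : F.Carrier → Carrier
    ι-cong : ∀ {x y} → x F.≈ y → ι x ≈ ι y
    ι-+    : ∀ x y → ι (x F.+ y) ≈ ι x + ι y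
    ι-*    : ∀ x y → ι (x F.* y) ≈ ι x * ι y
    ι-1    : ι F.1# ≈ 1#

  open RingTools commutativeRing

  ι-0 : ι F.0# ≈ 0#
  ι-0 = x+x≈x⇒x≈0 _ (trans (sym (ι-+ F.0# F.0#)) (ι-cong (F.+-identityˡ F.0#)))

  ι-neg : ∀ x → ι (F.- x) ≈ - ι x
  ι-neg x = trans (solve 2 (λ a b → b := (a :+ b) :- a) refl (ι x) (ι (F.- x)))
    (trans (+-congʳ (trans (sym (ι-+ x (F.- x))) (trans (ι-cong (F.-‿inverseʳ x)) ι-0))) (+-identityˡ _))

  ι-- : ∀ x y → ι (x F.+ F.- y) ≈ ι x + - ι y
  ι-- x y = trans (ι-+ x _) (+-congˡ (ι-neg y))

  ι-· : ∀ n → ι (RingTools._·_ F.commutativeRing n F.1#) ≈ n · 1#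
  ι-· zero    = ι-0
  ι-· (suc n) = trans (ι-+ F.1# _) (+-cong ι-1 (ι-· n))

  ι-^ : ∀ x n → ι (RingTools._^_ F.commutativeRing x n) ≈ ι x ^ n
  ι-^ x zero    = ι-1
  ι-^ x (suc n) = trans (ι-* x _) (*-congˡ (ι-^ x n))

module _ {c ℓ : Level} (F : Field c ℓ) where
  private module F = Field F
  open FieldTheory F
  open Polynomials F

  selfAlgebra : Algebra F c ℓ
  selfAlgebra = record
    { commutativeRing = F.commutativeRing ; ι = λ x → x ; ι-cong = λ e → e
    ; ι-+ = λ x y → F.refl ; ι-* = λ x y → F.refl ; ι-1 = F.refl }

  polyAlgebra : Algebra F c ℓ
  polyAlgebra = record
    { commutativeRing = polyRing ; ι = constP ; ι-cong = λ e → ∷-cong e ≋-refl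
    ; ι-+ = λ x y → ≋-refl ; ι-* = λ x y → ∷-cong (F.sym (F.+-identityʳ _)) ≋-refl ; ι-1 = ≋-refl }

  _/ₐ_ : ∀ {a b} → (A : Algebra F a b) → Algebra.Carrier A → Algebra F a (a ⊔ b)
  A /ₐ h = record
    { commutativeRing = quotientRing ; ι = ι ; ι-cong = λ e → ≈⇒≈/ (ι-cong e)
    ; ι-+ = λ x y → ≈⇒≈/ (ι-+ x y) ; ι-* = λ x y → ≈⇒≈/ (ι-* x y) ; ι-1 = ≈⇒≈/ ι-1 }
    where
    open Algebra A
    open Quotient commutativeRing h

-- Degrees, division with remainder and Bezout relations

module Degrees {c ℓ : Level} (F : Field c ℓ) where
  open Field F
  open FieldTheory F
  open Polynomials F
  open RingTools commutativeRing
  open import Relation.Binary.Reasoning.Setoid setoid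

  DegLt : Poly → ℕ → Set ℓ
  DegLt f n = ∀ i → n ≤ i → coeff f i ≈ 0#

  DegLt-≤ : ∀ f {m n} → m ≤ n → DegLt f m → DegLt f n
  DegLt-≤ f m≤n f< i n≤i = f< i (ℕ.≤-trans m≤n n≤i)

  DegLt-≋ : ∀ {f g n} → f ≋ g → DegLt f n → DegLt g n
  DegLt-≋ e f< i n≤i = trans (sym (coeff≈ e i)) (f< i n≤i)

  DegLt-length : ∀ f → DegLt f (length f)
  DegLt-length []      i       _         = refl
  DegLt-length (a ∷ f) (suc i) (s≤s n≤i) = DegLt-length f i n≤i

  DegLt-+ : ∀ f g {n} → DegLt f n → DegLt g n → DegLt (f +ₚ g) n
  DegLt-+ f g f< g< i n≤i = trans (coeff-+ f g i) (trans (+-cong (f< i n≤i) (g< i n≤i)) (+-identityˡ _))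

  DegLt-scale : ∀ a f {n} → DegLt f n → DegLt (scale a f) n
  DegLt-scale a f f< i n≤i = trans (coeff-scale a f i) (trans (*-congˡ (f< i n≤i)) (zeroʳ a))

  DegLt-constP : ∀ a → DegLt (constP a) 1
  DegLt-constP a = DegLt-length (constP a)

  DegLt0⇒≋[] : ∀ f → DegLt f 0 → f ≋ []
  DegLt0⇒≋[] f f< = coeffs λ i → f< i z≤n

  -- Here `d` and `e` are bounds that need not be attained, so the formula also covers formal
  -- leading coefficients whose nonvanishing is settled only later, or fails.
  *ₚ-top : ∀ f g d e → DegLt f (suc d) → DegLt g (suc e) →
    DegLt (f *ₚ g) (suc (d ℕ.+ e)) × (coeff (f *ₚ g) (d ℕ.+ e) ≈ coeff f d * coeff g e)
  *ₚ-top []      g d e f< g< = (λ i _ → refl) , sym (zeroˡ _)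
  *ₚ-top (a ∷ f) g zero e f< g< = (λ i e<i → trans (coeff-a i) (trans (*-congˡ (g< i e<i)) (zeroʳ a))) , coeff-a e
    where
    coeff-a : ∀ i → coeff ((a ∷ f) *ₚ g) i ≈ a * coeff g i
    coeff-a i = begin
      coeff ((a ∷ f) *ₚ g) i  ≈⟨ coeff≈ (*ₚ-cong (∷-cong (refl {a}) (DegLt0⇒≋[] f (λ i _ → f< (suc i) (s≤s z≤n)))) (≋-refl {g})) i ⟩
      coeff (constP a *ₚ g) i ≈⟨ coeff≈ (constP-*ₚ a g) i ⟩
      coeff (scale a g) i     ≈⟨ coeff-scale a g i ⟩
      a * coeff g i           ∎
  *ₚ-top (a ∷ f) g (suc d) e f< g< = deg , top
    where
    IH = *ₚ-top f g d e (λ i d≤i → f< (suc i) (s≤s d≤i)) g<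
    coeff-suc : ∀ i → e ≤ i → coeff ((a ∷ f) *ₚ g) (suc i) ≈ coeff (f *ₚ g) i
    coeff-suc i e≤i = begin
      coeff ((a ∷ f) *ₚ g) (suc i)                   ≈⟨ coeff-+ (scale a g) (0# ∷ (f *ₚ g)) (suc i) ⟩
      coeff (scale a g) (suc i) + coeff (f *ₚ g) i   ≈⟨ +-congʳ (DegLt-scale a g g< (suc i) (s≤s e≤i)) ⟩
      0# + coeff (f *ₚ g) i                          ≈⟨ +-identityˡ _ ⟩
      coeff (f *ₚ g) i                               ∎
    deg : DegLt ((a ∷ f) *ₚ g) (suc (suc d ℕ.+ e))
    deg (suc i) (s≤s de≤i) = trans (coeff-suc i (ℕ.≤-trans (ℕ.m≤n+m e (suc d)) de≤i)) (proj₁ IH i de≤i)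
    top : coeff ((a ∷ f) *ₚ g) (suc (d ℕ.+ e)) ≈ coeff f d * coeff g e
    top = trans (coeff-suc (d ℕ.+ e) (ℕ.m≤n+m e d)) (proj₂ IH)

  x≉0∧y≉0⇒xy≉0 : ∀ {x y} → ¬ x ≈ 0# → ¬ y ≈ 0# → ¬ x * y ≈ 0#
  x≉0∧y≉0⇒xy≉0 {x} {y} x≉0 y≉0 xy≈0 = x≉0 (begin
    x               ≈⟨ *-identityʳ x ⟨
    x * 1#          ≈⟨ *-congˡ (⁻¹-inverse y y≉0) ⟨
    x * (y * y ⁻¹)  ≈⟨ *-assoc x y _ ⟨
    (x * y) * y ⁻¹  ≈⟨ *-congʳ xy≈0 ⟩
    0# * y ⁻¹       ≈⟨ zeroˡ _ ⟩
    0#              ∎)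

  ^≉0 : ∀ {x} → ¬ x ≈ 0# → ∀ n → ¬ x ^ n ≈ 0#
  ^≉0 x≉0 zero    = 1≉0
  ^≉0 x≉0 (suc n) = x≉0∧y≉0⇒xy≉0 x≉0 (^≉0 x≉0 n)

  record Degree (f : Poly) (d : ℕ) : Set ℓ where
    constructor degree
    field
      below : DegLt f (suc d)
      lead≉0 : ¬ coeff f d ≈ 0#

  Degree-* : ∀ {f g d e} → Degree f d → Degree g e → Degree (f *ₚ g) (d ℕ.+ e)
  Degree-* {f} {g} {d} {e} (degree f< f≉0) (degree g< g≉0) with *ₚ-top f g d e f< g<
  ... | fg< , top = degree fg< (λ fg≈0 → x≉0∧y≉0⇒xy≉0 f≉0 g≉0 (trans (sym top) fg≈0))

  Degree-≋ : ∀ {f g d} → f ≋ g → Degree f d → Degree g d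
  Degree-≋ {f} {g} e (degree f< f≉0) = degree (DegLt-≋ {f} {g} e f<) (λ g≈0 → f≉0 (trans (coeff≈ e _) g≈0))

  Degree<DegLt : ∀ {f d n} → Degree f d → DegLt f n → d < n
  Degree<DegLt {f} {d} {n} (degree _ f≉0) f< with d ℕ.<? n
  ... | yes d<n = d<n
  ... | no  d≮n = ⊥-elim (f≉0 (f< d (ℕ.≮⇒≥ d≮n)))

  Degree-unique : ∀ {f d e} → Degree f d → Degree f e → d ≡ e
  Degree-unique f-d f-e = ℕ.≤-antisym (ℕ.≤-pred (Degree<DegLt f-d (Degree.below f-e))) (ℕ.≤-pred (Degree<DegLt f-e (Degree.below f-d)))

  Degree⇒¬zero : ∀ {f d} → Degree f d → ¬ f ≋ []
  Degree⇒¬zero (degree _ f≉0) f≈0 = f≉0 (coeff≈ f≈0 _)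

  Degree0⇒const : ∀ {f} → Degree f 0 → IsConstP f
  Degree0⇒const (degree f< _) i = f< (suc i) (s≤s z≤n)

  const⇒≋ : ∀ f → IsConstP f → f ≋ constP (coeff f 0)
  const⇒≋ []      _ = ≋-sym 0∷[]≋[]
  const⇒≋ (a ∷ f) f-const = ∷-cong refl (coeffs f-const)

  ∣ₚ⇒≋ : ∀ {f} g → (f∣g : f ∣ₚ g) → g ≋ proj₁ f∣g *ₚ f
  ∣ₚ⇒≋ g (k , g≈kf) = coeffs g≈kf

  ∣ₚ-trans : ∀ {f g h} → f ∣ₚ g → g ∣ₚ h → f ∣ₚ h
  ∣ₚ-trans {f} {g} {h} f∣g@(k , _) g∣h@(l , _) = l *ₚ k ,
    coeff≈ (≋-trans (∣ₚ⇒≋ h g∣h) (≋-trans (*ₚ-congˡ l (∣ₚ⇒≋ g f∣g)) (≋-sym (*ₚ-assoc l k f))))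

  module Decidable (_≟_ : ∀ x y → Dec (x ≈ y)) where

    zero-or-degree : ∀ f → f ≋ [] ⊎ ∃ (Degree f)
    zero-or-degree [] = inj₁ ≋-refl
    zero-or-degree (a ∷ f) with zero-or-degree f
    ... | inj₂ (d , degree f< f≉0) = inj₂ (suc d , degree (λ { (suc i) (s≤s d<i) → f< i d<i }) f≉0)
    ... | inj₁ f≈0 with a ≟ 0#
    ...   | yes a≈0 = inj₁ (≋-trans (∷-cong a≈0 f≈0) 0∷[]≋[])
    ...   | no  a≉0 = inj₂ (0 , degree (λ { (suc i) _ → coeff≈ f≈0 i }) a≉0)

    ≉[]⇒degree : ∀ {f} → ¬ f ≋ [] → ∃ (Degree f)
    ≉[]⇒degree {f} f≉0 with zero-or-degree f
    ... | inj₁ f≈0 = ⊥-elim (f≉0 f≈0)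
    ... | inj₂ d   = d

    -- The bound on the length of the quotient is what makes repeated division by `g` end after a
    -- known number of digits.
    record Division (f g : Poly) (d : ℕ) : Set (c ⊔ ℓ) where
      field
        quotient remainder : Poly
        f≋qg+r    : f ≋ (quotient *ₚ g) +ₚ remainder
        remainder< : DegLt remainder d
        length-quotient : length quotient ≤ length f ∸ d

    divide : ∀ {g d} → Degree g d → ∀ f → Division f g d
    divide {g} {d} g-d [] = record { quotient = [] ; remainder = [] ; f≋qg+r = ≋-refl ; remainder< = λ _ _ → refl ; length-quotient = z≤n }
    divide {g} {d} g-d (a ∷ f) with suc (length f) ℕ.≤? d
    -- A short dividend gets the empty quotient: a padded zero coefficient would violate the length
    -- bound.
    ... | yes f≤d = record { quotient = [] ; remainder = a ∷ f ; f≋qg+r = ≋-refl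
                           ; remainder< = DegLt-≤ (a ∷ f) f≤d (DegLt-length (a ∷ f)) ; length-quotient = z≤n }
    ... | no  f≰d = record
      { quotient = b ∷ q
      ; remainder = s +ₚ (-ₚ scale b g)
      ; f≋qg+r = ≋-trans (∷-cong (sym (+-identityˡ a)) f≋qg+r)
          (≋-sym (≋-trans (+ₚ-assoc (scale b g) (0# ∷ (q *ₚ g)) _)
            (≋-trans (+ₚ-cong (≋-refl {scale b g}) (≋-sym (+ₚ-assoc (0# ∷ (q *ₚ g)) s (-ₚ scale b g))))
            (≋-trans (+ₚ-swap (scale b g) ((0# ∷ (q *ₚ g)) +ₚ s) _)
            (≋-trans (+ₚ-cong (≋-refl {(0# ∷ (q *ₚ g)) +ₚ s}) (+ₚ-inverseʳ (scale b g))) (+ₚ-identityʳ _))))))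
      ; remainder< = rem<
      ; length-quotient = P.subst (suc (length q) ≤_) (P.sym (ℕ.+-∸-assoc 1 (ℕ.≤-pred (ℕ.≰⇒> f≰d)))) (s≤s length-quotient) }
      where
      open Division (divide g-d f) renaming (quotient to q; remainder to r)
      open Degree g-d
      s = a ∷ r
      -- Multiplying the division of the tail by `X` and adding `a` leaves the remainder
      -- `s = a + X r`, of degree at most `d`; subtracting `b g` cancels its coefficient at `d`.
      b = coeff s d * coeff g d ⁻¹
      coeff-rem : ∀ i → coeff (s +ₚ (-ₚ scale b g)) i ≈ coeff s i + - (b * coeff g i)
      coeff-rem i = trans (coeff-+ s (-ₚ scale b g) i) (+-congˡ (trans (coeff-neg (scale b g) i) (-‿cong (coeff-scale b g i))))
      s< : DegLt s (suc d)
      s< (suc i) (s≤s d≤i) = remainder< i d≤i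
      rem< : DegLt (s +ₚ (-ₚ scale b g)) d
      rem< i d≤i with ℕ.m≤n⇒m<n∨m≡n d≤i
      ... | inj₁ d<i = DegLt-+ s (-ₚ scale b g) s< (DegLt-scale (- 1#) (scale b g) (DegLt-scale b g below)) i d<i
      ... | inj₂ P.refl = trans (coeff-rem d) (x≈y⇒x-y≈0 (begin
        coeff s d                                   ≈⟨ *-identityʳ _ ⟨
        coeff s d * 1#                              ≈⟨ *-congˡ (⁻¹-inverse _ lead≉0) ⟨
        coeff s d * (coeff g d * coeff g d ⁻¹)      ≈⟨ solve 3 (λ x y z → x :* (y :* z) := (x :* z) :* y) refl _ _ _ ⟩
        b * coeff g d                               ∎))

    private
      module PR = CommutativeRing polyRing
      module PT = RingTools polyRing

    record Bezout (f g : Poly) : Set (c ⊔ ℓ) where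
      field
        gcd u v : Poly
        gcd≋ : gcd ≋ (u *ₚ f) +ₚ (v *ₚ g)
        gcd∣f : gcd ∣ₚ f
        gcd∣g : gcd ∣ₚ g

    bezout : ∀ f g → Bezout f g
    bezout f g = go (length g) f g (DegLt-length g)
      where
      g≈0-case : ∀ f {g} → g ≋ [] → Bezout f g
      g≈0-case f {g} g≈0 = record
        { gcd = f ; u = constP 1# ; v = []
        ; gcd≋ = ≋-sym (≋-trans (+ₚ-identityʳ _) (*ₚ-identityˡ f))
        ; gcd∣f = constP 1# , coeff≈ (≋-sym (*ₚ-identityˡ f))
        ; gcd∣g = [] , coeff≈ g≈0 }
      go : ∀ n f g → DegLt g n → Bezout f g
      go zero    f g g< = g≈0-case f (DegLt0⇒≋[] g g<)
      go (suc n) f g g< with zero-or-degree g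
      ... | inj₁ g≈0 = g≈0-case f g≈0
      ... | inj₂ (d , g-d) = record
        { gcd = gcd ; u = v ; v = u PR.+ PR.- (v PR.* q)
        ; gcd≋ = ≋-trans gcd≋ (≋-trans (+ₚ-cong (≋-refl {u *ₚ g}) (*ₚ-congˡ v r≋))
            (PT.solve 5 (λ f g q u v → u PT.:* g PT.:+ v PT.:* (f PT.:- q PT.:* g) PT.:= v PT.:* f PT.:+ (u PT.:- v PT.:* q) PT.:* g) ≋-refl f g q u v))
        ; gcd∣f = (q *ₚ proj₁ gcd∣f) +ₚ proj₁ gcd∣g , coeff≈ (≋-trans f≋qg+r
            (≋-trans (+ₚ-cong (*ₚ-congˡ q (∣ₚ⇒≋ g gcd∣f)) (∣ₚ⇒≋ r gcd∣g))
            (PT.solve 4 (λ q a b h → q PT.:* (a PT.:* h) PT.:+ b PT.:* h PT.:= (q PT.:* a PT.:+ b) PT.:* h) ≋-refl q (proj₁ gcd∣f) (proj₁ gcd∣g) gcd)))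
        ; gcd∣g = gcd∣f }
        where
        open Division (divide g-d f) renaming (quotient to q; remainder to r)
        open Bezout (go n g r (DegLt-≤ r (ℕ.≤-pred (Degree<DegLt g-d g<)) remainder<))
        r≋ : r ≋ f PR.+ PR.- (q PR.* g)
        r≋ = ≋-trans (PT.solve 2 (λ s r → r PT.:= (s PT.:+ r) PT.:- s) ≋-refl (q *ₚ g) r) (+ₚ-cong (≋-sym f≋qg+r) ≋-refl)

    -- Coprimality as an identity: it can be multiplied by a third polynomial to cancel a factor,
    -- which the common-divisor form `CoprimeP` does not allow directly.
    Comaximal : Poly → Poly → Set (c ⊔ ℓ)
    Comaximal f g = ∃ λ u → ∃ λ v → (u *ₚ f) +ₚ (v *ₚ g) ≋ constP 1#

    const-gcd⇒Comaximal : ∀ {f g} (b : Bezout f g) → IsConstP (Bezout.gcd b) → ¬ Bezout.gcd b ≋ [] → Comaximal f g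
    const-gcd⇒Comaximal {f} {g} b gcd-const gcd≉0 = scale (a ⁻¹) u , scale (a ⁻¹) v ,
      ≋-trans (+ₚ-cong (scale-*ₚ (a ⁻¹) u f) (scale-*ₚ (a ⁻¹) v g))
      (≋-trans (≋-sym (scale-+ (a ⁻¹) (u *ₚ f) (v *ₚ g)))
      (≋-trans (scale-cong refl (≋-trans (≋-sym gcd≋) gcd≋a))
      (∷-cong (trans (*-comm _ _) (⁻¹-inverse a a≉0)) ≋-refl)))
      where
      open Bezout b
      a = coeff gcd 0
      gcd≋a : gcd ≋ constP a
      gcd≋a = const⇒≋ gcd gcd-const
      a≉0 : ¬ a ≈ 0#
      a≉0 a≈0 = gcd≉0 (≋-trans gcd≋a (≋-trans (∷-cong a≈0 ≋-refl) 0∷[]≋[]))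

    CoprimeP⇒Comaximal : ∀ {f g} → CoprimeP f g → ¬ g ≋ [] → Comaximal f g
    CoprimeP⇒Comaximal {f} {g} coprime g≉0 = const-gcd⇒Comaximal b (coprime gcd gcd∣f gcd∣g)
      (λ gcd≈0 → g≉0 (≋-trans (∣ₚ⇒≋ g gcd∣g) (≋-trans (*ₚ-congˡ (proj₁ gcd∣g) gcd≈0) (*ₚ-zeroʳ (proj₁ gcd∣g)))))
      where
      b = bezout f g
      open Bezout b

    ∣1⇒const : ∀ {a} → a ∣ₚ constP 1# → IsConstP a
    ∣1⇒const {a} a∣1@(k , _) with zero-or-degree a | zero-or-degree k
    ... | inj₁ a≈0 | _ = λ i → coeff≈ a≈0 (suc i)
    ... | inj₂ _ | inj₁ k≈0 = ⊥-elim (1≉0 (1≈ka′ 0))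
      where
      1≈ka′ : constP 1# ≈ₚ []
      1≈ka′ = coeff≈ (≋-trans (∣ₚ⇒≋ (constP 1#) a∣1) (*ₚ-cong k≈0 (≋-refl {a})))
    ... | inj₂ (d , a-d) | inj₂ (e , k-e)
      with ℕ.m+n≡0⇒n≡0 e (Degree-unique (Degree-≋ (≋-sym (∣ₚ⇒≋ (constP 1#) a∣1)) (Degree-* k-e a-d)) (degree {constP 1#} (DegLt-constP 1#) 1≉0))
    ...   | P.refl = Degree0⇒const a-d

    Comaximal⇒CoprimeP : ∀ {f g} → Comaximal f g → CoprimeP f g
    Comaximal⇒CoprimeP {f} {g} (u , v , uf+vg≈1) a a∣f@(k , _) a∣g@(l , _) = ∣1⇒const ((u *ₚ k) +ₚ (v *ₚ l) ,
      coeff≈ (≋-trans (≋-sym uf+vg≈1) (≋-trans (+ₚ-cong (*ₚ-congˡ u (∣ₚ⇒≋ f a∣f)) (*ₚ-congˡ v (∣ₚ⇒≋ g a∣g)))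
        (PT.solve 5 (λ u v k l a → u PT.:* (k PT.:* a) PT.:+ v PT.:* (l PT.:* a) PT.:= (u PT.:* k PT.:+ v PT.:* l) PT.:* a) ≋-refl u v k l a))))

    Comaximal-∣* : ∀ {f g} → Comaximal f g → ∀ h → f ∣ₚ (h *ₚ g) → f ∣ₚ h
    Comaximal-∣* {f} {g} (u , v , uf+vg≈1) h f∣hg@(k , _) = (h *ₚ u) +ₚ (v *ₚ k) , coeff≈
      (≋-trans (PT.solve 1 (λ h → h PT.:= h PT.:* PT.con (+ 1)) ≋-refl h)
      (≋-trans (*ₚ-congˡ h (≋-sym uf+vg≈1))
      (≋-trans (PT.solve 5 (λ h u f v g → h PT.:* (u PT.:* f PT.:+ v PT.:* g) PT.:= (h PT.:* u) PT.:* f PT.:+ v PT.:* (h PT.:* g)) ≋-refl h u f v g)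
      (≋-trans (+ₚ-cong ≋-refl (*ₚ-congˡ v (∣ₚ⇒≋ (h *ₚ g) f∣hg)))
      (PT.solve 5 (λ h u f v k → (h PT.:* u) PT.:* f PT.:+ v PT.:* (k PT.:* f) PT.:= (h PT.:* u PT.:+ v PT.:* k) PT.:* f) ≋-refl h u f v k)))))

    -- Euclid's lemma. The gcd divides `f`, so it is constant or `f` up to a unit, and the latter
    -- would make `f` divide `g`. Modulo an irreducible `f` this makes every nonzero class
    -- cancellable.
    Irreducible-∣* : ∀ {f} → Irreducible f → ∀ {g} → ¬ f ∣ₚ g → ∀ h → f ∣ₚ (h *ₚ g) → f ∣ₚ h
    Irreducible-∣* {f} (f-nonconst , f-irred) {g} f∤g = Comaximal-∣* (const-gcd⇒Comaximal b gcd-const gcd≉0)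
      where
      b = bezout f g
      open Bezout b
      k = proj₁ gcd∣f
      f≉0 : ¬ f ≋ []
      f≉0 f≈0 = f-nonconst (λ i → coeff≈ f≈0 (suc i))
      gcd≉0 : ¬ gcd ≋ []
      gcd≉0 gcd≈0 = f≉0 (≋-trans (∣ₚ⇒≋ f gcd∣f) (≋-trans (*ₚ-congˡ k gcd≈0) (*ₚ-zeroʳ k)))
      gcd-const : IsConstP gcd
      gcd-const with f-irred k gcd (proj₂ gcd∣f)
      ... | inj₂ gcd-const = gcd-const
      ... | inj₁ k-const = ⊥-elim (f∤g (∣ₚ-trans {f} {gcd} {g} (constP (a ⁻¹) , coeff≈ gcd≈) gcd∣g))
        where
        a = coeff k 0
        f≋ : f ≋ constP a *ₚ gcd
        f≋ = ≋-trans (∣ₚ⇒≋ f gcd∣f) (*ₚ-cong (const⇒≋ k k-const) (≋-refl {gcd}))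
        a≉0 : ¬ a ≈ 0#
        a≉0 a≈0 = f≉0 (≋-trans f≋ (≋-trans (constP-*ₚ a gcd) (≋-trans (scale-cong a≈0 ≋-refl) (scale-0 gcd))))
        gcd≈ : gcd ≋ constP (a ⁻¹) *ₚ f
        gcd≈ = ≋-sym (≋-trans (*ₚ-congˡ (constP (a ⁻¹)) (≋-trans f≋ (constP-*ₚ a gcd)))
          (≋-trans (constP-*ₚ (a ⁻¹) _) (≋-trans (scale-scale (a ⁻¹) a gcd)
          (≋-trans (scale-cong (trans (*-comm _ _) (⁻¹-inverse a a≉0)) ≋-refl) (scale-1 gcd)))))

-- Evaluation of polynomials in an algebra

module Eval {c ℓ a b : Level} (F : Field c ℓ) (A : Algebra F a b) where
  private module F = Field F
  open FieldTheory F
  open Polynomials F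
  open Degrees F using (DegLt)
  open Algebra A
  open RingTools commutativeRing
  open Evaluation commutativeRing
  open import Relation.Binary.Reasoning.Setoid setoid

  eval : Poly → Carrier → Carrier
  eval []      y = 0#
  eval (a ∷ f) y = ι a + y * eval f y

  eval-DegLt : ∀ f n → DegLt f n → ∀ y → eval f y ≈ evalN n (λ i → ι (coeff f i)) y
  eval-DegLt []      n       f< y = sym (evalN-0 n (λ _ _ → ι-0) y)
  eval-DegLt (a ∷ f) (suc n) f< y = +-congˡ (*-congˡ (eval-DegLt f n (λ i n≤i → f< (suc i) (s≤s n≤i)) y))
  eval-DegLt (a ∷ f) zero    f< y = begin
    ι a + y * eval f y ≈⟨ +-cong (trans (ι-cong (f< 0 z≤n)) ι-0) (trans (*-congˡ (eval-DegLt f 0 (λ i _ → f< (suc i) z≤n) y)) (zeroʳ y)) ⟩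
    0# + 0#            ≈⟨ +-identityˡ 0# ⟩
    0#                 ∎

  eval-≋ : ∀ {f g} → f ≋ g → ∀ y → eval f y ≈ eval g y
  eval-≋ {[]}    {g}     e y = sym (eval-DegLt g 0 (λ i _ → F.sym (coeff≈ e i)) y)
  eval-≋ {a ∷ f} {[]}    e y = eval-DegLt (a ∷ f) 0 (λ i _ → coeff≈ e i) y
  eval-≋ {a ∷ f} {b ∷ g} e y = +-cong (ι-cong (coeff≈ e 0)) (*-congˡ (eval-≋ {f} {g} (coeffs λ i → coeff≈ e (suc i)) y))

  eval-+ : ∀ f g y → eval (f +ₚ g) y ≈ eval f y + eval g y
  eval-+ []      g       y = sym (+-identityˡ _)
  eval-+ (a ∷ f) []      y = sym (+-identityʳ _)
  eval-+ (a ∷ f) (b ∷ g) y = trans (+-cong (ι-+ a b) (*-congˡ (eval-+ f g y)))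
    (solve 5 (λ a b y s t → (a :+ b) :+ y :* (s :+ t) := (a :+ y :* s) :+ (b :+ y :* t)) refl _ _ y _ _)

  eval-scale : ∀ a f y → eval (scale a f) y ≈ ι a * eval f y
  eval-scale a []      y = sym (zeroʳ _)
  eval-scale a (b ∷ f) y = trans (+-cong (ι-* a b) (*-congˡ (eval-scale a f y)))
    (solve 4 (λ a b y s → a :* b :+ y :* (a :* s) := a :* (b :+ y :* s)) refl _ _ y _)

  eval-* : ∀ f g y → eval (f *ₚ g) y ≈ eval f y * eval g y
  eval-* []      g y = sym (zeroˡ _)
  eval-* (a ∷ f) g y = trans (eval-+ (scale a g) _ y) (trans (+-cong (eval-scale a g y) (+-cong ι-0 (*-congˡ (eval-* f g y))))
    (solve 4 (λ a y s t → a :* t :+ (con (+ 0) :+ y :* (s :* t)) := (a :+ y :* s) :* t) refl _ y _ _))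

  eval-constP : ∀ a y → eval (constP a) y ≈ ι a
  eval-constP a y = trans (+-congˡ (zeroʳ y)) (+-identityʳ _)

  eval-X : ∀ y → eval Xₚ y ≈ y
  eval-X y = trans (+-cong ι-0 (*-congˡ (eval-constP F.1# y))) (trans (+-identityˡ _) (trans (*-congˡ ι-1) (*-identityʳ y)))

  eval-powP : ∀ f n y → eval (powP f n) y ≈ eval f y ^ n
  eval-powP f zero    y = trans (eval-constP F.1# y) ι-1
  eval-powP f (suc n) y = trans (eval-* f _ y) (*-congˡ (eval-powP f n y))

  eval-neg : ∀ f y → eval (-ₚ f) y ≈ - eval f y
  eval-neg f y = trans (eval-scale (F.- F.1#) f y) (trans (*-congʳ (trans (ι-neg F.1#) (-‿cong ι-1)))
    (solve 1 (λ z → (:- con (+ 1)) :* z := :- z) refl _))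

  eval-^ : ∀ f n y → eval (RingTools._^_ polyRing f n) y ≈ eval f y ^ n
  eval-^ f zero    y = trans (eval-constP F.1# y) ι-1
  eval-^ f (suc n) y = trans (eval-* f (RingTools._^_ polyRing f n) y) (*-congˡ (eval-^ f n y))

module _ {c ℓ : Level} (F : Field c ℓ) where
  open Field F
  open FieldTheory F
  open Polynomials F
  open Eval F (polyAlgebra F)

  -- Because of this, a fact about values in every algebra becomes an identity of polynomials when
  -- it is read at `Xₚ`.
  eval-polyAlgebra-X : ∀ f → eval f Xₚ ≋ f
  eval-polyAlgebra-X []      = ≋-refl
  eval-polyAlgebra-X (a ∷ f) = ≋-trans (+ₚ-cong (≋-refl {constP a})
      (≋-trans (shift-*ₚ (constP 1#) (eval f Xₚ)) (∷-cong refl (≋-trans (*ₚ-identityˡ _) (eval-polyAlgebra-X f)))))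
    (∷-cong (+-identityʳ a) ≋-refl)

-- Finite fields: decidable equality, characteristic, Fermat's theorem

module FiniteField {c ℓ : Level} (F : Field c ℓ) (q : ℕ) (card : FieldTheory.HasCardinality F q) where
  open Field F
  open FieldTheory F
  open RingTools commutativeRing hiding (sum; sum-cong-≋)
  open Degrees F using (x≉0∧y≉0⇒xy≉0)
  open import Relation.Binary.Reasoning.Setoid setoid

  private
    enum : Fin q → Carrier
    enum = proj₁ card

    index : Carrier → Fin q
    index x = proj₁ (proj₁ (proj₂ card) x)

    enum-index : ∀ x → enum (index x) ≈ x
    enum-index x = sym (proj₂ (proj₁ (proj₂ card) x))

    enum-injective : ∀ i j → enum i ≈ enum j → i ≡ j
    enum-injective = proj₂ (proj₂ card)

  infix 4 _≟_
  _≟_ : ∀ x y → Dec (x ≈ y)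
  x ≟ y with index x Fin.≟ index y
  ... | yes i≡j = yes (trans (sym (enum-index x)) (trans (reflexive (P.cong enum i≡j)) (enum-index y)))
  ... | no  i≢j = no λ x≈y → i≢j (enum-injective _ _ (trans (enum-index x) (trans x≈y (sym (enum-index y)))))

  private
    bijection : (f g : Carrier → Carrier) → (∀ {x y} → x ≈ y → f x ≈ f y) → (∀ {x y} → x ≈ y → g x ≈ g y) →
      (∀ x → f (g x) ≈ x) → (∀ x → g (f x) ≈ x) → Permutation q q
    bijection f g f-cong g-cong fg gf = permutation (λ i → index (f (enum i))) (λ i → index (g (enum i)))
      (λ i → enum-injective _ _ (trans (enum-index _) (trans (f-cong (enum-index _)) (fg _))))
      (λ i → enum-injective _ _ (trans (enum-index _) (trans (g-cong (enum-index _)) (gf _))))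

  -- Translation by 1 permutes the field, so the sum of all elements does not change when `q` ones
  -- are added to it.
  q·1≈0 : q · 1# ≈ 0#
  q·1≈0 = begin
    q · 1#                       ≈⟨ solve 2 (λ s t → t := (s :+ t) :- s) refl (sum enum) (q · 1#) ⟩
    (sum enum + q · 1#) + - sum enum ≈⟨ +-congʳ sum-shift ⟨
    sum enum + - sum enum        ≈⟨ -‿inverseʳ _ ⟩
    0#                           ∎
    where
    open Sum +-commutativeMonoid
    shift = bijection (_+ 1#) (_+ - 1#) +-congʳ +-congʳ
      (λ x → solve 1 (λ x → (x :- con (+ 1)) :+ con (+ 1) := x) refl x)
      (λ x → solve 1 (λ x → (x :+ con (+ 1)) :- con (+ 1) := x) refl x)
    sum-shift : sum enum ≈ sum enum + q · 1#
    sum-shift = begin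
      sum enum                               ≈⟨ sum-permute enum shift ⟩
      sum (λ i → enum (index (enum i + 1#))) ≈⟨ sum-cong-≋ (λ i → enum-index (enum i + 1#)) ⟩
      sum (λ i → enum i + 1#)                ≈⟨ ∑-distrib-+ enum (λ _ → 1#) ⟩
      sum enum + sum {q} (λ _ → 1#)          ≈⟨ +-congˡ (sum-replicate q) ⟩
      sum enum + q · 1#                      ∎

  private
    open Sum *-commutativeMonoid using () renaming
      (sum to product; sum-permute to product-permute; sum-cong-≋ to product-cong;
       ∑-distrib-+ to product-distrib; sum-replicate to product-replicate; sum-remove to product-remove)

    product≉0 : ∀ {n} (t : Fin n → Carrier) → (∀ i → ¬ t i ≈ 0#) → ¬ product t ≈ 0#
    product≉0 {zero}  t t≉0 = 1≉0
    product≉0 {suc n} t t≉0 = x≉0∧y≉0⇒xy≉0 (t≉0 Fin.zero) (product≉0 (λ i → t (Fin.suc i)) (λ i → t≉0 (Fin.suc i)))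

    if0_then_else_ : Carrier → Carrier → Carrier → Carrier
    if0 x then a else b with x ≟ 0#
    ... | yes _ = a
    ... | no  _ = b

    if0-yes : ∀ {x} a b → x ≈ 0# → if0 x then a else b ≈ a
    if0-yes {x} a b x≈0 with x ≟ 0#
    ... | yes _   = refl
    ... | no  x≉0 = ⊥-elim (x≉0 x≈0)

    if0-no : ∀ {x} a b → ¬ x ≈ 0# → if0 x then a else b ≈ b
    if0-no {x} a b x≉0 with x ≟ 0#
    ... | yes x≈0 = ⊥-elim (x≉0 x≈0)
    ... | no  _   = refl

    -- Replacing 0 by 1 turns a product over the whole enumeration into the product of the units, so
    -- the nonzero elements need no enumeration of their own.
    nonzero : Carrier → Carrier
    nonzero x = if0 x then 1# else x

    nonzero-cong : ∀ {x y} → x ≈ y → nonzero x ≈ nonzero y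
    nonzero-cong {x} {y} x≈y with x ≟ 0#
    ... | yes x≈0 = sym (if0-yes 1# y (trans (sym x≈y) x≈0))
    ... | no  x≉0 = trans x≈y (sym (if0-no 1# y (λ y≈0 → x≉0 (trans x≈y y≈0))))

    nonzero≉0 : ∀ x → ¬ nonzero x ≈ 0#
    nonzero≉0 x with x ≟ 0#
    ... | yes _   = 1≉0
    ... | no  x≉0 = x≉0

    nonzero-* : ∀ {a} → ¬ a ≈ 0# → ∀ x → nonzero (a * x) ≈ (if0 x then 1# else a) * nonzero x
    nonzero-* {a} a≉0 x with x ≟ 0#
    ... | yes x≈0 = trans (if0-yes 1# (a * x) (trans (*-congˡ x≈0) (zeroʳ a))) (sym (*-identityˡ 1#))
    ... | no  x≉0 = if0-no 1# (a * x) (x≉0∧y≉0⇒xy≉0 a≉0 x≉0)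

    -- Exactly one index enumerates zero, so the product is `a ^ (q - 1)`; the additional factor `a`
    -- avoids the subtraction.
    product-if0 : ∀ a → a * product (λ i → if0 enum i then 1# else a) ≈ a ^ q
    product-if0 a = go q P.refl enum (index 0#) (enum-index 0#) enum-injective
      where
      go : ∀ n → n ≡ q → (enum : Fin n → Carrier) (i₀ : Fin n) → enum i₀ ≈ 0# → (∀ i j → enum i ≈ enum j → i ≡ j) →
        a * product (λ i → if0 enum i then 1# else a) ≈ a ^ n
      go (suc n) _ enum i₀ enum₀ inj = *-congˡ (begin
        product (λ i → if0 enum i then 1# else a)       ≈⟨ product-remove {n} {i₀} (λ i → if0 enum i then 1# else a) ⟩
        (if0 enum i₀ then 1# else a) * product (λ j → if0 enum (punchIn i₀ j) then 1# else a)
          ≈⟨ *-cong (if0-yes 1# a enum₀) (product-cong {n} (λ j → if0-no 1# a (λ e → Fin.punchInᵢ≢i i₀ j (inj _ _ (trans e (sym enum₀)))))) ⟩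
        1# * product {n} (λ j → a)                      ≈⟨ *-identityˡ _ ⟩
        product {n} (λ j → a)                           ≈⟨ product-replicate n ⟩
        a ^ n                                           ∎)

  -- For `a` nonzero, multiplication by `a` permutes the units. Their product `N` therefore equals
  -- `a ^ (q - 1) * N`, and `N` can be cancelled.
  x^q≈x : ∀ a → a ^ q ≈ a
  x^q≈x a with a ≟ 0#
  ... | yes a≈0 = trans (^-congˡ q a≈0) (trans (0^ q (0<q q (index 0#))) (sym a≈0))
    where
    0<q : ∀ n → Fin n → 0 < n
    0<q (suc n) _ = s≤s z≤n
  ... | no  a≉0 = begin
    a ^ q                ≈⟨ product-if0 a ⟨
    a * W                ≈⟨ *-congˡ W≈1 ⟩
    a * 1#               ≈⟨ *-identityʳ a ⟩
    a                    ∎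
    where
    W = product (λ i → if0 enum i then 1# else a)
    N = product (λ i → nonzero (enum i))
    a⁻¹*a : a ⁻¹ * a ≈ 1#
    a⁻¹*a = trans (*-comm _ _) (⁻¹-inverse a a≉0)
    scaling = bijection (a *_) (a ⁻¹ *_) *-congˡ *-congˡ
      (λ x → trans (sym (*-assoc _ _ x)) (trans (*-congʳ (⁻¹-inverse a a≉0)) (*-identityˡ x)))
      (λ x → trans (sym (*-assoc _ _ x)) (trans (*-congʳ a⁻¹*a) (*-identityˡ x)))
    N≈W*N : N ≈ W * N
    N≈W*N = begin
      N                                              ≈⟨ product-permute (λ i → nonzero (enum i)) scaling ⟩
      product (λ i → nonzero (enum (index (a * enum i)))) ≈⟨ product-cong (λ i → trans (nonzero-cong (enum-index _)) (nonzero-* a≉0 (enum i))) ⟩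
      product (λ i → (if0 enum i then 1# else a) * nonzero (enum i)) ≈⟨ product-distrib (λ i → if0 enum i then 1# else a) (λ i → nonzero (enum i)) ⟩
      W * N                                          ∎
    W≈1 : W ≈ 1#
    W≈1 with (W + - 1#) ≟ 0#
    ... | yes e = x-y≈0⇒x≈y e
    ... | no  e = ⊥-elim (x≉0∧y≉0⇒xy≉0 e (product≉0 (λ i → nonzero (enum i)) (λ i → nonzero≉0 (enum i))) (begin
      (W + - 1#) * N   ≈⟨ solve 2 (λ w n → (w :- con (+ 1)) :* n := w :* n :- n) refl W N ⟩
      W * N + - N      ≈⟨ x≈y⇒x-y≈0 (sym N≈W*N) ⟩
      0#               ∎))

module FiniteFieldChar {c ℓ : Level} (F : Field c ℓ) (p e : ℕ) (p-prime : Prime p) (card : FieldTheory.HasCardinality F (p ℕ.^ e)) where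
  open Field F
  open FieldTheory F
  open RingTools commutativeRing
  open FiniteField F (p ℕ.^ e) card public
  open Degrees F using (^≉0)
  open import Relation.Binary.Reasoning.Setoid setoid

  ^·1 : ∀ m n → (m ℕ.^ n) · 1# ≈ (m · 1#) ^ n
  ^·1 m zero    = +-identityʳ 1#
  ^·1 m (suc n) = trans (×1-homo-* m (m ℕ.^ n)) (*-congˡ (^·1 m n))

  -- The element `q · 1` is the `e`-th power of `p · 1`, and a power that vanishes in a field has a
  -- vanishing base.
  p·1≈0 : p · 1# ≈ 0#
  p·1≈0 with (p · 1#) ≟ 0#
  ... | yes e≈0 = e≈0
  ... | no  e≉0 = ⊥-elim (^≉0 e≉0 e (trans (sym (^·1 p e)) q·1≈0))

  open Frobenius commutativeRing p p-prime p·1≈0 public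

  fr-e : ∀ x → fr e x ≈ x
  fr-e x = trans (fr≈^ e x) (x^q≈x x)

  pow≈^ : ∀ x n → pow x n ≈ x ^ n
  pow≈^ x zero    = refl
  pow≈^ x (suc n) = *-congˡ (pow≈^ x n)

  -- `Tr` adds the highest Frobenius power last, `S` takes the lowest one off first; splitting `S`
  -- before its last term reconciles the two recursions.
  Tr≈S : ∀ n x → Tr p n x ≈ S 1 n x
  Tr≈S zero    x = refl
  Tr≈S (suc n) x = begin
    Tr p n x + pow x (p ℕ.^ n)   ≈⟨ +-cong (Tr≈S n x) (trans (pow≈^ x (p ℕ.^ n)) (sym (fr≈^ n x))) ⟩
    S 1 n x + fr n x             ≈⟨ +-congˡ (trans (reflexive (P.cong (λ k → fr k x) (P.sym (ℕ.*-identityʳ n)))) (sym (+-identityʳ _))) ⟩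
    S 1 n x + S 1 1 (fr (n ℕ.* 1) x) ≈⟨ S-split 1 n 1 x ⟨
    S 1 (n ℕ.+ 1) x              ≡⟨ P.cong (λ k → S 1 k x) (ℕ.+-comm n 1) ⟩
    S 1 (suc n) x                ∎

-- Power sums over translates

module PowerSum {a ℓ : Level} (R : CommutativeRing a ℓ) (T : CommutativeRing.Carrier R) (m : ℕ) where
  open CommutativeRing R
  open RingTools R
  open import Relation.Binary.Reasoning.Setoid setoid

  -- The sum of `(Z + jT) ^ m` over `j < n`.
  PS : ℕ → Carrier → Carrier
  PS zero    Z = 0#
  PS (suc n) Z = Z ^ m + PS n (Z + T)

  PS-cong : ∀ n {Y Z} → Y ≈ Z → PS n Y ≈ PS n Z
  PS-cong zero    Y≈Z = refl
  PS-cong (suc n) Y≈Z = +-cong (^-congˡ m Y≈Z) (PS-cong n (+-congʳ Y≈Z))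

  PS-snoc : ∀ n Z → PS (suc n) Z ≈ PS n Z + (Z + n · T) ^ m
  PS-snoc zero    Z = trans (+-comm _ _) (+-congˡ (^-congˡ m (sym (+-identityʳ Z))))
  PS-snoc (suc n) Z = trans (+-congˡ (PS-snoc n (Z + T)))
    (trans (sym (+-assoc _ _ _)) (+-congˡ (^-congˡ m (+-assoc Z T (n · T)))))

  -- The shift drops the term at `Z` and gains the one at `Z + nT`, which is the same.
  PS-periodic : ∀ n → n · T ≈ 0# → ∀ Z → PS n (Z + T) ≈ PS n Z
  PS-periodic n nT≈0 Z = begin
    PS n (Z + T)                           ≈⟨ solve 2 (λ a b → b := (a :+ b) :- a) refl (Z ^ m) _ ⟩
    (Z ^ m + PS n (Z + T)) + - Z ^ m       ≈⟨ +-congʳ (trans (PS-snoc n Z) (+-congˡ (^-congˡ m (trans (+-congˡ nT≈0) (+-identityʳ Z))))) ⟩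
    (PS n Z + Z ^ m) + - Z ^ m             ≈⟨ solve 2 (λ a b → (b :+ a) :- a := b) refl (Z ^ m) _ ⟩
    PS n Z                                 ∎

-- The absolute trace, the prime field and the power sum identity

module Setup {c ℓ : Level} (F : Field c ℓ) (p e : ℕ) (p-prime : Prime p)
  (card : FieldTheory.HasCardinality F (p ℕ.^ e)) where
  private module F where
    open Field F public
    open RingTools commutativeRing public
    open FiniteFieldChar F p e p-prime card public
    open Degrees F public
    open Decidable _≟_ public
    open Evaluation commutativeRing public
  open FieldTheory F
  open Polynomials F

  1<p : 1 < p
  1<p = ℕ.nonTrivial⇒n>1 _ {{prime⇒nonTrivial p-prime}}

  suc[p∸1]≡p : suc (p ∸ 1) ≡ p
  suc[p∸1]≡p = ℕ.m+[n∸m]≡n (ℕ.<⇒≤ 1<p)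

  0<p∸1 : 0 < p ∸ 1
  0<p∸1 = ℕ.m<n⇒0<n∸m 1<p

  tr : F.Carrier → F.Carrier
  tr = F.S 1 e

  -- The sum telescopes to `x ^ q - x`.
  tr-p : ∀ x → tr (x F.^ p F.+ F.- x) F.≈ F.0#
  tr-p x = F.trans (F.S-telescope 1 e x) (F.x≈y⇒x-y≈0
    (F.trans (F.reflexive (P.cong (λ k → F.fr k x) (ℕ.*-identityʳ e))) (F.fr-e x)))

  tr^p : ∀ x → tr x F.^ p F.≈ tr x
  tr^p x = F.x-y≈0⇒x≈y (F.trans (F.+-congʳ (F.sym (F.S-fr 1 1 e x)))
    (F.trans (F.+-congˡ (F.sym (F.S-neg 1 e x))) (F.trans (F.sym (F.S-+ 1 e _ _)) (tr-p x))))

  private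
    k*m·1≈0 : ∀ k m → m F.· F.1# F.≈ F.0# → (k ℕ.* m) F.· F.1# F.≈ F.0#
    k*m·1≈0 k m m≈0 = F.trans (F.×1-homo-* k m) (F.trans (F.*-congˡ m≈0) (F.zeroʳ _))

    1+a≡b⇒¬[a≈0∧b≈0] : ∀ {a b} → suc a ≡ b → a F.· F.1# F.≈ F.0# → ¬ b F.· F.1# F.≈ F.0#
    1+a≡b⇒¬[a≈0∧b≈0] {a} {b} 1+a≡b a≈0 b≈0 = F.1≉0 (begin
      F.1#              ≈⟨ F.+-identityʳ _ ⟨
      F.1# F.+ F.0#     ≈⟨ F.+-congˡ a≈0 ⟨
      suc a F.· F.1#    ≡⟨ P.cong (F._· F.1#) 1+a≡b ⟩
      b F.· F.1#        ≈⟨ b≈0 ⟩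
      F.0#              ∎)
      where open import Relation.Binary.Reasoning.Setoid F.setoid

  -- Since `n` and `p` are coprime, a Bezout relation makes a multiple of one the successor of a
  -- multiple of the other; if both vanished in F, so would 1.
  n·1≉0 : ∀ n → 0 < n → n < p → ¬ n F.· F.1# F.≈ F.0#
  n·1≉0 n@(suc _) _ n<p n·1≈0 with coprime-Bézout (prime⇒coprime p-prime n<p)
  ... | GCD.Bézout.+- x y 1+yn≡xp = 1+a≡b⇒¬[a≈0∧b≈0] 1+yn≡xp (k*m·1≈0 y n n·1≈0) (k*m·1≈0 x p F.p·1≈0)
  ... | GCD.Bézout.-+ x y 1+xp≡yn = 1+a≡b⇒¬[a≈0∧b≈0] 1+xp≡yn (k*m·1≈0 x p F.p·1≈0) (k*m·1≈0 y n n·1≈0)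

  multiples-differ : ∀ {τ} → ¬ τ F.≈ F.0# → ∀ i j → i < j → j < p →
    ¬ (j F.· F.1# F.* τ) F.+ F.- (i F.· F.1# F.* τ) F.≈ F.0#
  multiples-differ {τ} τ≉0 i j i<j j<p e = F.x≉0∧y≉0⇒xy≉0 (n·1≉0 (j ∸ i) (ℕ.m<n⇒0<n∸m i<j) (ℕ.≤-<-trans (ℕ.m∸n≤m j i) j<p)) τ≉0 (begin
    (j ∸ i) F.· F.1# F.* τ                     ≈⟨ F.solve 3 (λ a b t → b F.:* t F.:= (a F.:+ b) F.:* t F.:- a F.:* t) F.refl (i F.· F.1#) _ τ ⟩
    (i F.· F.1# F.+ (j ∸ i) F.· F.1#) F.* τ F.+ F.- (i F.· F.1# F.* τ) ≈⟨ F.+-congʳ (F.*-congʳ (F.×-homo-+ F.1# i (j ∸ i))) ⟨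
    (i ℕ.+ (j ∸ i)) F.· F.1# F.* τ F.+ F.- (i F.· F.1# F.* τ) ≡⟨ P.cong (λ k → k F.· F.1# F.* τ F.+ F.- (i F.· F.1# F.* τ)) (ℕ.m+[n∸m]≡n (ℕ.<⇒≤ i<j)) ⟩
    j F.· F.1# F.* τ F.+ F.- (i F.· F.1# F.* τ) ≈⟨ e ⟩
    F.0#                                       ∎)
    where open import Relation.Binary.Reasoning.Setoid F.setoid

  module Over {a b : Level} (A : Algebra F a b) where
    open Algebra A public
    open RingTools commutativeRing public
    open Evaluation commutativeRing public
    open Eval F A public
    open import Relation.Binary.Reasoning.Setoid setoid

    p·1≈0 : p · 1# ≈ 0#
    p·1≈0 = trans (sym (ι-· p)) (trans (ι-cong F.p·1≈0) ι-0)

    open Frobenius commutativeRing p p-prime p·1≈0 public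

    ι-inverse : ∀ {x} → ¬ x F.≈ F.0# → ι (x F.⁻¹) * ι x ≈ 1#
    ι-inverse {x} x≉0 = trans (sym (ι-* _ x)) (trans (ι-cong (F.trans (F.*-comm _ x) (F.⁻¹-inverse x x≉0))) ι-1)

    ι-nonzerodivisor : ∀ {x} → ¬ x F.≈ F.0# → NonZeroDivisor (ι x)
    ι-nonzerodivisor {x} x≉0 z zx≈0 = begin
      z                         ≈⟨ *-identityʳ z ⟨
      z * 1#                    ≈⟨ *-congˡ (ι-inverse x≉0) ⟨
      z * (ι (x F.⁻¹) * ι x)    ≈⟨ solve 3 (λ z y x → z :* (y :* x) := y :* (z :* x)) refl z _ _ ⟩
      ι (x F.⁻¹) * (z * ι x)    ≈⟨ *-congˡ zx≈0 ⟩
      ι (x F.⁻¹) * 0#           ≈⟨ zeroʳ _ ⟩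
      0#                        ∎

    ι-fr : ∀ k x → ι (F.fr k x) ≈ fr k (ι x)
    ι-fr zero    x = refl
    ι-fr (suc k) x = trans (ι-^ _ p) (^-congˡ p (ι-fr k x))

    ι-S : ∀ k n x → ι (F.S k n x) ≈ S k n (ι x)
    ι-S k zero    x = ι-0
    ι-S k (suc n) x = trans (ι-+ x _) (+-congˡ (trans (ι-S k n _) (S-cong k n (ι-fr k x))))

    fr-e-ι : ∀ x → fr e (ι x) ≈ ι x
    fr-e-ι x = trans (sym (ι-fr e x)) (ι-cong (F.fr-e x))

    fr-*e-ι : ∀ n x → fr (n ℕ.* e) (ι x) ≈ ι x
    fr-*e-ι n x = fr-fixed e (ι x) (fr-e-ι x) n

    x*x^[p∸1] : ∀ x → x * x ^ (p ∸ 1) ≈ x ^ p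
    x*x^[p∸1] x = reflexive (P.cong (x ^_) suc[p∸1]≡p)

    eval-PS : ∀ τ m n f y → eval (PowerSum.PS polyRing (constP τ) m n f) y ≈ PowerSum.PS commutativeRing (ι τ) m n (eval f y)
    eval-PS τ m zero    f y = refl
    eval-PS τ m (suc n) f y = trans (eval-+ (RingTools._^_ polyRing f m) (PowerSum.PS polyRing (constP τ) m n (f +ₚ constP τ)) y) (+-cong (eval-^ f m y)
      (trans (eval-PS τ m n (f +ₚ constP τ) y) (PowerSum.PS-cong commutativeRing (ι τ) m n
        (trans (eval-+ f (constP τ) y) (+-congˡ (eval-constP τ y))))))

  PS-degree : ∀ τ m n f → F.DegLt f 2 → F.DegLt (PowerSum.PS polyRing (constP τ) m n f) (suc m)
  PS-degree τ m zero    f f< i _ = F.refl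
  PS-degree τ m (suc n) f f< = F.DegLt-+ (RingTools._^_ polyRing f m) (PowerSum.PS polyRing (constP τ) m n (f +ₚ constP τ)) (^-degree m)
    (PS-degree τ m n (f +ₚ constP τ) (F.DegLt-+ f (constP τ) f< (F.DegLt-≤ (constP τ) (s≤s z≤n) (F.DegLt-constP τ))))
    where
    ^-degree : ∀ m → F.DegLt (RingTools._^_ polyRing f m) (suc m)
    ^-degree zero    = F.DegLt-constP F.1#
    ^-degree (suc m) = proj₁ (F.*ₚ-top f (RingTools._^_ polyRing f m) 1 m f< (^-degree m))

  module _ (τ : F.Carrier) (τ≉0 : ¬ τ F.≈ F.0#) (τ^p≈τ : τ F.^ p F.≈ τ) where
    private
      module FF = Over (selfAlgebra F)
      open PowerSum F.commutativeRing τ (p ∸ 1)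
      open import Relation.Binary.Reasoning.Setoid F.setoid

    iτ : ℕ → F.Carrier
    iτ i = i F.· F.1# F.* τ

    iτ+τ : ∀ i → iτ i F.+ τ F.≈ iτ (suc i)
    iτ+τ i = F.solve 2 (λ n t → n F.:* t F.:+ t F.:= (F.con (+ 1) F.:+ n) F.:* t) F.refl (i F.· F.1#) τ

    0τ≈0 : iτ 0 F.≈ F.0#
    0τ≈0 = F.zeroˡ τ

    private
      iτ≉0 : ∀ i → 0 < i → i < p → ¬ iτ i F.≈ F.0#
      iτ≉0 i 0<i i<p = F.x≉0∧y≉0⇒xy≉0 (n·1≉0 i 0<i i<p) τ≉0

      iτ^p≈iτ : ∀ i → iτ i F.^ p F.≈ iτ i
      iτ^p≈iτ i = F.trans (F.fr-* 1 (i F.· F.1#) τ) (F.*-cong (F.fr-·1 1 i) τ^p≈τ)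

      iτ^[p∸1]≈1 : ∀ i → 0 < i → i < p → iτ i F.^ (p ∸ 1) F.≈ F.1#
      iτ^[p∸1]≈1 i 0<i i<p = F.x-y≈0⇒x≈y (FF.ι-nonzerodivisor (iτ≉0 i 0<i i<p) _ (begin
        (iτ i F.^ (p ∸ 1) F.+ F.- F.1#) F.* iτ i   ≈⟨ F.solve 2 (λ a b → (a F.:- F.con (+ 1)) F.:* b F.:= b F.:* a F.:- b) F.refl _ (iτ i) ⟩
        iτ i F.* iτ i F.^ (p ∸ 1) F.+ F.- iτ i     ≈⟨ F.x≈y⇒x-y≈0 (F.trans (FF.x*x^[p∸1] (iτ i)) (iτ^p≈iτ i)) ⟩
        F.0#                                       ∎))

      PS-iτ : ∀ n i → 0 < i → i ℕ.+ n ≤ p → PS n (iτ i) F.≈ n F.· F.1#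
      PS-iτ zero    i 0<i _   = F.refl
      PS-iτ (suc n) i 0<i i+n≤p = F.+-cong
        (iτ^[p∸1]≈1 i 0<i (ℕ.≤-trans (s≤s (ℕ.m≤m+n i n)) i+n≤p′))
        (F.trans (PS-cong n (iτ+τ i)) (PS-iτ n (suc i) (s≤s z≤n) i+n≤p′))
        where
        i+n≤p′ : suc (i ℕ.+ n) ≤ p
        i+n≤p′ = P.subst (_≤ p) (ℕ.+-suc i n) i+n≤p

      -- The term at 0 vanishes. The other `p - 1` terms are powers `(iτ) ^ (p - 1)` of nonzero
      -- elements fixed by the p-th power, each equal to 1, and `p - 1` ones add up to -1.
      PS-0 : PS p (iτ 0) F.≈ F.- F.1#
      PS-0 = begin
        PS p (iτ 0)                        ≡⟨ P.cong (λ n → PS n (iτ 0)) suc[p∸1]≡p ⟨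
        iτ 0 F.^ (p ∸ 1) F.+ PS (p ∸ 1) (iτ 0 F.+ τ)
          ≈⟨ F.+-cong (F.trans (F.^-congˡ (p ∸ 1) 0τ≈0) (F.0^ (p ∸ 1) 0<p∸1)) (F.trans (PS-cong (p ∸ 1) (iτ+τ 0))
               (PS-iτ (p ∸ 1) 1 (s≤s z≤n) (ℕ.≤-reflexive suc[p∸1]≡p))) ⟩
        F.0# F.+ (p ∸ 1) F.· F.1#          ≈⟨ F.solve 1 (λ n → F.con (+ 0) F.:+ n F.:= (F.con (+ 1) F.:+ n) F.:- F.con (+ 1)) F.refl _ ⟩
        suc (p ∸ 1) F.· F.1# F.+ F.- F.1#  ≡⟨ P.cong (λ n → n F.· F.1# F.+ F.- F.1#) suc[p∸1]≡p ⟩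
        p F.· F.1# F.+ F.- F.1#            ≈⟨ F.+-congʳ F.p·1≈0 ⟩
        F.0# F.+ F.- F.1#                  ≈⟨ F.+-identityˡ _ ⟩
        F.- F.1#                           ∎

      PS-root : ∀ i → PS p (iτ i) F.≈ F.- F.1#
      PS-root zero    = PS-0
      PS-root (suc i) = F.trans (PS-cong p (F.sym (iτ+τ i))) (F.trans (PS-periodic p (F.p·≈0 τ) (iτ i)) (PS-root i))

      PSₚ : Poly
      PSₚ = PowerSum.PS polyRing (constP τ) (p ∸ 1) p Xₚ

      -- The polynomial Σ (X + jτ)^(p-1) + 1 has degree < p and the p roots jτ.
      PSₚ+1≋0 : PSₚ +ₚ constP F.1# ≋ []
      PSₚ+1≋0 = coeffs coeff≈0
        where
        G = PSₚ +ₚ constP F.1#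
        G< : F.DegLt G p
        G< = F.DegLt-+ PSₚ (constP F.1#)
          (P.subst (F.DegLt PSₚ) suc[p∸1]≡p (PS-degree τ (p ∸ 1) p Xₚ (F.DegLt-length Xₚ)))
          (F.DegLt-≤ (constP F.1#) (ℕ.<⇒≤ 1<p) (F.DegLt-constP F.1#))
        root : ∀ i → i < p → F.evalN p (coeff G) (iτ i) F.≈ F.0#
        root i _ = begin
          F.evalN p (coeff G) (iτ i)           ≈⟨ FF.eval-DegLt G p G< (iτ i) ⟨
          FF.eval G (iτ i)                     ≈⟨ FF.eval-+ PSₚ (constP F.1#) (iτ i) ⟩
          FF.eval PSₚ (iτ i) F.+ FF.eval (constP F.1#) (iτ i)
            ≈⟨ F.+-cong (F.trans (FF.eval-PS τ (p ∸ 1) p Xₚ (iτ i)) (F.trans (PS-cong p (FF.eval-X (iτ i))) (PS-root i))) (FF.eval-constP F.1# (iτ i)) ⟩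
          F.- F.1# F.+ F.1#                    ≈⟨ F.-‿inverseˡ F.1# ⟩
          F.0#                                 ∎
        coeff≈0 : ∀ i → coeff G i F.≈ F.0#
        coeff≈0 i with i ℕ.<? p
        ... | no  i≮p = G< i (ℕ.≮⇒≥ i≮p)
        ... | yes i<p = F.too-many-roots⇒≈0 p (coeff G) iτ
          (λ i j i<j j<p → FF.ι-nonzerodivisor (multiples-differ τ≉0 i j i<j j<p)) root i i<p

    -- In a given algebra the argument by roots reaches only the values `Z = jτ`. Proved as an
    -- identity of polynomials over F, the formula can be evaluated at any `Z`.
    PS≈-1 : ∀ {a b} (A : Algebra F a b) → let module O = Over A in
      ∀ Z → PowerSum.PS O.commutativeRing (O.ι τ) (p ∸ 1) p Z O.≈ O.- O.1#
    PS≈-1 A Z = O.x-y≈0⇒x≈y (O.trans (O.+-cong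
        (O.trans (PowerSum.PS-cong O.commutativeRing (O.ι τ) (p ∸ 1) p (O.sym (O.eval-X Z))) (O.sym (O.eval-PS τ (p ∸ 1) p Xₚ Z)))
        (O.trans (O.-‿involutive O.1#) (O.trans (O.sym O.ι-1) (O.sym (O.eval-constP F.1# Z)))))
      (O.trans (O.sym (O.eval-+ PSₚ (constP F.1#) Z)) (O.eval-≋ PSₚ+1≋0 Z)))
      where module O = Over A

-- Unfolding the homogenisation

module HomogUnfold {c ℓ : Level} (F : Field c ℓ) where
  open Field F
  open FieldTheory F

  homogFrom : Poly → Poly → Poly → ℕ → Poly → Poly
  homogFrom φ N D i []       = []
  homogFrom φ N D i (a ∷ as) = scale a (powP N i *ₚ powP D (length φ ∸ 1 ∸ i)) +ₚ homogFrom φ N D (suc i) as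

  -- The local function of homog has no name outside Defs; with-abstraction
  -- turns it into the solution of the placeholder in go≡homogFrom.
  mutual
    homog≡homogFrom : ∀ φ N D → homog φ N D ≡ homogFrom φ N D 0 φ
    homog≡homogFrom [] N D = P.refl
    homog≡homogFrom (a ∷ as) N D with a ∷ as | 1
    ... | φ | i = P.cong (scale a (powP N 0 *ₚ powP D (length as)) +ₚ_) (go≡homogFrom φ N D i as)

    go≡homogFrom : ∀ φ N D i as → _ ≡ homogFrom φ N D i as
    go≡homogFrom φ N D i [] = P.refl
    go≡homogFrom φ N D i (a ∷ as) = P.cong (scale a (powP N i *ₚ powP D (length φ ∸ 1 ∸ i)) +ₚ_) (go≡homogFrom φ N D (suc i) as)

-- Chains of Artin-Schreier roots and the traces along them

module Chains {c ℓ : Level} (F : Field c ℓ) (p e : ℕ) (p-prime : Prime p)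
  (card : FieldTheory.HasCardinality F (p ℕ.^ e)) (ξ : Field.Carrier F)
  (tr-ξ≉0 : ¬ Field._≈_ F (Setup.tr F p e p-prime card ξ) (Field.0# F)) where
  open Setup F p e p-prime card
  private module F where
    open Field F public
    open RingTools commutativeRing public
    open FiniteFieldChar F p e p-prime card public
    open Degrees F public

  g : F.Carrier → F.Carrier
  g x = (x F.^ p F.+ F.- x) F.+ ξ

  -- The part `x ^ p - x` has absolute trace zero, so `g x` has the trace of `ξ`. Hence `Φ = 1 / g`
  -- is defined on all of F.
  g≉0 : ∀ x → ¬ g x F.≈ F.0#
  g≉0 x gx≈0 = tr-ξ≉0 (begin
    tr ξ                                  ≈⟨ F.+-identityˡ _ ⟨
    F.0# F.+ tr ξ                         ≈⟨ F.+-congʳ (tr-p x) ⟨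
    tr (x F.^ p F.+ F.- x) F.+ tr ξ       ≈⟨ F.S-+ 1 e _ ξ ⟨
    tr (g x)                              ≈⟨ F.S-cong 1 e gx≈0 ⟩
    tr F.0#                               ≈⟨ F.S-0 1 e ⟩
    F.0#                                  ∎)
    where open import Relation.Binary.Reasoning.Setoid F.setoid

  Φ : F.Carrier → F.Carrier
  Φ x = g x F.⁻¹

  Φ*g≈1 : ∀ x → Φ x F.* g x F.≈ F.1#
  Φ*g≈1 x = F.trans (F.*-comm _ _) (F.⁻¹-inverse (g x) (g≉0 x))

  Φ≉0 : ∀ x → ¬ Φ x F.≈ F.0#
  Φ≉0 x Φx≈0 = F.1≉0 (F.trans (F.sym (Φ*g≈1 x)) (F.trans (F.*-congʳ Φx≈0) (F.zeroˡ _)))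

  -- At level 0, `v = 0` and `1 / (v - g a)` is `- Φ a`. Above it, `v = 1 / y`, and with `c = Φ a`
  -- one has `1 / (v - g a) = - c - c² / (y - c)`: the constant has trace zero, and `1 / (y - c)`
  -- has trace `- σ k c`.
  σ : ℕ → F.Carrier → F.Carrier
  σ zero    a = F.- Φ a
  σ (suc k) a = (Φ a F.* Φ a) F.* σ k (Φ a)

  σ≉0 : ∀ k a → ¬ σ k a F.≈ F.0#
  σ≉0 zero    a -Φ≈0 = Φ≉0 a (F.trans (F.sym (F.-‿involutive _)) (F.trans (F.-‿cong -Φ≈0) F.-0#≈0#))
  σ≉0 (suc k) a = F.x≉0∧y≉0⇒xy≉0 (F.x≉0∧y≉0⇒xy≉0 (Φ≉0 a) (Φ≉0 a)) (σ≉0 k (Φ a))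

  -- The trace of `v - ξ` down to F. At level 0 it is `- ξ`; at level `suc k` the constant `ξ`
  -- contributes nothing, and `v = 1 / y` is the case `x = 0` of `1 / (y - x)`.
  θ : ℕ → F.Carrier
  θ zero    = F.- ξ
  θ (suc k) = F.- σ k F.0#

  module InAlgebra {a b : Level} (A : Algebra F a b) where
    open Over A public
    open import Relation.Binary.Reasoning.Setoid setoid

    gᴬ : Carrier → Carrier
    gᴬ y = (y ^ p + - y) + ι ξ

    gᴬ-cong : ∀ {x y} → x ≈ y → gᴬ x ≈ gᴬ y
    gᴬ-cong x≈y = +-congʳ (+-cong (^-congˡ p x≈y) (-‿cong x≈y))

    ι-g : ∀ x → ι (g x) ≈ gᴬ (ι x)
    ι-g x = trans (ι-+ _ ξ) (+-congʳ (trans (ι-- _ x) (+-congʳ (ι-^ x p))))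

    -- Link k v: v = g (y_(k+1)) for a chain g (y₁) = 0, y_i g (y_(i+1)) = 1.
    data Link : ℕ → Carrier → Set (a ⊔ b) where
      base : ∀ {v} → v ≈ 0# → Link 0 v
      step : ∀ {k v} → Link k v → ∀ {w} y → w * y ≈ 1# → gᴬ y ≈ v → Link (suc k) w

    -- Over a chain with nonzero τ's, v has degree p ^ k over F, S e (p ^ k) is the
    -- trace from F(v) to F, and σ k x is the trace of 1 / (v - g x).
    record Conjugates (k : ℕ) (v : Carrier) : Set (c ⊔ a ⊔ b) where
      field
        fixed       : fr (p ℕ.^ k ℕ.* e) v ≈ v
        inverse     : F.Carrier → Carrier
        inverse-*   : ∀ x → inverse x * (v + - ι (g x)) ≈ 1#
        S-inverse   : ∀ x → S e (p ℕ.^ k) (inverse x) ≈ ι (σ k x)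
        S-[v-ξ]     : S e (p ℕ.^ k) (v + - ι ξ) ≈ ι (θ k)

    -- Additivity of `z ^ p - z` makes both sides the difference of `g` at `y` and at `x`, as `ξ`
    -- cancels.
    [y-c]^p-[y-c] : ∀ {v} y → gᴬ y ≈ v → ∀ x → (y + - ι x) ^ p + - (y + - ι x) ≈ v + - ι (g x)
    [y-c]^p-[y-c] {v} y gy≈v x = begin
      (y + - ι x) ^ p + - (y + - ι x)        ≈⟨ +-congʳ (fr-- 1 y (ι x)) ⟩
      (y ^ p + - ι x ^ p) + - (y + - ι x)    ≈⟨ solve 5 (λ yp xp y x t → (yp :- xp) :- (y :- x) := ((yp :- y) :+ t) :- ((xp :- x) :+ t)) refl (y ^ p) (ι x ^ p) y (ι x) (ι ξ) ⟩
      gᴬ y + - gᴬ (ι x)                      ≈⟨ +-cong gy≈v (-‿cong (sym (ι-g x))) ⟩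
      v + - ι (g x)                          ∎

    -- Elements of F are fixed, so the sum is a multiple by `p ^ suc k`. At level 0 the sum has one
    -- term, hence the successor.
    S-ι≈0 : ∀ k x → S e (p ℕ.^ suc k) (ι x) ≈ 0#
    S-ι≈0 k x = trans (S-fixed e (p ℕ.^ suc k) (ι x) (fr-e-ι x)) (p∣⇒·≈0 (m∣m*n (p ℕ.^ k)) (ι x))

    module Root {k v} (conj : Conjugates k v) (y : Carrier) (gy≈v : gᴬ y ≈ v) where
      open Conjugates conj
      private
        n = p ℕ.^ k
        K = n ℕ.* e

      shifted : F.Carrier → Carrier
      shifted x = y + - ι x

      -- With `s = shifted x`, the product `s * (s ^ (p - 1) - 1)` is `v - g x`, whose inverse is
      -- known; the cofactor times that inverse inverts `s`.
      shifted⁻¹ : F.Carrier → Carrier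
      shifted⁻¹ x = inverse x * (shifted x ^ (p ∸ 1) + - 1#)

      shifted⁻¹-* : ∀ x → shifted⁻¹ x * shifted x ≈ 1#
      shifted⁻¹-* x = begin
        (inverse x * (shifted x ^ (p ∸ 1) + - 1#)) * shifted x ≈⟨ solve 3 (λ z a s → (z :* (a :- con (+ 1))) :* s := z :* (s :* a :- s)) refl _ _ _ ⟩
        inverse x * (shifted x * shifted x ^ (p ∸ 1) + - shifted x) ≈⟨ *-congˡ (+-congʳ (x*x^[p∸1] (shifted x))) ⟩
        inverse x * (shifted x ^ p + - shifted x)  ≈⟨ *-congˡ ([y-c]^p-[y-c] y gy≈v x) ⟩
        inverse x * (v + - ι (g x))                ≈⟨ inverse-* x ⟩
        1#                                         ∎

      -- Telescoping `y ^ p - y = v - ξ` leaves a sum of `K` Frobenius powers of `v - ξ`, which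
      -- transitivity splits into the trace down to F followed by the absolute trace.
      fr-y : fr K y ≈ y + ι (tr (θ k))
      fr-y = begin
        fr K y                           ≈⟨ solve 2 (λ f y → f := y :+ (f :- y)) refl _ y ⟩
        y + (fr K y + - y)               ≈⟨ +-congˡ (+-congʳ (reflexive (P.cong (λ j → fr j y) (ℕ.*-identityʳ K)))) ⟨
        y + (fr (K ℕ.* 1) y + - y)       ≈⟨ +-congˡ (S-telescope 1 K y) ⟨
        y + S 1 K (y ^ p + - y)          ≈⟨ +-congˡ (S-cong 1 K (trans (solve 3 (λ a y t → a :- y := ((a :- y) :+ t) :- t) refl (y ^ p) y (ι ξ)) (+-congʳ gy≈v))) ⟩
        y + S 1 K (v + - ι ξ)            ≈⟨ +-congˡ (S-blocks 1 e n _) ⟩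
        y + S 1 e (S (e ℕ.* 1) n (v + - ι ξ)) ≡⟨ P.cong (λ j → y + S 1 e (S j n (v + - ι ξ))) (ℕ.*-identityʳ e) ⟩
        y + S 1 e (S e n (v + - ι ξ))    ≈⟨ +-congˡ (S-cong 1 e S-[v-ξ]) ⟩
        y + S 1 e (ι (θ k))              ≈⟨ +-congˡ (ι-S 1 e (θ k)) ⟨
        y + ι (tr (θ k))                 ∎

      module _ (τ≉0 : ¬ tr (θ k) F.≈ F.0#) where
        private
          τ = tr (θ k)
          open PowerSum commutativeRing (ι τ) (p ∸ 1)

        fr-iterate-y : ∀ j → fr (j ℕ.* K) y ≈ y + j · ι τ
        fr-iterate-y zero    = sym (+-identityʳ y)
        fr-iterate-y (suc j) = begin
          fr (K ℕ.+ j ℕ.* K) y             ≈⟨ fr-∘ K (j ℕ.* K) y ⟩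
          fr K (fr (j ℕ.* K) y)            ≈⟨ fr-cong K (fr-iterate-y j) ⟩
          fr K (y + j · ι τ)               ≈⟨ fr-+ K y _ ⟩
          fr K y + fr K (j · ι τ)          ≈⟨ +-cong fr-y (fr-multiple j) ⟩
          (y + ι τ) + j · ι τ              ≈⟨ +-assoc y _ _ ⟩
          y + suc j · ι τ                  ∎
          where
          fr-multiple : ∀ j → fr K (j · ι τ) ≈ j · ι τ
          fr-multiple j = trans (fr-cong K (·-1 j (ι τ))) (trans (fr-* K _ _) (trans (*-cong (fr-·1 K j) (fr-*e-ι n τ)) (sym (·-1 j (ι τ)))))

        -- Each application of `fr K` translates `Z` by `τ`, which is itself fixed, so the trace sum
        -- of a power is a power sum over translates.
        S-shifted^ : ∀ j Z → fr K Z ≈ Z + ι τ → S K j (Z ^ (p ∸ 1)) ≈ PS j Z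
        S-shifted^ zero    Z frZ = refl
        S-shifted^ (suc j) Z frZ = +-congˡ (trans (S-cong K j (trans (fr-^ K Z (p ∸ 1)) (^-congˡ (p ∸ 1) frZ)))
          (S-shifted^ j (Z + ι τ) (trans (fr-+ K Z _) (+-cong frZ (fr-*e-ι n τ)))))

        fr-inverse : ∀ x → fr K (inverse x) ≈ inverse x
        fr-inverse x = inverse-unique (begin
          fr K (inverse x) * (v + - ι (g x))         ≈⟨ *-congˡ (trans (fr-- K v _) (+-cong fixed (-‿cong (fr-*e-ι n (g x))))) ⟨
          fr K (inverse x) * fr K (v + - ι (g x))    ≈⟨ fr-* K _ _ ⟨
          fr K (inverse x * (v + - ι (g x)))         ≈⟨ fr-cong K (inverse-* x) ⟩
          fr K 1#                                    ≈⟨ fr-1 K ⟩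
          1#                                         ∎) (inverse-* x)

        -- The partial trace of 1 / (y - x): its p conjugates are 1 / (y - x + jτ).
        S-shifted⁻¹-inner : ∀ x → S K p (shifted⁻¹ x) ≈ - inverse x
        S-shifted⁻¹-inner x = begin
          S K p (inverse x * (shifted x ^ (p ∸ 1) + - 1#))        ≈⟨ S-scale K p _ _ (fr-inverse x) ⟩
          inverse x * S K p (shifted x ^ (p ∸ 1) + - 1#)          ≈⟨ *-congˡ (trans (S-+ K p _ _) (+-cong S-power S-one)) ⟩
          inverse x * (- 1# + - 0#)                               ≈⟨ solve 1 (λ z → z :* (:- con (+ 1) :- con (+ 0)) := :- z) refl _ ⟩
          - inverse x                                             ∎
          where
          fr-shifted : fr K (shifted x) ≈ shifted x + ι τ
          fr-shifted = trans (fr-- K y (ι x)) (trans (+-cong fr-y (-‿cong (fr-*e-ι n x)))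
            (solve 3 (λ y t x → (y :+ t) :- x := (y :- x) :+ t) refl y _ _))
          S-power : S K p (shifted x ^ (p ∸ 1)) ≈ - 1#
          S-power = trans (S-shifted^ p (shifted x) fr-shifted) (PS≈-1 τ τ≉0 (tr^p (θ k)) A (shifted x))
          S-one : S K p (- 1#) ≈ - 0#
          S-one = trans (S-neg K p 1#) (-‿cong (trans (S-fixed K p 1# (fr-1 K)) p·1≈0))

        S-shifted⁻¹ : ∀ x → S e (p ℕ.^ suc k) (shifted⁻¹ x) ≈ - ι (σ k x)
        S-shifted⁻¹ x = begin
          S e (p ℕ.* n) (shifted⁻¹ x)     ≈⟨ S-blocks e n p _ ⟩
          S e n (S K p (shifted⁻¹ x))     ≈⟨ S-cong e n (S-shifted⁻¹-inner x) ⟩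
          S e n (- inverse x)             ≈⟨ S-neg e n _ ⟩
          - S e n (inverse x)             ≈⟨ -‿cong (S-inverse x) ⟩
          - ι (σ k x)                     ∎

        conjugates-next : ∀ {w} → w * y ≈ 1# → Conjugates (suc k) w
        conjugates-next {w} wy≈1 = record
          { fixed     = fixed′
          ; inverse   = λ x → - (ι (Φ x) + (ι (Φ x) * ι (Φ x)) * shifted⁻¹ (Φ x))
          ; inverse-* = inverse-*′
          ; S-inverse = S-inverse′
          ; S-[v-ξ]   = S-[w-ξ]
          }
          where
          K′ = p ℕ.^ suc k ℕ.* e
          fr-K′-y : fr K′ y ≈ y
          fr-K′-y = begin
            fr (p ℕ.* n ℕ.* e) y    ≡⟨ P.cong (λ j → fr j y) (ℕ.*-assoc p n e) ⟩
            fr (p ℕ.* K) y          ≈⟨ fr-iterate-y p ⟩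
            y + p · ι τ             ≈⟨ +-congˡ (p·≈0 (ι τ)) ⟩
            y + 0#                  ≈⟨ +-identityʳ y ⟩
            y                       ∎
          fixed′ : fr K′ w ≈ w
          fixed′ = inverse-unique (begin
            fr K′ w * y             ≈⟨ *-congˡ fr-K′-y ⟨
            fr K′ w * fr K′ y       ≈⟨ fr-* K′ w y ⟨
            fr K′ (w * y)           ≈⟨ fr-cong K′ wy≈1 ⟩
            fr K′ 1#                ≈⟨ fr-1 K′ ⟩
            1#                      ∎) wy≈1
          -- 1 / (w - b) = - c - c² / (y - c) for w = 1 / y and c = 1 / b.
          inverse-*′ : ∀ x → - (ι (Φ x) + (ι (Φ x) * ι (Φ x)) * shifted⁻¹ (Φ x)) * (w + - ι (g x)) ≈ 1#
          inverse-*′ x = begin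
            - (C + (C * C) * r) * (w + - B)  ≈⟨ solve 4 (λ c b r w → :- (c :+ (c :* c) :* r) :* (w :- b) :=
                                                  c :* b :- c :* w :+ (c :* b) :* (c :* r) :- ((c :* c) :* r) :* w) refl C B r w ⟩
            C * B + - (C * w) + (C * B) * (C * r) + - (((C * C) * r) * w)
              ≈⟨ +-congʳ (+-cong (+-congʳ CB≈1) (*-congʳ CB≈1)) ⟩
            1# + - (C * w) + 1# * (C * r) + - (((C * C) * r) * w)
              ≈⟨ +-congʳ (+-congˡ (*-congʳ wy≈1)) ⟨
            1# + - (C * w) + (w * y) * (C * r) + - (((C * C) * r) * w)
              ≈⟨ solve 4 (λ c r w y → con (+ 1) :- c :* w :+ (w :* y) :* (c :* r) :- ((c :* c) :* r) :* w :=
                    con (+ 1) :- c :* w :+ (c :* w) :* (r :* (y :- c))) refl C r w y ⟩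
            1# + - (C * w) + (C * w) * (r * (y + - C)) ≈⟨ +-congˡ (*-congˡ (shifted⁻¹-* (Φ x))) ⟩
            1# + - (C * w) + (C * w) * 1#  ≈⟨ solve 2 (λ c w → con (+ 1) :- c :* w :+ (c :* w) :* con (+ 1) := con (+ 1)) refl C w ⟩
            1#                             ∎
            where
            C = ι (Φ x)
            B = ι (g x)
            r = shifted⁻¹ (Φ x)
            CB≈1 : C * B ≈ 1#
            CB≈1 = trans (sym (ι-* _ _)) (trans (ι-cong (Φ*g≈1 x)) ι-1)
          S-inverse′ : ∀ x → S e (p ℕ.^ suc k) (- (ι (Φ x) + (ι (Φ x) * ι (Φ x)) * shifted⁻¹ (Φ x))) ≈ ι (σ (suc k) x)
          S-inverse′ x = begin
            S e m (- (C + (C * C) * r))            ≈⟨ trans (S-neg e m _) (-‿cong (S-+ e m _ _)) ⟩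
            - (S e m C + S e m ((C * C) * r))      ≈⟨ -‿cong (+-cong (S-ι≈0 k (Φ x)) (S-scale e m (C * C) r fr-CC)) ⟩
            - (0# + (C * C) * S e m r)             ≈⟨ -‿cong (+-congˡ (*-congˡ (S-shifted⁻¹ (Φ x)))) ⟩
            - (0# + (C * C) * - ι (σ k (Φ x)))     ≈⟨ solve 2 (λ c s → :- (con (+ 0) :+ c :* (:- s)) := c :* s) refl (C * C) _ ⟩
            (C * C) * ι (σ k (Φ x))                ≈⟨ *-congʳ (ι-* _ _) ⟨
            ι (Φ x F.* Φ x) * ι (σ k (Φ x))        ≈⟨ ι-* _ _ ⟨
            ι (σ (suc k) x)                        ∎
            where
            m = p ℕ.^ suc k
            C = ι (Φ x)
            r = shifted⁻¹ (Φ x)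
            fr-CC : fr e (C * C) ≈ C * C
            fr-CC = trans (fr-* e C C) (*-cong (fr-e-ι _) (fr-e-ι _))
          -- Both invert `y`, so the trace of `w` is the already known trace of `1 / (y - x)` at
          -- `x = 0`.
          w≈ : w ≈ shifted⁻¹ F.0#
          w≈ = inverse-unique wy≈1 (trans (*-congˡ (sym y-0)) (shifted⁻¹-* F.0#))
            where
            y-0 : shifted F.0# ≈ y
            y-0 = trans (+-congˡ (trans (-‿cong ι-0) -0#≈0#)) (+-identityʳ y)
          S-[w-ξ] : S e (p ℕ.^ suc k) (w + - ι ξ) ≈ ι (θ (suc k))
          S-[w-ξ] = begin
            S e m (w + - ι ξ)            ≈⟨ trans (S-+ e m w _) (+-cong (S-cong e m w≈) (trans (S-neg e m _) (-‿cong (S-ι≈0 k ξ)))) ⟩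
            S e m (shifted⁻¹ F.0#) + - 0# ≈⟨ +-congʳ (S-shifted⁻¹ F.0#) ⟩
            - ι (σ k F.0#) + - 0#         ≈⟨ solve 1 (λ s → :- s :- con (+ 0) := :- s) refl _ ⟩
            - ι (σ k F.0#)                ≈⟨ ι-neg _ ⟨
            ι (θ (suc k))                ∎
            where m = p ℕ.^ suc k

    conjugates-base : ∀ {v} → v ≈ 0# → Conjugates 0 v
    conjugates-base {v} v≈0 = record
      { fixed     = trans (fr-cong (1 ℕ.* e) v≈0) (trans (fr-0 (1 ℕ.* e)) (sym v≈0))
      ; inverse   = λ x → - ι (Φ x)
      ; inverse-* = λ x → begin
          - ι (Φ x) * (v + - ι (g x))    ≈⟨ *-congˡ (+-congʳ v≈0) ⟩
          - ι (Φ x) * (0# + - ι (g x))   ≈⟨ solve 2 (λ c b → (:- c) :* (con (+ 0) :- b) := c :* b) refl _ _ ⟩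
          ι (Φ x) * ι (g x)              ≈⟨ ι-* _ _ ⟨
          ι (Φ x F.* g x)                ≈⟨ ι-cong (Φ*g≈1 x) ⟩
          ι F.1#                         ≈⟨ ι-1 ⟩
          1#                             ∎
      ; S-inverse = λ x → trans (+-identityʳ _) (sym (ι-neg _))
      ; S-[v-ξ]   = trans (+-identityʳ _) (trans (+-congʳ v≈0) (trans (+-identityˡ _) (sym (ι-neg ξ))))
      }

    conjugates : ∀ {k v} → (∀ i → i < k → ¬ tr (θ i) F.≈ F.0#) → Link k v → Conjugates k v
    conjugates τ≉0 (base v≈0) = conjugates-base v≈0
    conjugates {suc k} τ≉0 (step link y wy≈1 gy≈v) =
      Root.conjugates-next (conjugates (λ i i<k → τ≉0 i (ℕ.m<n⇒m<1+n i<k)) link) y gy≈v (τ≉0 k (ℕ.n<1+n k)) wy≈1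

-- Numerators and denominators of the iterates, and chains from their roots

module Iterates {c ℓ : Level} (F : Field c ℓ) (p e : ℕ) (p-prime : Prime p)
  (card : FieldTheory.HasCardinality F (p ℕ.^ e)) (ξ : Field.Carrier F)
  (tr-ξ≉0 : ¬ Field._≈_ F (Setup.tr F p e p-prime card ξ) (Field.0# F)) where
  open Setup F p e p-prime card
  open Chains F p e p-prime card ξ tr-ξ≉0
  open FieldTheory F
  open Polynomials F
  open HomogUnfold F
  private module F where
    open Field F public
    open RingTools commutativeRing public
    open FiniteFieldChar F p e p-prime card public
    open Degrees F public
    open Decidable _≟_ public

  coeff-applyUpTo : ∀ f n i → i < n → coeff (applyUpTo f n) i F.≈ f i
  coeff-applyUpTo f (suc n) zero    _         = F.refl
  coeff-applyUpTo f (suc n) (suc i) (s≤s i<n) = coeff-applyUpTo (λ i → f (suc i)) n i i<n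

  DegLt-applyUpTo : ∀ f n → F.DegLt (applyUpTo f n) n
  DegLt-applyUpTo f n = P.subst (F.DegLt (applyUpTo f n)) (List.length-applyUpTo f n) (F.DegLt-length (applyUpTo f n))

  take-≋ : ∀ f n → F.DegLt f n → f ≋ take n f
  take-≋ f       zero    f< = F.DegLt0⇒≋[] f f<
  take-≋ []      (suc n) f< = ≋-refl
  take-≋ (a ∷ f) (suc n) f< = ∷-cong F.refl (take-≋ f n (λ i n≤i → f< (suc i) (s≤s n≤i)))

  gᴾ : Poly
  gᴾ = gPoly p ξ

  powP-X-top : ∀ n → F.DegLt (powP Xₚ n) (suc n) × (coeff (powP Xₚ n) n F.≈ F.1#)
  powP-X-top zero    = F.DegLt-constP F.1# , F.refl
  powP-X-top (suc n) with powP-X-top n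
  ... | X^n< , X^n≈1 with F.*ₚ-top Xₚ (powP Xₚ n) 1 n (F.DegLt-length Xₚ) X^n<
  ...   | X^[1+n]< , top = X^[1+n]< , F.trans top (F.trans (F.*-identityˡ _) X^n≈1)

  gᴾ-degree : F.Degree gᴾ p
  gᴾ-degree = F.degree
    (F.DegLt-+ (powP Xₚ p +ₚ scale (F.- F.1#) Xₚ) (constP ξ)
      (F.DegLt-+ (powP Xₚ p) (scale (F.- F.1#) Xₚ) (proj₁ (powP-X-top p)) (F.DegLt-≤ (scale (F.- F.1#) Xₚ) (ℕ.m≤n⇒m≤1+n 1<p) -X<))
      (F.DegLt-≤ (constP ξ) (s≤s z≤n) (F.DegLt-constP ξ)))
    (λ lead≈0 → F.1≉0 (F.trans (F.sym lead≈1) lead≈0))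
    where
    -X< : F.DegLt (scale (F.- F.1#) Xₚ) 2
    -X< = F.DegLt-scale (F.- F.1#) Xₚ (F.DegLt-length Xₚ)
    lead≈1 : coeff gᴾ p F.≈ F.1#
    lead≈1 = begin
      coeff gᴾ p                             ≈⟨ F.trans (coeff-+ (powP Xₚ p +ₚ scale (F.- F.1#) Xₚ) (constP ξ) p) (F.+-congʳ (coeff-+ (powP Xₚ p) (scale (F.- F.1#) Xₚ) p)) ⟩
      (coeff (powP Xₚ p) p F.+ coeff (scale (F.- F.1#) Xₚ) p) F.+ coeff (constP ξ) p
        ≈⟨ F.+-cong (F.+-cong (proj₂ (powP-X-top p)) (-X< p 1<p)) (F.DegLt-constP ξ p (ℕ.<⇒≤ 1<p)) ⟩
      (F.1# F.+ F.0#) F.+ F.0#               ≈⟨ F.trans (F.+-identityʳ _) (F.+-identityʳ _) ⟩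
      F.1#                                   ∎
      where open import Relation.Binary.Reasoning.Setoid F.setoid

  length-+ₚ : ∀ f g → length (f +ₚ g) ≡ length f ℕ.⊔ length g
  length-+ₚ []      g       = P.refl
  length-+ₚ (a ∷ f) []      = P.refl
  length-+ₚ (a ∷ f) (b ∷ g) = P.cong suc (length-+ₚ f g)

  length-scale : ∀ a f → length (scale a f) ≡ length f
  length-scale a []      = P.refl
  length-scale a (b ∷ f) = P.cong suc (length-scale a f)

  length-powP-X : ∀ n → length (powP Xₚ n) ≡ suc n
  length-powP-X zero    = P.refl
  length-powP-X (suc n) = begin
    length (scale F.0# f +ₚ (F.0# ∷ (scale F.1# f +ₚ (F.0# ∷ [])))) ≡⟨ length-+ₚ (scale F.0# f) _ ⟩
    length (scale F.0# f) ℕ.⊔ suc (length (scale F.1# f +ₚ (F.0# ∷ [])))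
      ≡⟨ P.cong₂ (λ l m → l ℕ.⊔ suc m) (P.trans (length-scale F.0# f) IH) (P.trans (length-+ₚ (scale F.1# f) (F.0# ∷ [])) (P.cong (ℕ._⊔ 1) (P.trans (length-scale F.1# f) IH))) ⟩
    suc n ℕ.⊔ suc (suc (n ℕ.⊔ 0))              ≡⟨ P.cong (λ m → suc n ℕ.⊔ suc (suc m)) (ℕ.⊔-identityʳ n) ⟩
    suc n ℕ.⊔ suc (suc n)                      ≡⟨ ℕ.m≤n⇒m⊔n≡n (ℕ.n≤1+n (suc n)) ⟩
    suc (suc n)                                ∎
    where
    open P.≡-Reasoning
    f = powP Xₚ n
    IH = length-powP-X n

  -- The homogenising exponent is read off the length of the list, where trailing zeros count, so it
  -- has to be computed on the list itself; the degree would not determine it.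
  length-gᴾ : length gᴾ ∸ 1 ≡ p
  length-gᴾ = P.cong (_∸ 1) (begin
    length gᴾ                                                ≡⟨ length-+ₚ (powP Xₚ p +ₚ scale (F.- F.1#) Xₚ) (constP ξ) ⟩
    length (powP Xₚ p +ₚ scale (F.- F.1#) Xₚ) ℕ.⊔ 1          ≡⟨ P.cong (ℕ._⊔ 1) (length-+ₚ (powP Xₚ p) (scale (F.- F.1#) Xₚ)) ⟩
    (length (powP Xₚ p) ℕ.⊔ 2) ℕ.⊔ 1                         ≡⟨ P.cong (λ l → (l ℕ.⊔ 2) ℕ.⊔ 1) (length-powP-X p) ⟩
    (suc p ℕ.⊔ 2) ℕ.⊔ 1                                      ≡⟨ P.cong (ℕ._⊔ 1) (ℕ.m≥n⇒m⊔n≡m (ℕ.m≤n⇒m≤1+n 1<p)) ⟩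
    suc p ℕ.⊔ 1                                              ≡⟨ ℕ.m≥n⇒m⊔n≡m (s≤s z≤n) ⟩
    suc p                                                    ∎)
    where open P.≡-Reasoning

  module Homog (N D : Poly) where
    private
      L : ℕ → Poly → Poly
      L = homogFrom gᴾ N D

      monomial : ℕ → Poly
      monomial i = powP N i *ₚ powP D (length gᴾ ∸ 1 ∸ i)

      L-+ : ∀ i f h → L i (f +ₚ h) ≋ L i f +ₚ L i h
      L-+ i []      h       = ≋-refl
      L-+ i (a ∷ f) []      = ≋-sym (+ₚ-identityʳ _)
      L-+ i (a ∷ f) (b ∷ h) = ≋-trans (+ₚ-cong (scale-distribʳ a b (monomial i)) (L-+ (suc i) f h))
        (interchange (scale a (monomial i)) (scale b (monomial i)) (L (suc i) f) (L (suc i) h))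

      L-scale : ∀ i a f → L i (scale a f) ≋ scale a (L i f)
      L-scale i a []      = ≋-refl
      L-scale i a (b ∷ f) = ≋-trans (+ₚ-cong (≋-sym (scale-scale a b (monomial i))) (L-scale (suc i) a f))
        (≋-sym (scale-+ a (scale b (monomial i)) (L (suc i) f)))

      L-0∷ : ∀ i f → L i (F.0# ∷ f) ≋ L (suc i) f
      L-0∷ i f = +ₚ-cong (scale-0 (monomial i)) ≋-refl

      L-X* : ∀ i f → L i (Xₚ *ₚ f) ≋ L (suc i) f
      L-X* i f = ≋-trans (L-+ i (scale F.0# f) (F.0# ∷ (scale F.1# f +ₚ (F.0# ∷ []))))
        (≋-trans (+ₚ-cong (≋-trans (L-scale i F.0# f) (scale-0 (L i f))) (L-0∷ i (scale F.1# f +ₚ (F.0# ∷ []))))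
        (≋-trans (L-+ (suc i) (scale F.1# f) (F.0# ∷ []))
        (≋-trans (+ₚ-cong (≋-trans (L-scale (suc i) F.1# f) (scale-1 (L (suc i) f))) (L-0∷ (suc i) [])) (+ₚ-identityʳ _))))

      L-powP-X : ∀ i n → L i (powP Xₚ n) ≋ monomial (i ℕ.+ n)
      L-powP-X i zero    = ≋-trans (+ₚ-identityʳ _) (≋-trans (scale-1 (monomial i)) (P.subst (λ j → monomial i ≋ monomial j) (P.sym (ℕ.+-identityʳ i)) ≋-refl))
      L-powP-X i (suc n) = ≋-trans (L-X* i (powP Xₚ n)) (P.subst (λ j → L (suc i) (powP Xₚ n) ≋ monomial j) (P.sym (ℕ.+-suc i n)) (L-powP-X (suc i) n))

    -- `homogFrom` is linear in the coefficient list and turns multiplication by `Xₚ` into a shift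
    -- of its index, so the three summands of `gᴾ` can be homogenised separately.
    homog-gᴾ : homog gᴾ N D ≋ ((powP N p *ₚ powP D 0) +ₚ scale (F.- F.1#) (powP N 1 *ₚ powP D (p ∸ 1))) +ₚ scale ξ (powP N 0 *ₚ powP D p)
    homog-gᴾ rewrite homog≡homogFrom gᴾ N D =
      ≋-trans (L-+ 0 (powP Xₚ p +ₚ scale (F.- F.1#) Xₚ) (constP ξ))
        (+ₚ-cong (≋-trans (L-+ 0 (powP Xₚ p) (scale (F.- F.1#) Xₚ)) (+ₚ-cong (≋-trans (L-powP-X 0 p) (exponent p 0 (ℕ.n∸n≡0 p)))
          (≋-trans (L-scale 0 (F.- F.1#) Xₚ) (scale-cong F.refl (≋-trans L-X (exponent 1 (p ∸ 1) P.refl))))))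
        (≋-trans (+ₚ-identityʳ _) (scale-cong F.refl (exponent 0 p P.refl))))
      where
      exponent : ∀ i j → p ∸ i ≡ j → monomial i ≋ powP N i *ₚ powP D j
      exponent i j p∸i≡j = P.subst (λ k → monomial i ≋ powP N i *ₚ powP D k)
        (P.trans (P.cong (_∸ i) length-gᴾ) p∸i≡j) ≋-refl
      L-X : L 0 Xₚ ≋ monomial 1
      L-X = ≋-trans (L-0∷ 0 (F.1# ∷ [])) (≋-trans (+ₚ-identityʳ _) (scale-1 (monomial 1)))

  module IteratesIn {a b : Level} (A : Algebra F a b) where
    open InAlgebra A public
    open import Relation.Binary.Reasoning.Setoid setoid

    eval-gᴾ : ∀ y → eval gᴾ y ≈ gᴬ y
    eval-gᴾ y = trans (eval-+ (powP Xₚ p +ₚ scale (F.- F.1#) Xₚ) (constP ξ) y)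
      (+-cong (trans (eval-+ (powP Xₚ p) (scale (F.- F.1#) Xₚ) y)
        (+-cong (trans (eval-powP Xₚ p y) (^-congˡ p (eval-X y)))
          (trans (eval-scale (F.- F.1#) Xₚ y) (trans (*-cong (trans (ι-neg F.1#) (-‿cong ι-1)) (eval-X y))
            (solve 1 (λ y → (:- con (+ 1)) :* y := :- y) refl y)))))
        (eval-constP ξ y))

    -- This is `D ^ p * g (N / D)` with the division cleared, meaningful also where `D` is not
    -- invertible.
    den : Carrier → Carrier → Carrier
    den N D = (N ^ p + - (N * D ^ (p ∸ 1))) + ι ξ * D ^ p

    den-cong : ∀ {N N′ D D′} → N ≈ N′ → D ≈ D′ → den N D ≈ den N′ D′
    den-cong N≈ D≈ = +-cong (+-cong (^-congˡ p N≈) (-‿cong (*-cong N≈ (^-congˡ (p ∸ 1) D≈)))) (*-congˡ (^-congˡ p D≈))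

    num : ℕ → Carrier → Carrier
    denom : ℕ → Carrier → Carrier
    num zero    y = y
    num (suc n) y = denom n y ^ p
    denom zero    y = 1#
    denom (suc n) y = den (num n y) (denom n y)

    eval-iterΦ : ∀ n y → (eval (proj₁ (iterΦ gᴾ n)) y ≈ num n y) × (eval (proj₂ (iterΦ gᴾ n)) y ≈ denom n y)
    eval-iterΦ zero    y = eval-X y , trans (eval-constP F.1# y) ι-1
    eval-iterΦ (suc n) y with eval-iterΦ n y
    ... | N≈ , D≈ =
      trans (eval-powP D (length gᴾ ∸ 1) y) (trans (reflexive (P.cong (eval D y ^_) length-gᴾ)) (^-congˡ p D≈)) ,
      (begin
        eval (homog gᴾ N D) y     ≈⟨ eval-≋ (Homog.homog-gᴾ N D) y ⟩
        eval (((powP N p *ₚ powP D 0) +ₚ scale (F.- F.1#) (powP N 1 *ₚ powP D (p ∸ 1))) +ₚ scale ξ (powP N 0 *ₚ powP D p)) y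
          ≈⟨ trans (eval-+ ((powP N p *ₚ powP D 0) +ₚ scale (F.- F.1#) (powP N 1 *ₚ powP D (p ∸ 1))) (scale ξ (powP N 0 *ₚ powP D p)) y)
               (+-cong (trans (eval-+ (powP N p *ₚ powP D 0) (scale (F.- F.1#) (powP N 1 *ₚ powP D (p ∸ 1))) y)
                 (+-cong (eval-monomial p 0) (trans (eval-scale (F.- F.1#) (powP N 1 *ₚ powP D (p ∸ 1)) y) (*-congˡ (eval-monomial 1 (p ∸ 1))))))
                 (trans (eval-scale ξ (powP N 0 *ₚ powP D p) y) (*-congˡ (eval-monomial 0 p)))) ⟩
        (num n y ^ p * 1# + ι (F.- F.1#) * ((num n y * 1#) * denom n y ^ (p ∸ 1))) + ι ξ * (1# * denom n y ^ p)
          ≈⟨ +-congʳ (+-congˡ (*-congʳ (trans (ι-neg F.1#) (-‿cong ι-1)))) ⟩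
        (num n y ^ p * 1# + - 1# * ((num n y * 1#) * denom n y ^ (p ∸ 1))) + ι ξ * (1# * denom n y ^ p)
          ≈⟨ solve 5 (λ np n dp x d → (np :* con (+ 1) :+ (:- con (+ 1)) :* ((n :* con (+ 1)) :* dp)) :+ x :* (con (+ 1) :* d) := (np :- n :* dp) :+ x :* d) refl _ _ _ _ _ ⟩
        den (num n y) (denom n y) ∎)
      where
      N = proj₁ (iterΦ gᴾ n)
      D = proj₂ (iterΦ gᴾ n)
      eval-monomial : ∀ i j → eval (powP N i *ₚ powP D j) y ≈ num n y ^ i * denom n y ^ j
      eval-monomial i j = trans (eval-* (powP N i) (powP D j) y)
        (*-cong (trans (eval-powP N i y) (^-congˡ i N≈)) (trans (eval-powP D j y) (^-congˡ j D≈)))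

    g-fraction : ∀ N D i → i * D ≈ 1# → gᴬ (N * i) ≈ i ^ p * den N D
    g-fraction N D i iD≈1 = sym (begin
      i ^ p * den N D                             ≈⟨ solve 6 (λ ip np n d x dp → ip :* ((np :- n :* d) :+ x :* dp) := (np :* ip :- n :* (ip :* d)) :+ x :* (ip :* dp)) refl _ _ N _ _ _ ⟩
      (N ^ p * i ^ p + - (N * (i ^ p * D ^ (p ∸ 1)))) + ι ξ * (i ^ p * D ^ p)
        ≈⟨ +-cong (+-cong (sym (^-distrib-* N i p)) (-‿cong (*-congˡ i^p*D^[p∸1]))) (*-congˡ (iD^n≈1 p)) ⟩
      ((N * i) ^ p + - (N * i)) + ι ξ * 1#        ≈⟨ +-congˡ (*-identityʳ _) ⟩
      gᴬ (N * i)                                  ∎)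
      where
      iD^n≈1 : ∀ n → i ^ n * D ^ n ≈ 1#
      iD^n≈1 n = trans (sym (^-distrib-* i D n)) (trans (^-congˡ n iD≈1) (1^ n))
      i^p*D^[p∸1] : i ^ p * D ^ (p ∸ 1) ≈ i
      i^p*D^[p∸1] = trans (*-congʳ (sym (x*x^[p∸1] i))) (trans (*-assoc i _ _) (trans (*-congˡ (iD^n≈1 (p ∸ 1))) (*-identityʳ i)))

    Coprime : Carrier → Carrier → Set (a ⊔ b)
    Coprime x y = ∃ λ u → ∃ λ v → u * x + v * y ≈ 1#

    Coprime-sym : ∀ {x y} → Coprime x y → Coprime y x
    Coprime-sym (u , v , e) = v , u , trans (+-comm _ _) e

    Coprime-* : ∀ {x y z} → Coprime x y → Coprime x z → Coprime x (y * z)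
    Coprime-* {x} {y} {z} (u , v , e) (u′ , v′ , e′) = u + v * y * u′ , v * v′ , (begin
      (u + v * y * u′) * x + v * v′ * (y * z)      ≈⟨ solve 7 (λ u v u′ v′ x y z → (u :+ v :* y :* u′) :* x :+ v :* v′ :* (y :* z) := u :* x :+ (v :* y) :* (u′ :* x :+ v′ :* z)) refl u v u′ v′ x y z ⟩
      u * x + (v * y) * (u′ * x + v′ * z)          ≈⟨ +-congˡ (trans (*-congˡ e′) (*-identityʳ _)) ⟩
      u * x + v * y                                ≈⟨ e ⟩
      1#                                           ∎)

    Coprime-^ : ∀ {x y} → Coprime x y → ∀ n → Coprime x (y ^ n)
    Coprime-^ cop zero    = 0# , 1# , trans (+-cong (zeroˡ _) (*-identityˡ 1#)) (+-identityˡ 1#)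
    Coprime-^ cop (suc n) = Coprime-* cop (Coprime-^ cop n)

    Coprime-shift : ∀ {x y} → Coprime x y → ∀ k {z} → z ≈ y + k * x → Coprime x z
    Coprime-shift {x} {y} (u , v , e) k {z} z≈ = u + - (v * k) , v , trans (+-congˡ (*-congˡ z≈))
      (trans (solve 5 (λ u v k x y → (u :- v :* k) :* x :+ v :* (y :+ k :* x) := u :* x :+ v :* y) refl u v k x y) e)

    -- The new denominator is `N ^ p` plus a multiple of `D`, hence coprime to `D` and to `D ^ p`,
    -- the new numerator.
    num-denom-coprime : ∀ n y → Coprime (num n y) (denom n y)
    num-denom-coprime zero    y = 0# , 1# , trans (+-cong (zeroˡ _) (*-identityˡ 1#)) (+-identityˡ 1#)
    num-denom-coprime (suc n) y = Coprime-sym (Coprime-^ (Coprime-sym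
      (Coprime-shift (Coprime-^ (Coprime-sym (num-denom-coprime n y)) p) k den≈)) p)
      where
      N = num n y
      D = denom n y
      -- A factor `D` is taken out of `N * D ^ (p - 1)`, which is possible because `p` is at least
      -- 2.
      k = - (N * D ^ (p ∸ 1 ∸ 1)) + ι ξ * D ^ (p ∸ 1)
      D*D^ : D * D ^ (p ∸ 1 ∸ 1) ≈ D ^ (p ∸ 1)
      D*D^ = reflexive (P.cong (D ^_) (ℕ.m+[n∸m]≡n 0<p∸1))
      den≈ : den N D ≈ N ^ p + k * D
      den≈ = trans (+-cong (+-congˡ (-‿cong (*-congˡ (sym D*D^)))) (*-congˡ (sym (x*x^[p∸1] D))))
        (solve 6 (λ np n d d₂ x d₁ → (np :- n :* (d :* d₂)) :+ x :* (d :* d₁) := np :+ (:- (n :* d₂) :+ x :* d₁) :* d) refl _ N D _ _ _)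

    unit-base : ∀ x {u} → u * x ^ p ≈ 1# → (u * x ^ (p ∸ 1)) * x ≈ 1#
    unit-base x {u} ux^p≈1 = trans (trans (*-assoc u _ x) (*-congˡ (trans (*-comm _ x) (x*x^[p∸1] x)))) ux^p≈1

    -- The points num k / denom k for k = n - 1, n - 2, …, 0 are the chain members y₁, y₂, …, y_n.
    chain-from : ∀ y k j → (∀ i → i < j → ¬ tr (θ i) F.≈ F.0#) → denom (k ℕ.+ suc j) y ≈ 0# →
      ∃ λ i → (i * denom k y ≈ 1#) × ∃ λ v → Link j v × (gᴬ (num k y * i) ≈ v)
    chain-from y k zero τ≉0 denom≈0 = i , iD≈1 , _ , base v≈0 , g-fraction _ _ i iD≈1
      where
      denom′≈0 : denom (suc k) y ≈ 0#
      denom′≈0 = trans (reflexive (P.cong (λ n → denom n y) (ℕ.+-comm 1 k))) denom≈0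
      cop = num-denom-coprime (suc k) y
      u = proj₁ cop
      -- Where the next denominator vanishes, the Bezout relation reduces to `u * D ^ p = 1`, so `D`
      -- is a unit.
      i = u * denom k y ^ (p ∸ 1)
      iD≈1 : i * denom k y ≈ 1#
      iD≈1 = unit-base (denom k y) (begin
        u * num (suc k) y                                       ≈⟨ +-identityʳ _ ⟨
        u * num (suc k) y + 0#                                  ≈⟨ +-congˡ (trans (*-congˡ denom′≈0) (zeroʳ _)) ⟨
        u * num (suc k) y + proj₁ (proj₂ cop) * denom (suc k) y ≈⟨ proj₂ (proj₂ cop) ⟩
        1#                                                      ∎)
      v≈0 : i ^ p * denom (suc k) y ≈ 0#
      v≈0 = trans (*-congˡ denom′≈0) (zeroʳ _)
    chain-from y k (suc j) τ≉0 denom≈0 with chain-from y (suc k) j (λ i i<j → τ≉0 i (ℕ.m<n⇒m<1+n i<j))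
                                           (trans (reflexive (P.cong (λ n → denom n y) (P.sym (ℕ.+-suc k (suc j))))) denom≈0)
    ... | i′ , i′D′≈1 , v′ , link , gy′≈v′ = i , iD≈1 , _ , step link y′ vy′≈1 gy′≈v′ , g-fraction _ _ i iD≈1
      where
      D = denom k y
      D′ = denom (suc k) y
      y′ = D ^ p * i′
      open Root (conjugates (λ i i<j → τ≉0 i (ℕ.m<n⇒m<1+n i<j)) link) y′ gy′≈v′
      -- Invertibility of `D` has to come from that of `y′ = D ^ p * i′`. The conjugates computed
      -- for the shorter chain provide an inverse of `y′ - 0`.
      s = shifted⁻¹ F.0#
      sy′≈1 : s * y′ ≈ 1#
      sy′≈1 = trans (*-congˡ (sym (trans (+-congˡ (trans (-‿cong ι-0) -0#≈0#)) (+-identityʳ y′)))) (shifted⁻¹-* F.0#)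
      i = (s * i′) * D ^ (p ∸ 1)
      iD≈1 : i * D ≈ 1#
      iD≈1 = unit-base D (trans (solve 3 (λ s i d → (s :* i) :* d := s :* (d :* i)) refl s i′ (D ^ p)) sy′≈1)
      vy′≈1 : (i ^ p * D′) * y′ ≈ 1#
      vy′≈1 = begin
        (i ^ p * D′) * (D ^ p * i′)     ≈⟨ solve 4 (λ a b c d → (a :* b) :* (c :* d) := (a :* c) :* (d :* b)) refl _ D′ _ i′ ⟩
        (i ^ p * D ^ p) * (i′ * D′)     ≈⟨ *-cong (trans (sym (^-distrib-* i D p)) (trans (^-congˡ p iD≈1) (1^ p))) i′D′≈1 ⟩
        1# * 1#                         ≈⟨ *-identityˡ 1# ⟩
        1#                              ∎

    denom-root⇒chain : ∀ y j → (∀ i → i < j → ¬ tr (θ i) F.≈ F.0#) → denom (suc j) y ≈ 0# → ∃ λ v → Link j v × (gᴬ y ≈ v)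
    denom-root⇒chain y j τ≉0 denom≈0 with chain-from y 0 j τ≉0 denom≈0
    ... | i , i*1≈1 , v , link , g≈v = v , link , trans (gᴬ-cong (sym (trans (*-congˡ (trans (sym (*-identityʳ i)) i*1≈1)) (*-identityʳ y)))) g≈v

-- Linear independence of powers along a chain

module Independence {c ℓ : Level} (F : Field c ℓ) (p e : ℕ) (p-prime : Prime p)
  (card : FieldTheory.HasCardinality F (p ℕ.^ e)) (ξ : Field.Carrier F)
  (tr-ξ≉0 : ¬ Field._≈_ F (Setup.tr F p e p-prime card ξ) (Field.0# F)) where
  open Setup F p e p-prime card
  open Chains F p e p-prime card ξ tr-ξ≉0
  open Iterates F p e p-prime card ξ tr-ξ≉0
  open FieldTheory F
  open Polynomials F
  private module F where
    open Field F public
    open RingTools commutativeRing public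
    open FiniteFieldChar F p e p-prime card public
    open Degrees F public
    open Decidable _≟_ public

  module _ {a b : Level} (A : Algebra F a b) (1≉0 : ¬ Algebra._≈_ A (Algebra.1# A) (Algebra.0# A)) where
    open IteratesIn A
    open import Relation.Binary.Reasoning.Setoid setoid

    ι-injective : ∀ {x} → ι x ≈ 0# → x F.≈ F.0#
    ι-injective {x} ιx≈0 with x F.≟ F.0#
    ... | yes x≈0 = x≈0
    ... | no  x≉0 = ⊥-elim (1≉0 (ι-nonzerodivisor x≉0 1# (trans (*-identityˡ _) ιx≈0)))

    -- Linear independence over F of the powers of `x` with exponents below `n`.
    NoRelation : ℕ → Carrier → Set (c ⊔ ℓ ⊔ b)
    NoRelation n x = ∀ f → F.DegLt f n → eval f x ≈ 0# → f ≋ []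

    -- The expansion in base `g`. Since `g` takes the value `x` at `y`, evaluation turns the powers
    -- of the base into powers of `x` and leaves digits of degree below `p` in `y`.
    record Digits (M : ℕ) (f : Poly) (x y : Carrier) : Set (c ⊔ ℓ ⊔ b) where
      field
        digit   : ℕ → Poly
        digit<  : ∀ j → F.DegLt (digit j) p
        eval≈   : eval f y ≈ evalN M (λ j → eval (digit j) y) x
        digits≋0⇒≋0 : (∀ j → j < M → digit j ≋ []) → f ≋ []

    digits : ∀ M f {x y} → gᴬ y ≈ x → F.DegLt f (M ℕ.* p) → Digits M f x y
    digits zero f {x} {y} gy≈x f< = record
      { digit = λ _ → [] ; digit< = λ _ _ _ → F.refl
      ; eval≈ = eval-DegLt f 0 f< y ; digits≋0⇒≋0 = λ _ → F.DegLt0⇒≋[] f f< }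
    digits (suc M) f {x} {y} gy≈x f< = record
      { digit = λ { zero → r ; (suc j) → digit j }
      ; digit< = λ { zero → remainder< ; (suc j) → digit< j }
      ; eval≈ = begin
          eval f y                                       ≈⟨ eval-≋ (≋-trans f≋f′ f≋qg+r) y ⟩
          eval ((q *ₚ gᴾ) +ₚ r) y                        ≈⟨ trans (eval-+ (q *ₚ gᴾ) r y) (+-congʳ (eval-* q gᴾ y)) ⟩
          eval q y * eval gᴾ y + eval r y                ≈⟨ +-congʳ (*-cong eval≈ (trans (eval-gᴾ y) gy≈x)) ⟩
          evalN M (λ j → eval (digit j) y) x * x + eval r y ≈⟨ solve 3 (λ a x r → a :* x :+ r := r :+ x :* a) refl _ x _ ⟩
          eval r y + x * evalN M (λ j → eval (digit j) y) x ∎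
      ; digits≋0⇒≋0 = λ d≋0 → ≋-trans f≋f′ (≋-trans f≋qg+r
          (≋-trans (+ₚ-cong (*ₚ-cong (digits≋0⇒≋0 (λ j j<M → d≋0 (suc j) (s≤s j<M))) (≋-refl {gᴾ})) ≋-refl) (d≋0 0 (s≤s z≤n)))) }
      where
      n = suc M ℕ.* p
      -- The hypothesis bounds the degree, division bounds the quotient by list length; cutting off
      -- trailing zeros makes the two agree.
      f′ = take n f
      f≋f′ : f ≋ f′
      f≋f′ = take-≋ f n f<
      open F.Division (F.divide gᴾ-degree f′) renaming (quotient to q; remainder to r)
      q< : F.DegLt q (M ℕ.* p)
      q< = F.DegLt-≤ q (ℕ.≤-trans length-quotient (ℕ.≤-trans
        (ℕ.∸-monoˡ-≤ p (P.subst (_≤ n) (P.sym (List.length-take n f)) (ℕ.m⊓n≤m n (length f))))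
        (ℕ.≤-reflexive (ℕ.m+n∸m≡n p (M ℕ.* p))))) (F.DegLt-length q)
      open Digits (digits M q gy≈x q<)

    -- Exchanging the sums rereads a base `g` expansion as a polynomial in `y` whose coefficients
    -- are polynomials in `x`.
    evalN-swap : ∀ M n (k : ℕ → ℕ → Carrier) x y →
      evalN M (λ j → evalN n (k j) y) x ≈ evalN n (λ i → evalN M (λ j → k j i) x) y
    evalN-swap zero    n k x y = sym (evalN-0 n (λ _ _ → refl) y)
    evalN-swap (suc M) n k x y = begin
      evalN n (k 0) y + x * evalN M (λ j → evalN n (k (suc j)) y) x                     ≈⟨ +-congˡ (*-congˡ (evalN-swap M n (λ j → k (suc j)) x y)) ⟩
      evalN n (k 0) y + x * evalN n (λ i → evalN M (λ j → k (suc j) i) x) y             ≈⟨ +-congˡ (evalN-scale n x _ y) ⟨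
      evalN n (k 0) y + evalN n (λ i → x * evalN M (λ j → k (suc j) i) x) y             ≈⟨ evalN-+ n (k 0) _ y ⟨
      evalN n (λ i → k 0 i + x * evalN M (λ j → k (suc j) i) x) y                       ∎

    fr-evalN : ∀ m n k x → fr m (evalN n k x) ≈ evalN n (λ i → fr m (k i)) (fr m x)
    fr-evalN m zero    k x = fr-0 m
    fr-evalN m (suc n) k x = trans (fr-+ m _ _) (+-congˡ (trans (fr-* m _ _) (*-congˡ (fr-evalN m n (λ i → k (suc i)) x))))

    -- A relation of degree < p ^ (k + 1) for y is a relation of degree < p for y
    -- with coefficients in F[v]; the latter also kills the conjugates y + jτ.
    noRelation-root : ∀ {k v} → (conj : Conjugates k v) → ∀ y → gᴬ y ≈ v → ¬ tr (θ k) F.≈ F.0# →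
      NoRelation (p ℕ.^ k) v → NoRelation (p ℕ.^ suc k) y
    noRelation-root {k} {v} conj y gy≈v τ≉0 indep f f< fy≈0 = digits≋0⇒≋0 digit≋0
      where
      open Conjugates conj
      open Root conj y gy≈v
      M = p ℕ.^ k
      K = M ℕ.* e
      τ = tr (θ k)
      open Digits (digits M f gy≈v (P.subst (F.DegLt f) (ℕ.*-comm p M) f<))
      column : ℕ → Poly
      column i = applyUpTo (λ j → coeff (digit j) i) M
      C : ℕ → Carrier
      C i = evalN M (λ j → ι (coeff (digit j) i)) v
      y-root : evalN p C y ≈ 0#
      y-root = begin
        evalN p C y                                                      ≈⟨ evalN-swap M p (λ j i → ι (coeff (digit j) i)) v y ⟨
        evalN M (λ j → evalN p (λ i → ι (coeff (digit j) i)) y) v        ≈⟨ evalN-cong M (λ j _ → eval-DegLt (digit j) p (digit< j) y) v ⟨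
        evalN M (λ j → eval (digit j) y) v                               ≈⟨ eval≈ ⟨
        eval f y                                                         ≈⟨ fy≈0 ⟩
        0#                                                               ∎
      -- The `C i` lie in F[v], and `fr K` fixes both F and `v`; applied to the relation, it moves
      -- only `y`.
      fr-C : ∀ j i → fr (j ℕ.* K) (C i) ≈ C i
      fr-C j i = fr-fixed K (C i) (trans (fr-evalN K M _ v)
        (trans (evalN-cong M (λ j _ → fr-*e-ι M _) (fr K v)) (evalN-congʳ M fixed))) j
      conjugate-root : ∀ j → evalN p C (fr (j ℕ.* K) y) ≈ 0#
      conjugate-root j = trans (evalN-cong p (λ i _ → sym (fr-C j i)) _) (trans (sym (fr-evalN (j ℕ.* K) p C y))
        (trans (fr-cong (j ℕ.* K) y-root) (fr-0 (j ℕ.* K))))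
      difference : ∀ i j → fr (j ℕ.* K) y + - fr (i ℕ.* K) y ≈ ι (j F.· F.1# F.* τ F.+ F.- (i F.· F.1# F.* τ))
      difference i j = begin
        fr (j ℕ.* K) y + - fr (i ℕ.* K) y               ≈⟨ +-cong (fr-iterate-y τ≉0 j) (-‿cong (fr-iterate-y τ≉0 i)) ⟩
        (y + j · ι τ) + - (y + i · ι τ)                 ≈⟨ solve 3 (λ y a b → (y :+ a) :- (y :+ b) := a :- b) refl y _ _ ⟩
        j · ι τ + - (i · ι τ)                           ≈⟨ +-cong (multiple j) (-‿cong (multiple i)) ⟩
        ι (j F.· F.1# F.* τ) + - ι (i F.· F.1# F.* τ)   ≈⟨ ι-- _ _ ⟨
        ι (j F.· F.1# F.* τ F.+ F.- (i F.· F.1# F.* τ)) ∎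
        where
        multiple : ∀ j → j · ι τ ≈ ι (j F.· F.1# F.* τ)
        multiple j = trans (·-1 j (ι τ)) (trans (*-congʳ (sym (ι-· j))) (sym (ι-* _ τ)))
      C≈0 : ∀ i → i < p → C i ≈ 0#
      C≈0 = too-many-roots⇒≈0 p C (λ j → fr (j ℕ.* K) y)
        (λ i j i<j j<p z zd≈0 → ι-nonzerodivisor (multiples-differ τ≉0 i j i<j j<p) z (trans (*-congˡ (sym (difference i j))) zd≈0))
        (λ j _ → conjugate-root j)
      column≋0 : ∀ i → i < p → column i ≋ []
      column≋0 i i<p = indep (column i) (DegLt-applyUpTo _ M)
        (trans (eval-DegLt (column i) M (DegLt-applyUpTo _ M) v)
        (trans (evalN-cong M (λ j j<M → ι-cong (coeff-applyUpTo (λ j → coeff (digit j) i) M j j<M)) v) (C≈0 i i<p)))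
      digit≋0 : ∀ j → j < M → digit j ≋ []
      digit≋0 j j<M = coeffs coeff≈0
        where
        coeff≈0 : ∀ i → coeff (digit j) i F.≈ F.0#
        coeff≈0 i with i ℕ.<? p
        ... | no  i≮p = digit< j i (ℕ.≮⇒≥ i≮p)
        ... | yes i<p = F.trans (F.sym (coeff-applyUpTo (λ j → coeff (digit j) i) M j j<M)) (coeff≈ (column≋0 i i<p) j)

    -- Multiplying a relation for `w = 1/y` by `y ^ (n - 1)` reverses its coefficients into a
    -- relation for `y` under the same degree bound.
    noRelation-inverse : ∀ {n w y} → w * y ≈ 1# → NoRelation n y → NoRelation n w
    noRelation-inverse {n} {w} {y} wy≈1 indep f f< fw≈0 = coeffs coeff≈0
      where
      k : ℕ → Carrier
      k i = ι (coeff f i)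
      rev : ℕ → F.Carrier
      rev i = coeff f (n ∸ suc i)
      yw≈1 : y * w ≈ 1#
      yw≈1 = trans (*-comm y w) wy≈1
      rev-root : eval (applyUpTo rev n) y ≈ 0#
      rev-root = begin
        eval (applyUpTo rev n) y                   ≈⟨ eval-DegLt (applyUpTo rev n) n (DegLt-applyUpTo rev n) y ⟩
        evalN n (λ i → ι (coeff (applyUpTo rev n) i)) y ≈⟨ evalN-cong n (λ i i<n → ι-cong (coeff-applyUpTo rev n i i<n)) y ⟩
        evalN n (λ i → k (n ∸ suc i)) y            ≈⟨ trans (*-congʳ wy≈1) (*-identityˡ _) ⟨
        (w * y) * evalN n (λ i → k (n ∸ suc i)) y  ≈⟨ *-assoc w y _ ⟩
        w * (y * evalN n (λ i → k (n ∸ suc i)) y)  ≈⟨ *-congˡ (evalN-reverse n k w y yw≈1) ⟩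
        w * (y ^ n * evalN n k w)                  ≈⟨ *-congˡ (*-congˡ (trans (sym (eval-DegLt f n f< w)) fw≈0)) ⟩
        w * (y ^ n * 0#)                           ≈⟨ trans (*-congˡ (zeroʳ _)) (zeroʳ w) ⟩
        0#                                         ∎
      rev≋0 : applyUpTo rev n ≋ []
      rev≋0 = indep (applyUpTo rev n) (DegLt-applyUpTo rev n) rev-root
      coeff≈0 : ∀ i → coeff f i F.≈ F.0#
      coeff≈0 i with i ℕ.<? n
      ... | no  i≮n = f< i (ℕ.≮⇒≥ i≮n)
      ... | yes i<n = F.trans (F.reflexive (P.cong (coeff f) (P.sym involutive)))
        (F.trans (F.sym (coeff-applyUpTo rev n (n ∸ suc i) (ℕ.∸-monoʳ-< (s≤s z≤n) i<n))) (coeff≈ rev≋0 (n ∸ suc i)))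
        where
        involutive : n ∸ suc (n ∸ suc i) ≡ i
        involutive = P.trans (P.cong (n ∸_) (P.sym (ℕ.+-∸-assoc 1 i<n))) (ℕ.m∸[m∸n]≡n (ℕ.<⇒≤ i<n))

    noRelation : ∀ {k v} → (∀ i → i < k → ¬ tr (θ i) F.≈ F.0#) → Link k v → NoRelation (p ℕ.^ k) v
    noRelation τ≉0 (base {v} v≈0) f f< fv≈0 = coeffs λ { zero → coeff0≈0 ; (suc i) → f< (suc i) (s≤s z≤n) }
      where
      coeff0≈0 : coeff f 0 F.≈ F.0#
      coeff0≈0 = ι-injective (begin
        ι (coeff f 0)              ≈⟨ +-identityʳ _ ⟨
        ι (coeff f 0) + 0#         ≈⟨ +-congˡ (zeroʳ v) ⟨
        ι (coeff f 0) + v * 0#     ≈⟨ eval-DegLt f 1 f< v ⟨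
        eval f v                   ≈⟨ fv≈0 ⟩
        0#                         ∎)
    noRelation {suc k} τ≉0 (step link y wy≈1 gy≈v) = noRelation-inverse wy≈1
      (noRelation-root (conjugates τ≉0′ link) y gy≈v (τ≉0 k (ℕ.n<1+n k)) (noRelation τ≉0′ link))
      where
      τ≉0′ : ∀ i → i < k → ¬ tr (θ i) F.≈ F.0#
      τ≉0′ i i<k = τ≉0 i (ℕ.m<n⇒m<1+n i<k)

-- The sequences a, c, d; degrees, irreducibility and distinctness of the denominators

module Denominators {c ℓ : Level} (F : Field c ℓ) (p e : ℕ) (p-prime : Prime p)
  (card : FieldTheory.HasCardinality F (p ℕ.^ e)) (ξ : Field.Carrier F)
  (tr-ξ≉0 : ¬ Field._≈_ F (Setup.tr F p e p-prime card ξ) (Field.0# F)) where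
  open Setup F p e p-prime card
  open Chains F p e p-prime card ξ tr-ξ≉0
  open Iterates F p e p-prime card ξ tr-ξ≉0
  open Independence F p e p-prime card ξ tr-ξ≉0
  open FieldTheory F
  open Polynomials F
  private
    module F where
      open Field F public
      open RingTools commutativeRing public
      open FiniteFieldChar F p e p-prime card public
      open Degrees F public
      open Decidable _≟_ public
    module FF = IteratesIn (selfAlgebra F)
    module PA = IteratesIn (polyAlgebra F)

  Φ^ : ℕ → F.Carrier → F.Carrier
  Φ^ zero    a = a
  Φ^ (suc j) a = Φ^ j (Φ a)

  Φ^-suc : ∀ j a → Φ^ (suc j) a ≡ Φ (Φ^ j a)
  Φ^-suc zero    a = P.refl
  Φ^-suc (suc j) a = Φ^-suc j (Φ a)

  -- Unrolled, `σ k a` is minus the product of the squares of the first `k` iterates of `Φ` at `a`,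
  -- times the next iterate. The definition adds a factor at the start of the orbit; the sequence a
  -- grows at its end.
  σ-suc : ∀ k a → σ (suc k) a F.≈ (σ k a F.* Φ^ (suc k) a) F.* Φ^ (suc (suc k)) a
  σ-suc zero    a = F.solve 2 (λ x y → (x F.:* x) F.:* (F.:- y) F.:= ((F.:- x) F.:* x) F.:* y) F.refl (Φ a) (Φ (Φ a))
  σ-suc (suc k) a = F.trans (F.*-congˡ (σ-suc k (Φ a)))
    (F.solve 4 (λ x s y z → x F.:* ((s F.:* y) F.:* z) F.:= ((x F.:* s) F.:* y) F.:* z) F.refl _ _ _ _)

  -- Homogeneous coordinates: `- d / c` is a point of the orbit of 0 under `Φ` and `a / c` the trace
  -- value there, written without division.
  record Orbit (k : ℕ) (acd : F.Carrier × F.Carrier × F.Carrier) : Set ℓ where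
    field
      c≉0 : ¬ proj₁ (proj₂ acd) F.≈ F.0#
      -d≈ : F.- proj₂ (proj₂ acd) F.≈ Φ^ (suc k) F.0# F.* proj₁ (proj₂ acd)
      a≈  : proj₁ acd F.≈ σ k F.0# F.* proj₁ (proj₂ acd)

  orbit : ∀ k → Orbit k (acd p ξ (suc (suc k)))
  orbit zero = record
    { c≉0 = λ ξ≈0 → tr-ξ≉0 (F.trans (F.S-cong 1 e ξ≈0) (F.S-0 1 e))
    ; -d≈ = F.trans (F.-‿involutive F.1#) (F.sym Φ0*ξ≈1)
    ; a≈ = F.trans (F.-‿cong (F.sym Φ0*ξ≈1)) (F.-‿distribˡ-* _ _) }
    where
    Φ0*ξ≈1 : Φ F.0# F.* ξ F.≈ F.1#
    Φ0*ξ≈1 = F.trans (F.*-congˡ (F.sym (F.trans (F.+-congʳ (F.trans (F.+-cong (F.fr-0 1) F.-0#≈0#) (F.+-identityˡ _))) (F.+-identityˡ ξ)))) (Φ*g≈1 F.0#)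
  orbit (suc k) = record
    { c≉0 = λ c′≈0 → F.x≉0∧y≉0⇒xy≉0 (F.x≉0∧y≉0⇒xy≉0 c≉0 c≉0) (g≉0 t) (F.trans (F.sym c′≈) c′≈0)
    ; -d≈ = F.trans (F.-‿involutive _) cc≈
    ; a≈ = begin
        F.- (a₀ F.* d₀)                                ≈⟨ F.-‿distribʳ-* a₀ d₀ ⟩
        a₀ F.* F.- d₀                                  ≈⟨ F.*-cong a≈ -d≈ ⟩
        (σ k F.0# F.* c₀) F.* (t F.* c₀)               ≈⟨ F.solve 3 (λ s c t → (s F.:* c) F.:* (t F.:* c) F.:= (s F.:* t) F.:* (c F.:* c)) F.refl _ c₀ t ⟩
        (σ k F.0# F.* t) F.* (c₀ F.* c₀)               ≈⟨ F.*-congˡ cc≈ ⟩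
        (σ k F.0# F.* t) F.* (t′ F.* c′)               ≈⟨ F.*-assoc _ _ _ ⟨
        ((σ k F.0# F.* t) F.* t′) F.* c′               ≈⟨ F.*-congʳ (σ-suc k F.0#) ⟨
        σ (suc k) F.0# F.* c′                          ∎ }
    where
    open import Relation.Binary.Reasoning.Setoid F.setoid
    open Orbit (orbit k)
    a₀ = aₙ p ξ (suc (suc k))
    c₀ = cₙ p ξ (suc (suc k))
    d₀ = dₙ p ξ (suc (suc k))
    c′ = cₙ p ξ (suc (suc (suc k)))
    t = Φ^ (suc k) F.0#
    t′ = Φ^ (suc (suc k)) F.0#
    x = c₀ F.⁻¹ F.* d₀
    x≈-t : x F.≈ F.- t
    x≈-t = begin
      c₀ F.⁻¹ F.* d₀              ≈⟨ F.solve 2 (λ i d → i F.:* d F.:= F.:- (i F.:* (F.:- d))) F.refl _ d₀ ⟩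
      F.- (c₀ F.⁻¹ F.* F.- d₀)    ≈⟨ F.-‿cong (F.*-congˡ -d≈) ⟩
      F.- (c₀ F.⁻¹ F.* (t F.* c₀)) ≈⟨ F.-‿cong (F.solve 3 (λ i t c → i F.:* (t F.:* c) F.:= t F.:* (c F.:* i)) F.refl _ t c₀) ⟩
      F.- (t F.* (c₀ F.* c₀ F.⁻¹)) ≈⟨ F.-‿cong (F.trans (F.*-congˡ (F.⁻¹-inverse c₀ c≉0)) (F.*-identityʳ t)) ⟩
      F.- t                       ∎
    -- The bracket in the recursion for c is `g (- d / c)`, because the p-th power commutes with
    -- negation in characteristic `p`, including 2.
    c′≈ : c′ F.≈ (c₀ F.* c₀) F.* g t
    c′≈ = F.*-congˡ (begin
      (ξ F.+ F.- pow x p) F.+ x                ≈⟨ F.+-cong (F.+-congˡ (F.-‿cong (F.trans (F.pow≈^ x p) (F.trans (F.^-congˡ p x≈-t) (F.fr-neg 1 t))))) x≈-t ⟩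
      (ξ F.+ F.- F.- (t F.^ p)) F.+ F.- t      ≈⟨ F.solve 3 (λ x tp t → (x F.:- (F.:- tp)) F.:- t F.:= (tp F.:- t) F.:+ x) F.refl ξ (t F.^ p) t ⟩
      g t                                      ∎)
    cc≈ : c₀ F.* c₀ F.≈ t′ F.* c′
    cc≈ = begin
      c₀ F.* c₀                      ≈⟨ F.*-identityʳ _ ⟨
      (c₀ F.* c₀) F.* F.1#           ≈⟨ F.*-congˡ (Φ*g≈1 t) ⟨
      (c₀ F.* c₀) F.* (Φ t F.* g t)  ≈⟨ F.solve 3 (λ c f g → c F.:* (f F.:* g) F.:= f F.:* (c F.:* g)) F.refl _ (Φ t) (g t) ⟩
      Φ t F.* ((c₀ F.* c₀) F.* g t)  ≈⟨ F.*-cong (F.reflexive (P.sym (Φ^-suc (suc k) F.0#))) (F.sym c′≈) ⟩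
      t′ F.* c′                      ∎

  aₙ/cₙ≈-θ : ∀ n → aₙ p ξ (suc n) F.* cₙ p ξ (suc n) F.⁻¹ F.≈ F.- θ n
  aₙ/cₙ≈-θ zero = F.trans (F.*-congˡ (F.trans (F.sym (F.*-identityˡ _)) (F.⁻¹-inverse F.1# F.1≉0)))
    (F.trans (F.*-identityʳ ξ) (F.sym (F.-‿involutive ξ)))
  aₙ/cₙ≈-θ (suc k) = F.trans (F.*-congʳ a≈) (F.trans (F.*-assoc _ _ _)
    (F.trans (F.*-congˡ (F.⁻¹-inverse _ c≉0)) (F.trans (F.*-identityʳ _) (F.sym (F.-‿involutive _)))))
    where open Orbit (orbit k)

  Tr[aₙ/cₙ]≈-tr-θ : ∀ n → Tr p e (aₙ p ξ (suc n) F.* cₙ p ξ (suc n) F.⁻¹) F.≈ F.- tr (θ n)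
  Tr[aₙ/cₙ]≈-tr-θ n = F.trans (F.Tr≈S e _) (F.trans (F.S-cong 1 e (aₙ/cₙ≈-θ n)) (F.S-neg 1 e (θ n)))

  Nᵖ Dᵖ : ℕ → Poly
  Nᵖ n = proj₁ (iterΦ gᴾ n)
  Dᵖ n = proj₂ (iterΦ gᴾ n)

  Nᵖ≋num : ∀ n → Nᵖ n ≋ PA.num n Xₚ
  Nᵖ≋num n = ≋-trans (≋-sym (eval-polyAlgebra-X F (Nᵖ n))) (proj₁ (PA.eval-iterΦ n Xₚ))

  Dᵖ≋denom : ∀ n → Dᵖ n ≋ PA.denom n Xₚ
  Dᵖ≋denom n = ≋-trans (≋-sym (eval-polyAlgebra-X F (Dᵖ n))) (proj₂ (PA.eval-iterΦ n Xₚ))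

  -- A formal leading coefficient that may be zero: at the formal degree `p ^ n`, that of `denom 0`
  -- vanishes, and so does that of `num 1`.
  record Top (f : Poly) (d : ℕ) (t : F.Carrier) : Set ℓ where
    constructor top
    field
      below : F.DegLt f (suc d)
      coeff≈t : coeff f d F.≈ t

  Top-* : ∀ {f g d e s t} → Top f d s → Top g e t → Top (f *ₚ g) (d ℕ.+ e) (s F.* t)
  Top-* {f} {g} {d} {e} (top f< f≈s) (top g< g≈t) with F.*ₚ-top f g d e f< g<
  ... | fg< , fg≈ = top fg< (F.trans fg≈ (F.*-cong f≈s g≈t))

  Top-+ : ∀ {f g d s t} → Top f d s → Top g d t → Top (f +ₚ g) d (s F.+ t)
  Top-+ {f} {g} (top f< f≈s) (top g< g≈t) = top (F.DegLt-+ f g f< g<) (F.trans (coeff-+ f g _) (F.+-cong f≈s g≈t))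

  Top-neg : ∀ {f d t} → Top f d t → Top (-ₚ f) d (F.- t)
  Top-neg {f} (top f< f≈t) = top (F.DegLt-scale (F.- F.1#) f f<) (F.trans (coeff-neg f _) (F.-‿cong f≈t))

  Top-constP : ∀ a → Top (constP a) 0 a
  Top-constP a = top (F.DegLt-constP a) F.refl

  Top-^ : ∀ {f d t} → Top f d t → ∀ n → Top (f PA.^ n) (n ℕ.* d) (t F.^ n)
  Top-^ top-f zero    = Top-constP F.1#
  Top-^ top-f (suc n) = Top-* top-f (Top-^ top-f n)

  -- Leading coefficients obey the recursion of the values, started from `1 / 0`: they follow the
  -- orbit of the point at infinity.
  num-top denom-top : ℕ → F.Carrier
  num-top   zero    = F.1#
  num-top   (suc n) = denom-top n F.^ p
  denom-top zero    = F.0#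
  denom-top (suc n) = FF.den (num-top n) (denom-top n)

  tops : ∀ n → Top (PA.num n Xₚ) (p ℕ.^ n) (num-top n) × Top (PA.denom n Xₚ) (p ℕ.^ n) (denom-top n)
  tops zero = top (F.DegLt-length Xₚ) F.refl , top (F.DegLt-≤ (constP F.1#) (s≤s z≤n) (F.DegLt-constP F.1#)) F.refl
  tops (suc n) with tops n
  ... | topN , topD = Top-^ topD p ,
    Top-+ (Top-+ (Top-^ topN p) (Top-neg (P.subst (λ k → Top (PA.num n Xₚ *ₚ (PA.denom n Xₚ PA.^ (p ∸ 1))) k (num-top n F.* denom-top n F.^ (p ∸ 1)))
        (P.cong (ℕ._* p ℕ.^ n) suc[p∸1]≡p) (Top-* topN (Top-^ topD (p ∸ 1))))))
      (Top-* (Top-constP ξ) (Top-^ topD p))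

  -- The first step sends infinity to 0. From there the orbit stays in F, where `g` has no zero.
  denom-top≉0 : ∀ n → ¬ denom-top (suc n) F.≈ F.0#
  denom-top≉0 zero den≈0 = F.1≉0 (F.trans (F.sym den≈1) den≈0)
    where
    den≈1 : FF.den F.1# F.0# F.≈ F.1#
    den≈1 = F.trans (F.+-cong (F.+-cong (F.1^ p) (F.-‿cong (F.*-congˡ (F.0^ (p ∸ 1) 0<p∸1)))) (F.*-congˡ (F.fr-0 1)))
      (F.solve 1 (λ x → (F.con (+ 1) F.:- F.con (+ 1) F.:* F.con (+ 0)) F.:+ x F.:* F.con (+ 0) F.:= F.con (+ 1)) F.refl ξ)
  denom-top≉0 (suc n) den≈0 = g≉0 _ (F.trans (FF.g-fraction (num-top (suc n)) (denom-top (suc n)) (denom-top (suc n) F.⁻¹)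
    (FF.ι-inverse (denom-top≉0 n))) (F.trans (F.*-congˡ den≈0) (F.zeroʳ _)))

  Dᵖ-degree : ∀ n → F.Degree (Dᵖ (suc n)) (p ℕ.^ suc n)
  Dᵖ-degree n = F.Degree-≋ (≋-sym (Dᵖ≋denom (suc n)))
    (F.degree (Top.below topD) (λ lead≈0 → denom-top≉0 n (F.trans (F.sym (Top.coeff≈t topD)) lead≈0)))
    where topD = proj₂ (tops (suc n))

  Comaximal-sym : ∀ {f g} → F.Comaximal f g → F.Comaximal g f
  Comaximal-sym = PA.Coprime-sym

  Nᵖ-Dᵖ-comaximal : ∀ n → F.Comaximal (Nᵖ n) (Dᵖ n)
  Nᵖ-Dᵖ-comaximal n with PA.num-denom-coprime n Xₚ
  ... | u , v , uN+vD≈1 = u , v , ≋-trans (+ₚ-cong (*ₚ-congˡ u (Nᵖ≋num n)) (*ₚ-congˡ v (Dᵖ≋denom n))) uN+vD≈1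

  Dᵖ-denominator : ∀ n → IsDenominator gᴾ (suc n) (Dᵖ (suc n))
  Dᵖ-denominator n = (λ D≈0 → F.Degree⇒¬zero (Dᵖ-degree n) (coeffs D≈0)) ,
    Nᵖ (suc n) , F.Comaximal⇒CoprimeP (Nᵖ-Dᵖ-comaximal (suc n)) , coeff≈ (*ₚ-comm (Nᵖ (suc n)) (Dᵖ (suc n)))

  -- Cross multiplication gives `N * Dᵖ n = d * Nᵖ n`. Coprimality of `Nᵖ n` and `Dᵖ n` yields this
  -- divisibility, coprimality of `N` and `d` the opposite one, so all denominators agree up to a
  -- unit.
  Dᵖ∣denominator : ∀ n d → IsDenominator gᴾ n d → Dᵖ n ∣ₚ d
  Dᵖ∣denominator n d (d≉0 , N , coprime , ND≈dN) =
    F.Comaximal-∣* (Comaximal-sym (Nᵖ-Dᵖ-comaximal n)) d (N , coeff≈ (≋-sym (coeffs {N *ₚ Dᵖ n} {d *ₚ Nᵖ n} ND≈dN)))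

  denominator∣Dᵖ : ∀ n d → IsDenominator gᴾ n d → d ∣ₚ Dᵖ n
  denominator∣Dᵖ n d (d≉0 , N , coprime , ND≈dN) =
    F.Comaximal-∣* (Comaximal-sym (F.CoprimeP⇒Comaximal coprime (λ d≋0 → d≉0 (coeff≈ d≋0)))) (Dᵖ n)
      (Nᵖ n , coeff≈ (≋-trans (*ₚ-comm (Dᵖ n) N) (≋-trans (coeffs {N *ₚ Dᵖ n} {d *ₚ Nᵖ n} ND≈dN) (*ₚ-comm d (Nᵖ n)))))

  module Mod (h : Poly) where
    algebra : Algebra F c (c ⊔ ℓ)
    algebra = _/ₐ_ F (polyAlgebra F) h
    open Quotient polyRing h public using (≈⇒≈/; h≈/0; mod)
    module Q = IteratesIn algebra

    eval-X≈ : ∀ f → Q.eval f Xₚ Q.≈ f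
    eval-X≈ f = Q.trans (Q.reflexive (eval≡ f)) (≈⇒≈/ (eval-polyAlgebra-X F f))
      where
      eval≡ : ∀ f → Q.eval f Xₚ ≡ PA.eval f Xₚ
      eval≡ []      = P.refl
      eval≡ (a ∷ f) = P.cong (λ z → constP a +ₚ (Xₚ *ₚ z)) (eval≡ f)

    ∣⇒≈0 : ∀ {f} → h ∣ₚ f → f Q.≈ Q.0#
    ∣⇒≈0 {f} h∣f = mod (proj₁ h∣f) (≋-trans (+ₚ-identityʳ f) (F.∣ₚ⇒≋ f h∣f))

    ≈0⇒∣ : ∀ {f} → f Q.≈ Q.0# → h ∣ₚ f
    ≈0⇒∣ {f} (mod k f≈kh) = k , coeff≈ (≋-trans (≋-sym (+ₚ-identityʳ f)) f≈kh)

    nontrivial : ¬ IsConstP h → ¬ Q.1# Q.≈ Q.0#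
    nontrivial h-nonconst 1≈0 = h-nonconst (F.∣1⇒const (≈0⇒∣ 1≈0))

    denom≈0 : ∀ n → h ∣ₚ Dᵖ n → Q.denom n Xₚ Q.≈ Q.0#
    denom≈0 n h∣D = Q.trans (Q.sym (proj₂ (Q.eval-iterΦ n Xₚ))) (Q.trans (eval-X≈ (Dᵖ n)) (∣⇒≈0 h∣D))

  Degree⇒¬const : ∀ {f d} → F.Degree f d → 0 < d → ¬ IsConstP f
  Degree⇒¬const {d = suc d} (F.degree _ lead≉0) _ f-const = lead≉0 (f-const d)

  Degree-∣ : ∀ {f g d e} → F.Degree f d → F.Degree g e → f ∣ₚ g → d ≤ e
  Degree-∣ {f} {g} {d} {e} f-d g-e f∣g@(k , _) with F.zero-or-degree k
  ... | inj₁ k≋0 = ⊥-elim (F.Degree⇒¬zero g-e (≋-trans (F.∣ₚ⇒≋ g f∣g) (*ₚ-cong k≋0 (≋-refl {f}))))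
  ... | inj₂ (m , k-m) = P.subst (d ≤_) (F.Degree-unique (F.Degree-≋ (≋-sym (F.∣ₚ⇒≋ g f∣g)) (F.Degree-* k-m f-d)) g-e) (ℕ.m≤n+m d m)

  p^>0 : ∀ n → 0 < p ℕ.^ n
  p^>0 n = ℕ.>-nonZero⁻¹ _ {{ℕ.m^n≢0 p n {{ℕ.>-nonZero (ℕ.<⇒≤ 1<p)}}}}

  module _ (τ≉0 : ∀ n → ¬ tr (θ n) F.≈ F.0#) where

    -- In F[X]/f the class of X is a root of the denominator, and `f` itself is a nonzero relation
    -- for it, too short if `d` were below the bound.
    factor-degree : ∀ n {f d} → F.Degree f d → 0 < d → f ∣ₚ Dᵖ (suc n) → p ℕ.^ suc n ≤ d
    factor-degree n {f} {d} f-d 0<d f∣D = ℕ.≮⇒≥ (λ d<p^n → F.Degree⇒¬zero f-d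
        (noRelation-root algebra 1≉0 (Q.conjugates (λ i _ → τ≉0 i) link) Xₚ g≈v (τ≉0 n)
          (noRelation algebra 1≉0 (λ i _ → τ≉0 i) link)
          f (F.DegLt-≤ f d<p^n (F.Degree.below f-d)) (Q.trans (eval-X≈ f) h≈/0)))
      where
      open Mod f
      1≉0 : ¬ Q.1# Q.≈ Q.0#
      1≉0 = nontrivial (Degree⇒¬const f-d 0<d)
      chain = Q.denom-root⇒chain Xₚ n (λ i _ → τ≉0 i) (denom≈0 (suc n) f∣D)
      link = proj₁ (proj₂ chain)
      g≈v = proj₂ (proj₂ chain)

    denominator-irreducible : ∀ n d → IsDenominator gᴾ (suc n) d → Irreducible d
    denominator-irreducible n d d-den = d-nonconst , factors
      where
      d∣D = denominator∣Dᵖ (suc n) d d-den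
      degree-d = F.≉[]⇒degree {d} (λ d≋0 → proj₁ d-den (coeff≈ d≋0))
      d-nonconst : ¬ IsConstP d
      d-nonconst = Degree⇒¬const (proj₂ degree-d)
        (ℕ.≤-trans (p^>0 (suc n)) (Degree-∣ (Dᵖ-degree n) (proj₂ degree-d) (Dᵖ∣denominator (suc n) d d-den)))
      factors : ∀ f h → d ≈ₚ (f *ₚ h) → IsConstP f ⊎ IsConstP h
      factors f h d≈fh with F.zero-or-degree f | F.zero-or-degree h
      ... | inj₁ f≋0 | _ = inj₁ (λ i → coeff≈ f≋0 (suc i))
      ... | inj₂ _ | inj₁ h≋0 = inj₂ (λ i → coeff≈ h≋0 (suc i))
      ... | inj₂ (zero , f-0) | inj₂ _ = inj₁ (F.Degree0⇒const f-0)
      ... | inj₂ _ | inj₂ (zero , h-0) = inj₂ (F.Degree0⇒const h-0)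
      -- The first nonconstant factor already exhausts the degree of `Dᵖ`, leaving no room for the
      -- second.
      ... | inj₂ (suc α , f-α) | inj₂ (suc β , h-β) = ⊥-elim (ℕ.<⇒≱ (ℕ.m<m+n (suc α) (s≤s z≤n))
          (ℕ.≤-trans (Degree-∣ (F.Degree-* f-α h-β) (Dᵖ-degree n) fh∣D) (factor-degree n f-α (s≤s z≤n) f∣D)))
        where
        fh∣d : (f *ₚ h) ∣ₚ d
        fh∣d = constP F.1# , coeff≈ (≋-trans (coeffs {d} {f *ₚ h} d≈fh) (≋-sym (*ₚ-identityˡ (f *ₚ h))))
        fh∣D : (f *ₚ h) ∣ₚ Dᵖ (suc n)
        fh∣D = F.∣ₚ-trans {f *ₚ h} {d} {Dᵖ (suc n)} fh∣d d∣D
        f∣D : f ∣ₚ Dᵖ (suc n)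
        f∣D = F.∣ₚ-trans {f} {f *ₚ h} {Dᵖ (suc n)} (h , coeff≈ (*ₚ-comm f h)) fh∣D

  Dᵖ-∣⇒≤ : ∀ m n → Dᵖ (suc m) ∣ₚ Dᵖ (suc n) → suc m ≤ suc n
  Dᵖ-∣⇒≤ m n D∣D = ℕ.≮⇒≥ (λ n<m → ℕ.<⇒≱ (ℕ.^-monoʳ-< p 1<p n<m) (Degree-∣ (Dᵖ-degree m) (Dᵖ-degree n) D∣D))

  -- Associated denominators make the corresponding `Dᵖ` divide each other, and the degree
  -- `p ^ suc n` determines `n`.
  denominators-distinct : ∀ n m d d′ → IsDenominator gᴾ (suc n) d → IsDenominator gᴾ (suc m) d′ → Associated d d′ → suc n ≡ suc m
  denominators-distinct n m d d′ d-den d′-den (u , u≉0 , d≈ud′) = ℕ.≤-antisym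
    (Dᵖ-∣⇒≤ n m (∣-chain (Dᵖ (suc n)) d d′ (Dᵖ (suc m)) (Dᵖ∣denominator (suc n) d d-den) d∣d′ (denominator∣Dᵖ (suc m) d′ d′-den)))
    (Dᵖ-∣⇒≤ m n (∣-chain (Dᵖ (suc m)) d′ d (Dᵖ (suc n)) (Dᵖ∣denominator (suc m) d′ d′-den) d′∣d (denominator∣Dᵖ (suc n) d d-den)))
    where
    ∣-chain : ∀ f g h k → f ∣ₚ g → g ∣ₚ h → h ∣ₚ k → f ∣ₚ k
    ∣-chain f g h k f∣g g∣h h∣k = F.∣ₚ-trans {f} {g} {k} f∣g (F.∣ₚ-trans {g} {h} {k} g∣h h∣k)
    d≋ud′ : d ≋ scale u d′
    d≋ud′ = coeffs d≈ud′
    d′∣d : d′ ∣ₚ d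
    d′∣d = constP u , coeff≈ (≋-trans d≋ud′ (≋-sym (constP-*ₚ u d′)))
    d∣d′ : d ∣ₚ d′
    d∣d′ = constP (u F.⁻¹) , coeff≈ (≋-sym (≋-trans (constP-*ₚ (u F.⁻¹) d) (≋-trans (scale-cong F.refl d≋ud′)
      (≋-trans (scale-scale (u F.⁻¹) u d′) (≋-trans (scale-cong (F.trans (F.*-comm _ u) (F.⁻¹-inverse u u≉0)) ≋-refl) (scale-1 d′))))))

  traces-nonzero⇒stable : (∀ n → ¬ tr (θ n) F.≈ F.0#) → InverselyStable gᴾ
  traces-nonzero⇒stable τ≉0 =
    (λ { (suc n) _ → denominator-irreducible τ≉0 n }) ,
    (λ { (suc n) (suc m) _ _ n≢m d d′ d-den d′-den assoc → n≢m (denominators-distinct n m d d′ d-den d′-den assoc) })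

-- Necessity of the trace condition

module Converse {c ℓ : Level} (F : Field c ℓ) (p e : ℕ) (p-prime : Prime p)
  (card : FieldTheory.HasCardinality F (p ℕ.^ e)) (ξ : Field.Carrier F)
  (tr-ξ≉0 : ¬ Field._≈_ F (Setup.tr F p e p-prime card ξ) (Field.0# F)) where
  open Setup F p e p-prime card
  open Chains F p e p-prime card ξ tr-ξ≉0
  open Iterates F p e p-prime card ξ tr-ξ≉0
  open Independence F p e p-prime card ξ tr-ξ≉0
  open Denominators F p e p-prime card ξ tr-ξ≉0
  open FieldTheory F
  open Polynomials F
  private
    module F where
      open Field F public
      open RingTools commutativeRing public
      open FiniteFieldChar F p e p-prime card public
      open Degrees F public
      open Decidable _≟_ public
    module PA = IteratesIn (polyAlgebra F)

  module Translation {a b : Level} (A : Algebra F a b) where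
    open IteratesIn A
    open import Relation.Binary.Reasoning.Setoid setoid

    [y+1]^p-[y+1] : ∀ y → (y + 1#) ^ p + - (y + 1#) ≈ y ^ p + - y
    [y+1]^p-[y+1] y = trans (+-congʳ (trans (fr-+ 1 y 1#) (+-congˡ (fr-1 1))))
      (solve 2 (λ z y → (z :+ con (+ 1)) :- (y :+ con (+ 1)) := z :- y) refl _ y)

    gᴬ-translate : ∀ y → gᴬ (y + 1#) ≈ gᴬ y
    gᴬ-translate y = +-congʳ ([y+1]^p-[y+1] y)

    -- From the first iterate on, `y` enters only through `y ^ p - y`, which does not change under
    -- translation by 1.
    denom-translate : ∀ n y → (num (suc n) (y + 1#) ≈ num (suc n) y) × (denom (suc n) (y + 1#) ≈ denom (suc n) y)
    denom-translate zero    y = refl , +-congʳ (begin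
      (y + 1#) ^ p + - ((y + 1#) * 1# ^ (p ∸ 1)) ≈⟨ +-congˡ (-‿cong (trans (*-congˡ (1^ (p ∸ 1))) (*-identityʳ _))) ⟩
      (y + 1#) ^ p + - (y + 1#)                  ≈⟨ [y+1]^p-[y+1] y ⟩
      y ^ p + - y                                ≈⟨ +-congˡ (-‿cong (trans (*-congˡ (1^ (p ∸ 1))) (*-identityʳ _))) ⟨
      y ^ p + - (y * 1# ^ (p ∸ 1))               ∎)
    denom-translate (suc n) y with denom-translate n y
    ... | N≈ , D≈ = ^-congˡ p D≈ , den-cong N≈ D≈

    -- Writing `gᴬ y` in place of `v` makes this a polynomial expression in `y` alone, which can be
    -- evaluated at both `y` and `y + 1`.
    trace : F.Carrier → ℕ → Carrier → Carrier
    trace b K y = S 1 K ((ι b * gᴬ y) * y)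

    eval-fr : ∀ k f y → eval (PA.fr k f) y ≈ fr k (eval f y)
    eval-fr zero    f y = refl
    eval-fr (suc k) f y = trans (eval-^ (PA.fr k f) p y) (^-congˡ p (eval-fr k f y))

    eval-S : ∀ k n f y → eval (PA.S k n f) y ≈ S k n (eval f y)
    eval-S k zero    f y = refl
    eval-S k (suc n) f y = trans (eval-+ f (PA.S k n (PA.fr k f)) y) (+-congˡ (trans (eval-S k n (PA.fr k f) y) (S-cong k n (eval-fr k f y))))

    eval-trace : ∀ b K y → eval (PA.S 1 K ((constP b *ₚ PA.gᴬ Xₚ) *ₚ Xₚ)) y ≈ trace b K y
    eval-trace b K y = trans (eval-S 1 K _ y) (S-cong 1 K
      (trans (eval-* (constP b *ₚ PA.gᴬ Xₚ) Xₚ y) (*-cong (trans (eval-* (constP b) (PA.gᴬ Xₚ) y) (*-cong (eval-constP b y) eval-gX)) (eval-X y))))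
      where
      eval-gX : eval (PA.gᴬ Xₚ) y ≈ gᴬ y
      eval-gX = trans (eval-+ ((Xₚ PA.^ p) +ₚ (-ₚ Xₚ)) (constP ξ) y) (+-cong
        (trans (eval-+ (Xₚ PA.^ p) (-ₚ Xₚ) y) (+-cong (trans (eval-^ Xₚ p y) (^-congˡ p (eval-X y)))
          (trans (eval-neg Xₚ y) (-‿cong (eval-X y)))))
        (eval-constP ξ y))

    module _ {k v} (conj : Conjugates (suc k) v) (y : Carrier) (gy≈v : gᴬ y ≈ v) (τ≈0 : tr (θ (suc k)) F.≈ F.0#) where
      open Conjugates conj
      open Root conj y gy≈v
      private
        n = p ℕ.^ suc k
        K = n ℕ.* e

      fr-y≈y : fr K y ≈ y
      fr-y≈y = trans fr-y (trans (+-congˡ (trans (ι-cong τ≈0) ι-0)) (+-identityʳ y))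

      -- The difference telescopes to `fr K x - x` for the summand `x = b v y`, and `fr K` fixes all
      -- three factors: `y` precisely because its translation `τ` vanishes.
      trace^p≈trace : ∀ b → trace b K y ^ p ≈ trace b K y
      trace^p≈trace b = x-y≈0⇒x≈y (begin
        S 1 K x ^ p + - S 1 K x          ≈⟨ +-cong (S-fr 1 1 K x) (S-neg 1 K x) ⟨
        S 1 K (x ^ p) + S 1 K (- x)      ≈⟨ S-+ 1 K _ _ ⟨
        S 1 K (x ^ p + - x)              ≈⟨ S-telescope 1 K x ⟩
        fr (K ℕ.* 1) x + - x             ≈⟨ x≈y⇒x-y≈0 (trans (reflexive (P.cong (λ j → fr j x) (ℕ.*-identityʳ K))) fr-x) ⟩
        0#                               ∎)
        where
        x = (ι b * gᴬ y) * y
        fr-x : fr K x ≈ x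
        fr-x = trans (fr-* K _ y) (*-cong (trans (fr-* K _ _) (*-cong (fr-*e-ι n b)
          (trans (fr-cong K gy≈v) (trans fixed (sym gy≈v))))) fr-y≈y)

      -- The constant `ξ` has trace zero at every positive level, so `v` and `v - ξ` have the same
      -- trace.
      S-v : S e n v ≈ ι (θ (suc k))
      S-v = begin
        S e n v                                   ≈⟨ S-cong e n (solve 2 (λ v x → v := (v :- x) :+ x) refl v (ι ξ)) ⟩
        S e n ((v + - ι ξ) + ι ξ)                 ≈⟨ S-+ e n _ _ ⟩
        S e n (v + - ι ξ) + S e n (ι ξ)           ≈⟨ +-cong S-[v-ξ] (S-ι≈0 k ξ) ⟩
        ι (θ (suc k)) + 0#                        ≈⟨ +-identityʳ _ ⟩
        ι (θ (suc k))                             ∎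

      -- Since `g` is invariant, the shift adds only the sum over `b v`; transitivity turns this
      -- into the absolute trace of `b * θ (suc k)`.
      trace-translate : ∀ b → b F.* θ (suc k) F.≈ ξ → trace b K (y + 1#) ≈ trace b K y + ι (tr ξ)
      trace-translate b bθ≈ξ = begin
        S 1 K ((ι b * gᴬ (y + 1#)) * (y + 1#))                  ≈⟨ S-cong 1 K (trans (*-congʳ (*-congˡ (gᴬ-translate y)))
                                                                     (trans (distribˡ _ y 1#) (+-congˡ (trans (*-identityʳ _) (*-congˡ gy≈v))))) ⟩
        S 1 K ((ι b * gᴬ y) * y + ι b * v)                      ≈⟨ S-+ 1 K _ _ ⟩
        trace b K y + S 1 K (ι b * v)                           ≈⟨ +-congˡ (S-blocks 1 e n _) ⟩
        trace b K y + S 1 e (S (e ℕ.* 1) n (ι b * v))           ≡⟨ P.cong (λ j → trace b K y + S 1 e (S j n (ι b * v))) (ℕ.*-identityʳ e) ⟩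
        trace b K y + S 1 e (S e n (ι b * v))                   ≈⟨ +-congˡ (S-cong 1 e (trans (S-scale e n (ι b) v (fr-e-ι b)) (*-congˡ S-v))) ⟩
        trace b K y + S 1 e (ι b * ι (θ (suc k)))               ≈⟨ +-congˡ (S-cong 1 e (trans (sym (ι-* b _)) (ι-cong bθ≈ξ))) ⟩
        trace b K y + S 1 e (ι ξ)                               ≈⟨ +-congˡ (ι-S 1 e ξ) ⟨
        trace b K y + ι (tr ξ)                                  ∎

  X^p-X : Poly
  X^p-X = gᴾ +ₚ constP (F.- ξ)

  X^p-X< : F.DegLt X^p-X (suc p)
  X^p-X< = F.DegLt-+ gᴾ (constP (F.- ξ)) (F.Degree.below gᴾ-degree) (F.DegLt-≤ (constP (F.- ξ)) (s≤s z≤n) (F.DegLt-constP (F.- ξ)))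

  X^p-X-lead≉0 : ¬ coeff X^p-X p F.≈ F.0#
  X^p-X-lead≉0 lead≈0 = F.Degree.lead≉0 gᴾ-degree (F.trans (F.sym (F.trans (coeff-+ gᴾ (constP (F.- ξ)) p)
    (F.trans (F.+-congˡ (F.DegLt-constP (F.- ξ) p (ℕ.<⇒≤ 1<p))) (F.+-identityʳ _)))) lead≈0)

  module _ (h : Poly) (h-irred : Irreducible h) where
    open Mod h
    open Q

    nonzero⇒nonZeroDivisor : ∀ {x} → ¬ x ≈ 0# → NonZeroDivisor x
    nonzero⇒nonZeroDivisor {x} x≉0 z zx≈0 = ∣⇒≈0 (F.Irreducible-∣* h-irred {x} (λ h∣x → x≉0 (∣⇒≈0 h∣x)) z (≈0⇒∣ zx≈0))

    1≉0 : ¬ 1# ≈ 0#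
    1≉0 = nontrivial (proj₁ h-irred)

    -- Otherwise `X^p - X` would have the `p + 1` roots `x` and `i · 1`, with cancellable
    -- differences, although its degree is `p`. The negative form calls for no decision of equality
    -- modulo `h`.
    x^p≈x⇒prime-field : ∀ x → x ^ p ≈ x → ¬ (∀ i → i < p → ¬ x ≈ i · 1#)
    x^p≈x⇒prime-field x x^p≈x x≉i = X^p-X-lead≉0 (ι-injective algebra 1≉0
      (too-many-roots⇒≈0 (suc p) (λ i → ι (coeff X^p-X i)) r nzd root p (ℕ.n<1+n p)))
      where
      r : ℕ → Carrier
      r zero    = x
      r (suc i) = i · 1#
      nzd : ∀ i j → i < j → j < suc p → NonZeroDivisor (r j + - r i)
      nzd zero    (suc j) _ (s≤s j<p) = nonzero⇒nonZeroDivisor (λ e → x≉i j j<p (sym (x-y≈0⇒x≈y e)))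
      nzd (suc i) (suc j) (s≤s i<j) (s≤s j<p) = nonzero⇒nonZeroDivisor (λ j-i≈0 →
        multiples-differ F.1≉0 i j i<j j<p (ι-injective algebra 1≉0
          (trans (ι-- _ _) (trans (+-cong (multiple j) (-‿cong (multiple i))) j-i≈0))))
        where
        multiple : ∀ j → ι (j F.· F.1# F.* F.1#) ≈ j · 1#
        multiple j = trans (ι-cong (F.*-identityʳ _)) (ι-· j)
      r^p≈r : ∀ i → r i ^ p ≈ r i
      r^p≈r zero    = x^p≈x
      r^p≈r (suc i) = fr-·1 1 i
      root : ∀ i → i < suc p → evalN (suc p) (λ i → ι (coeff X^p-X i)) (r i) ≈ 0#
      root i _ = trans (sym (eval-DegLt X^p-X (suc p) X^p-X< (r i))) (trans (eval-+ gᴾ (constP (F.- ξ)) (r i))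
        (trans (+-cong (eval-gᴾ (r i)) (trans (eval-constP (F.- ξ) (r i)) (ι-neg ξ)))
        (trans (solve 3 (λ a b t → ((a :- b) :+ t) :- t := a :- b) refl (r i ^ p) (r i) (ι ξ)) (x≈y⇒x-y≈0 (r^p≈r i)))))

  irreducible⇒trace-nonzero : ∀ k → (∀ i → i < suc k → ¬ tr (θ i) F.≈ F.0#) →
    Irreducible (Dᵖ (suc (suc k))) → ¬ tr (θ (suc k)) F.≈ F.0#
  irreducible⇒trace-nonzero k τ≉0 D-irred τ≈0 =
    x^p≈x⇒prime-field h D-irred T (trans (^-congˡ p T≈) (trans (trace^p≈trace conj Xₚ g≈v τ≈0 b) (sym T≈))) T≉i
    where
    h = Dᵖ (suc (suc k))
    open Mod h
    open Q
    open Translation algebra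
    chain = denom-root⇒chain Xₚ (suc k) τ≉0 (denom≈0 (suc (suc k)) (constP F.1# , coeff≈ (≋-sym (*ₚ-identityˡ h))))
    g≈v = proj₂ (proj₂ chain)
    conj = conjugates τ≉0 (proj₁ (proj₂ chain))
    θ≉0 : ¬ θ (suc k) F.≈ F.0#
    θ≉0 -σ≈0 = σ≉0 k F.0# (F.trans (F.sym (F.-‿involutive _)) (F.trans (F.-‿cong -σ≈0) F.-0#≈0#))
    -- As `θ (suc k)` is the trace of `v` down to F, this scaling gives `b v` the trace `ξ`. The
    -- division is legitimate because no value of `σ` vanishes.
    b = ξ F.* θ (suc k) F.⁻¹
    bθ≈ξ : b F.* θ (suc k) F.≈ ξ
    bθ≈ξ = F.trans (F.*-assoc _ _ _) (F.trans (F.*-congˡ (F.trans (F.*-comm _ _) (F.⁻¹-inverse _ θ≉0))) (F.*-identityʳ ξ))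
    K = p ℕ.^ suc k ℕ.* e
    T : Poly
    T = PA.S 1 K ((constP b *ₚ PA.gᴬ Xₚ) *ₚ Xₚ)
    T≈ : T ≈ trace b K Xₚ
    T≈ = trans (sym (eval-X≈ T)) (eval-trace b K Xₚ)
    h[X+1]≈0 : eval h (Xₚ + 1#) ≈ 0#
    h[X+1]≈0 = trans (proj₂ (eval-iterΦ (suc (suc k)) (Xₚ + 1#))) (trans (proj₂ (denom-translate (suc k) Xₚ))
      (denom≈0 (suc (suc k)) (constP F.1# , coeff≈ (≋-sym (*ₚ-identityˡ h)))))
    -- The automorphism is replaced by evaluation at `Xₚ + 1`, again a root of `h`. A congruence of
    -- `T` with a constant says that `h` divides the difference, so it survives the evaluation, yet
    -- `T` gains the trace of `ξ`.
    T≉i : ∀ i → i < p → ¬ T ≈ i · 1#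
    T≉i i _ T≈i = tr-ξ≉0 (ι-injective algebra (1≉0 h D-irred) (begin
      ι (tr ξ)                                 ≈⟨ solve 2 (λ s t → t := (s :+ t) :- s) refl T (ι (tr ξ)) ⟩
      (T + ι (tr ξ)) + - T                     ≈⟨ +-cong (+-congʳ T≈) (-‿cong T≈i) ⟩
      (trace b K Xₚ + ι (tr ξ)) + - (i · 1#)   ≈⟨ +-congʳ (trace-translate conj Xₚ g≈v τ≈0 b bθ≈ξ) ⟨
      trace b K (Xₚ + 1#) + - (i · 1#)         ≈⟨ +-cong (eval-trace b K (Xₚ + 1#)) (-‿cong eval-i) ⟨
      eval T (Xₚ + 1#) + - eval C (Xₚ + 1#)    ≈⟨ trans (eval-+ T (-ₚ C) (Xₚ + 1#)) (+-congˡ (eval-neg C (Xₚ + 1#))) ⟨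
      eval (T +ₚ (-ₚ C)) (Xₚ + 1#)             ≈⟨ eval-≋ (F.∣ₚ⇒≋ (T +ₚ (-ₚ C)) h∣T-C) (Xₚ + 1#) ⟩
      eval (proj₁ h∣T-C *ₚ h) (Xₚ + 1#)        ≈⟨ trans (eval-* (proj₁ h∣T-C) h (Xₚ + 1#)) (trans (*-cong (refl {E}) h[X+1]≈0) (zeroʳ E)) ⟩
      0#                                       ∎))
      where
      open import Relation.Binary.Reasoning.Setoid setoid
      C = constP (i F.· F.1#)
      eval-i : eval C (Xₚ + 1#) ≈ i · 1#
      eval-i = trans (eval-constP _ (Xₚ + 1#)) (ι-· i)
      h∣T-C : h ∣ₚ (T +ₚ (-ₚ C))
      h∣T-C = ≈0⇒∣ (x≈y⇒x-y≈0 (trans T≈i (sym (ι-· i))))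
      E = eval (proj₁ h∣T-C) (Xₚ + 1#)

  stable⇒traces-nonzero : InverselyStable gᴾ → ∀ n → ¬ tr (θ n) F.≈ F.0#
  stable⇒traces-nonzero (irreducible , _) n = go (suc n) n (ℕ.n<1+n n)
    where
    -- Strong induction through the bound `m`: the irreducibility argument at one level needs all
    -- earlier traces to be nonzero.
    go : ∀ m i → i < m → ¬ tr (θ i) F.≈ F.0#
    go (suc m) zero    _         tr≈0 = tr-ξ≉0 (F.trans (F.sym (F.-‿involutive _))
      (F.trans (F.-‿cong (F.trans (F.sym (F.S-neg 1 e ξ)) tr≈0)) F.-0#≈0#))
    go (suc m) (suc i) (s≤s i<m) = irreducible⇒trace-nonzero i (λ j j<1+i → go m j (ℕ.≤-trans j<1+i i<m))
      (irreducible (suc (suc i)) (s≤s z≤n) (Dᵖ (suc (suc i))) (Dᵖ-denominator (suc i)))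

open Data.Nat using (_^_)

theorem1p2 : {c ℓ : Level} (F : Field c ℓ) (p e : ℕ) → Prime p → 1 ≤ e →
    FieldTheory.HasCardinality F (p ^ e) →
    (ξ : Field.Carrier F) →
    ¬ (Field._≈_ F (FieldTheory.Tr F p e ξ) (Field.0# F)) →
    FieldTheory.InverselyStable F (FieldTheory.gPoly F p ξ)
    ⇔ (∀ n → 1 ≤ n →
    ¬ (Field._≈_ F
    (FieldTheory.Tr F p e
    (Field._*_ F (FieldTheory.aₙ F p ξ n)
    (Field._⁻¹ F (FieldTheory.cₙ F p ξ n))))
    (Field.0# F)))
theorem1p2 F p e p-prime _ card ξ Tr-ξ≉0 = mk⇔
  (λ { stable (suc n) _ Tr≈0 → stable⇒traces-nonzero stable n
         (trans (sym (-‿involutive _)) (trans (-‿cong (trans (sym (Tr[aₙ/cₙ]≈-tr-θ n)) Tr≈0)) -0#≈0#)) })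
  (λ Tr≉0 → traces-nonzero⇒stable (λ n tr≈0 → Tr≉0 (suc n) (s≤s z≤n)
    (trans (Tr[aₙ/cₙ]≈-tr-θ n) (trans (-‿cong tr≈0) -0#≈0#))))
  where
  open Field F using (commutativeRing; trans; sym; -‿cong)
  open RingTools commutativeRing using (-‿involutive; -0#≈0#)
  tr-ξ≉0 : ¬ Field._≈_ F (Setup.tr F p e p-prime card ξ) (Field.0# F)
  tr-ξ≉0 tr≈0 = Tr-ξ≉0 (trans (FiniteFieldChar.Tr≈S F p e p-prime card e ξ) tr≈0)
  open Denominators F p e p-prime card ξ tr-ξ≉0
  open Converse F p e p-prime card ξ tr-ξ≉0
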